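{- Let $n\ge 0$ be an integer, and let $p,q\in\mathbb{R}[t]$ be polynomials of degree at most $2$ such that $\{p,q,1\}$ is linearly independent over $\mathbb{R}$ (equivalently, the convex curve $C=\{(p(t),q(t)) : t\in\mathbb{R}\}$ is not contained in a line). Let $a,b\in\mathbb{R}$ with $b\neq 0$, and let $v_i:=(p(a+ib),\,q(a+ib))\in\mathbb{R}^2$ for $i=0,1,\dots,n+2$ be equally-spaced points on $C$. Let $Q:=\mathrm{conv}\{v_0,\dots,v_{n+2}\}$, a convex $(n+3)$-gon with vertices $v_0,\dots,v_{n+2}$. Let $e_1,\dots,e_{n+2}$ be the standard basis of $\mathbb{R}^{n+2}$ and put $f_i:=e_1+\dots+e_i$ for $i=0,\dots,n+2$ (so $f_0=0$). Then all vertices of the secondary polytope $$\mathrm{Ass}_n(Q)=\mathrm{conv}\Big\{\sum_{i=0}^{n+2}\ \sum_{\sigma\in T\,:\,i\in\sigma}\mathrm{vol}(\sigma)\,f_i \ :\ T\text{ is a triangulation of }Q\Big\}\subset\mathbb{R}^{n+2}$$ lie on one common sphere centered at the origin; that is, they all have the same Euclidean norm.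
   Context: A triangulation $T$ of the convex polygon $Q$ with vertices $v_0,\dots,v_{n+2}$ is a subdivision of $Q$ into triangles by pairwise non-crossing diagonals, using only the vertices of $Q$ as vertices. It is regarded as the set of its triangles $\sigma$. The notation $i\in\sigma$ means that $v_i$ is a vertex of the triangle $\sigma$, and $\mathrm{vol}(\sigma)$ is the Euclidean area of $\sigma$. The points $f_0,\dots,f_{n+2}$ are the vertices of an $(n+2)$-dimensional simplex. -}

module Defs where

open import Algebra.Bundles.Raw using (RawRing)
open import Data.Bool.Base using (if_then_else_)
open import Data.Fin.Base as Fin using (Fin; Fin′; zero; suc; toℕ; inject!)
import Data.Fin.Properties as Fin
open import Data.List.Base as List using (List; filter)
open import Data.List.Membership.Propositional using (_∈_)
open import Data.List.Relation.Unary.Any using (Any)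
open import Data.List.Relation.Unary.Unique.Propositional using (Unique)
open import Data.Nat.Base as ℕ using (ℕ)
import Data.Nat.Properties as ℕ
open import Data.Product.Base using (∃-syntax; Σ-syntax; _×_; _,_)
open import Data.Rational.Base as ℚ using (ℚ; 0ℚ; 1ℚ; ½)
import Data.Rational.Properties as ℚ
open import Data.Rational.Solver using (module +-*-Solver)
open import Data.Sum.Base using (inj₁; inj₂)
open import Data.Vec.Functional using (Vector; []; _∷_)
open import Data.Vec.Functional.Relation.Binary.Pointwise using (Pointwise)
open import Function.Base using (_∘_)
open import Level using (0ℓ)
open import Relation.Binary.PropositionalEquality
  using (_≡_; refl; sym; trans; cong; cong₂; subst; subst₂)
open import Relation.Nullary using (¬_; Dec; does)
open import Relation.Unary using (Pred)

-- ℝ is the setoid of Cauchy sequences of rationals; real equality is _≃_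
-- below (the difference tends to zero), not propositional equality.

IsCauchy : (ℕ → ℚ) → Set
IsCauchy x = ∀ ε → 0ℚ ℚ.< ε →
  ∃[ N ] (∀ m n → N ℕ.≤ m → N ℕ.≤ n → ℚ.∣ x m ℚ.- x n ∣ ℚ.< ε)

record ℝ : Set where
  constructor mkℝ
  field
    seq    : ℕ → ℚ
    cauchy : IsCauchy seq

open ℝ public

infix 4 _≃_ _≤_ _<_

_≃_ : ℝ → ℝ → Set
x ≃ y = ∀ ε → 0ℚ ℚ.< ε →
  ∃[ N ] (∀ n → N ℕ.≤ n → ℚ.∣ seq x n ℚ.- seq y n ∣ ℚ.< ε)

_≤_ : ℝ → ℝ → Set
x ≤ y = ∀ ε → 0ℚ ℚ.< ε →
  ∃[ N ] (∀ n → N ℕ.≤ n → seq x n ℚ.- seq y n ℚ.< ε)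

-- The gap ε is uniform: pointwise strict inequality of representatives
-- would not be invariant under _≃_.
_<_ : ℝ → ℝ → Set
x < y = ∃[ ε ] 0ℚ ℚ.< ε ×
  ∃[ N ] (∀ n → N ℕ.≤ n → ε ℚ.≤ seq y n ℚ.- seq x n)

-- Abstract because the normal forms of these proofs are enormous and never
-- matter.
abstract
  half-pos : ∀ {ε} → 0ℚ ℚ.< ε → 0ℚ ℚ.< ε ℚ.* ½
  half-pos {ε} = ℚ.*-monoˡ-<-pos ½

  halves : ∀ ε → ε ℚ.* ½ ℚ.+ ε ℚ.* ½ ≡ ε
  halves ε = trans (sym (ℚ.*-distribˡ-+ ε ½ ½)) (ℚ.*-identityʳ ε)

  const-cauchy : ∀ c → IsCauchy (λ _ → c)
  const-cauchy c ε 0<ε = 0 , λ _ _ _ _ →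
    subst (ℚ._< ε) (sym (cong ℚ.∣_∣ (ℚ.+-inverseʳ c))) 0<ε

  +-cauchy : ∀ {x y} → IsCauchy x → IsCauchy y → IsCauchy (λ n → x n ℚ.+ y n)
  +-cauchy {x} {y} cx cy ε 0<ε
    with M , hx ← cx (ε ℚ.* ½) (half-pos 0<ε)
       | N , hy ← cy (ε ℚ.* ½) (half-pos 0<ε) = M ℕ.⊔ N , λ m n m≥ n≥ → begin-strict
    ℚ.∣ (x m ℚ.+ y m) ℚ.- (x n ℚ.+ y n) ∣
      ≡⟨ cong ℚ.∣_∣ (regroup (x m) (y m) (x n) (y n)) ⟩
    ℚ.∣ (x m ℚ.- x n) ℚ.+ (y m ℚ.- y n) ∣
      ≤⟨ ℚ.∣p+q∣≤∣p∣+∣q∣ (x m ℚ.- x n) (y m ℚ.- y n) ⟩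
    ℚ.∣ x m ℚ.- x n ∣ ℚ.+ ℚ.∣ y m ℚ.- y n ∣
      <⟨ ℚ.+-mono-< (hx m n (ℕ.m⊔n≤o⇒m≤o M N m≥) (ℕ.m⊔n≤o⇒m≤o M N n≥))
                    (hy m n (ℕ.m⊔n≤o⇒n≤o M N m≥) (ℕ.m⊔n≤o⇒n≤o M N n≥)) ⟩
    ε ℚ.* ½ ℚ.+ ε ℚ.* ½
      ≡⟨ halves ε ⟩
    ε ∎
    where
    open ℚ.≤-Reasoning
    open +-*-Solver
    regroup : ∀ a b c d → (a ℚ.+ b) ℚ.- (c ℚ.+ d) ≡ (a ℚ.- c) ℚ.+ (b ℚ.- d)
    regroup = solve 4 (λ a b c d → (a :+ b) :- (c :+ d) := (a :- c) :+ (b :- d)) refl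

  neg-cauchy : ∀ {x} → IsCauchy x → IsCauchy (λ n → ℚ.- x n)
  neg-cauchy {x} cx ε 0<ε with N , hx ← cx ε 0<ε = N , λ m n m≥ n≥ →
    subst (ℚ._< ε)
      (trans (sym (ℚ.∣-p∣≡∣p∣ (x m ℚ.- x n))) (cong ℚ.∣_∣ (ℚ.neg-distrib-+ (x m) (ℚ.- x n))))
      (hx m n m≥ n≥)

  ∣a∣-∣b∣≤∣a-b∣ : ∀ a b → ℚ.∣ a ∣ ℚ.- ℚ.∣ b ∣ ℚ.≤ ℚ.∣ a ℚ.- b ∣
  ∣a∣-∣b∣≤∣a-b∣ a b = begin
    ℚ.∣ a ∣ ℚ.- ℚ.∣ b ∣
      ≡⟨ cong (λ z → ℚ.∣ z ∣ ℚ.- ℚ.∣ b ∣) (solve 2 (λ a b → a := (a :- b) :+ b) refl a b) ⟩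
    ℚ.∣ (a ℚ.- b) ℚ.+ b ∣ ℚ.- ℚ.∣ b ∣
      ≤⟨ ℚ.+-monoˡ-≤ (ℚ.- ℚ.∣ b ∣) (ℚ.∣p+q∣≤∣p∣+∣q∣ (a ℚ.- b) b) ⟩
    ℚ.∣ a ℚ.- b ∣ ℚ.+ ℚ.∣ b ∣ ℚ.- ℚ.∣ b ∣
      ≡⟨ solve 2 (λ u v → u :+ v :- v := u) refl ℚ.∣ a ℚ.- b ∣ ℚ.∣ b ∣ ⟩
    ℚ.∣ a ℚ.- b ∣ ∎
    where
    open ℚ.≤-Reasoning
    open +-*-Solver

  ∣∣-lipschitz : ∀ a b → ℚ.∣ ℚ.∣ a ∣ ℚ.- ℚ.∣ b ∣ ∣ ℚ.≤ ℚ.∣ a ℚ.- b ∣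
  ∣∣-lipschitz a b with ℚ.∣p∣≡p∨∣p∣≡-p (ℚ.∣ a ∣ ℚ.- ℚ.∣ b ∣)
  ... | inj₁ eq = subst (ℚ._≤ ℚ.∣ a ℚ.- b ∣) (sym eq) (∣a∣-∣b∣≤∣a-b∣ a b)
  ... | inj₂ eq = subst₂ ℚ._≤_
    (trans (swap ℚ.∣ b ∣ ℚ.∣ a ∣) (sym eq))
    (trans (cong ℚ.∣_∣ (swap b a)) (ℚ.∣-p∣≡∣p∣ (a ℚ.- b)))
    (∣a∣-∣b∣≤∣a-b∣ b a)
    where
    open +-*-Solver
    swap : ∀ u v → u ℚ.- v ≡ ℚ.- (v ℚ.- u)
    swap = solve 2 (λ u v → u :- v := :- (v :- u)) refl

  ∣∣-cauchy : ∀ {x} → IsCauchy x → IsCauchy (λ n → ℚ.∣ x n ∣)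
  ∣∣-cauchy {x} cx ε 0<ε with N , hx ← cx ε 0<ε = N , λ m n m≥ n≥ →
    ℚ.≤-<-trans (∣∣-lipschitz (x m) (x n)) (hx m n m≥ n≥)

  eventuallyBounded : ∀ {x} → IsCauchy x →
    ∃[ B ] 0ℚ ℚ.< B × ∃[ N ] (∀ n → N ℕ.≤ n → ℚ.∣ x n ∣ ℚ.≤ B)
  eventuallyBounded {x} cx with N , hx ← cx 1ℚ (ℚ.positive⁻¹ 1ℚ) =
    1ℚ ℚ.+ ℚ.∣ x N ∣ , 0<B , N , λ n n≥ → begin
      ℚ.∣ x n ∣
        ≡⟨ cong ℚ.∣_∣ (solve 2 (λ u v → u := (u :- v) :+ v) refl (x n) (x N)) ⟩
      ℚ.∣ (x n ℚ.- x N) ℚ.+ x N ∣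
        ≤⟨ ℚ.∣p+q∣≤∣p∣+∣q∣ (x n ℚ.- x N) (x N) ⟩
      ℚ.∣ x n ℚ.- x N ∣ ℚ.+ ℚ.∣ x N ∣
        ≤⟨ ℚ.+-monoˡ-≤ ℚ.∣ x N ∣ (ℚ.<⇒≤ (hx n N n≥ ℕ.≤-refl)) ⟩
      1ℚ ℚ.+ ℚ.∣ x N ∣ ∎
    where
    open ℚ.≤-Reasoning
    open +-*-Solver
    0<B : 0ℚ ℚ.< 1ℚ ℚ.+ ℚ.∣ x N ∣
    0<B = ℚ.+-mono-<-≤ (ℚ.positive⁻¹ 1ℚ) (ℚ.0≤∣p∣ (x N))

  ∣ab-cd∣≤ : ∀ a b c d {A B} → ℚ.∣ a ∣ ℚ.≤ A → ℚ.∣ d ∣ ℚ.≤ B →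
    ℚ.∣ a ℚ.* b ℚ.- c ℚ.* d ∣ ℚ.≤ A ℚ.* ℚ.∣ b ℚ.- d ∣ ℚ.+ ℚ.∣ a ℚ.- c ∣ ℚ.* B
  ∣ab-cd∣≤ a b c d {A} {B} a≤A d≤B = begin
    ℚ.∣ a ℚ.* b ℚ.- c ℚ.* d ∣
      ≡⟨ cong ℚ.∣_∣ (split a b c d) ⟩
    ℚ.∣ a ℚ.* (b ℚ.- d) ℚ.+ (a ℚ.- c) ℚ.* d ∣
      ≤⟨ ℚ.∣p+q∣≤∣p∣+∣q∣ (a ℚ.* (b ℚ.- d)) ((a ℚ.- c) ℚ.* d) ⟩
    ℚ.∣ a ℚ.* (b ℚ.- d) ∣ ℚ.+ ℚ.∣ (a ℚ.- c) ℚ.* d ∣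
      ≡⟨ cong₂ ℚ._+_ (ℚ.∣p*q∣≡∣p∣*∣q∣ a (b ℚ.- d)) (ℚ.∣p*q∣≡∣p∣*∣q∣ (a ℚ.- c) d) ⟩
    ℚ.∣ a ∣ ℚ.* ℚ.∣ b ℚ.- d ∣ ℚ.+ ℚ.∣ a ℚ.- c ∣ ℚ.* ℚ.∣ d ∣
      ≤⟨ ℚ.+-mono-≤
           (ℚ.*-monoʳ-≤-nonNeg ℚ.∣ b ℚ.- d ∣ {{ℚ.nonNegative (ℚ.0≤∣p∣ (b ℚ.- d))}} a≤A)
           (ℚ.*-monoˡ-≤-nonNeg ℚ.∣ a ℚ.- c ∣ {{ℚ.nonNegative (ℚ.0≤∣p∣ (a ℚ.- c))}} d≤B) ⟩
    A ℚ.* ℚ.∣ b ℚ.- d ∣ ℚ.+ ℚ.∣ a ℚ.- c ∣ ℚ.* B ∎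
    where
    open ℚ.≤-Reasoning
    open +-*-Solver
    split : ∀ a b c d → a ℚ.* b ℚ.- c ℚ.* d ≡ a ℚ.* (b ℚ.- d) ℚ.+ (a ℚ.- c) ℚ.* d
    split = solve 4 (λ a b c d → a :* b :- c :* d := a :* (b :- d) :+ (a :- c) :* d) refl

  divide : ∀ C ε → 0ℚ ℚ.< C → 0ℚ ℚ.< ε → ∃[ δ ] 0ℚ ℚ.< δ × C ℚ.* δ ≡ ε
  divide C ε 0<C 0<ε = C⁻¹ ℚ.* ε , 0<δ , Cδ≡ε
    where
    C-pos : ℚ.Positive C
    C-pos = ℚ.positive 0<C
    C-nonZero : ℚ.NonZero C
    C-nonZero = ℚ.pos⇒nonZero C {{C-pos}}
    C⁻¹ : ℚ
    C⁻¹ = ℚ.1/_ C {{C-nonZero}}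
    0<δ : 0ℚ ℚ.< C⁻¹ ℚ.* ε
    0<δ = subst (ℚ._< C⁻¹ ℚ.* ε) (ℚ.*-zeroʳ C⁻¹)
            (ℚ.*-monoʳ-<-pos C⁻¹ {{ℚ.1/pos⇒pos C {{C-pos}}}} 0<ε)
    Cδ≡ε : C ℚ.* (C⁻¹ ℚ.* ε) ≡ ε
    Cδ≡ε = trans (sym (ℚ.*-assoc C C⁻¹ ε))
      (trans (cong (ℚ._* ε) (ℚ.*-inverseʳ C {{C-nonZero}})) (ℚ.*-identityˡ ε))

  products-close : ∀ a b c d A B δ → 0ℚ ℚ.< A → 0ℚ ℚ.< B →
    ℚ.∣ a ∣ ℚ.≤ A → ℚ.∣ d ∣ ℚ.≤ B → ℚ.∣ a ℚ.- c ∣ ℚ.< δ → ℚ.∣ b ℚ.- d ∣ ℚ.< δ →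
    ℚ.∣ a ℚ.* b ℚ.- c ℚ.* d ∣ ℚ.< (A ℚ.+ B) ℚ.* δ
  products-close a b c d A B δ 0<A 0<B a≤A d≤B ac bd = begin-strict
    ℚ.∣ a ℚ.* b ℚ.- c ℚ.* d ∣
      ≤⟨ ∣ab-cd∣≤ a b c d a≤A d≤B ⟩
    A ℚ.* ℚ.∣ b ℚ.- d ∣ ℚ.+ ℚ.∣ a ℚ.- c ∣ ℚ.* B
      <⟨ ℚ.+-mono-< (ℚ.*-monoʳ-<-pos A {{ℚ.positive 0<A}} bd)
                    (ℚ.*-monoˡ-<-pos B {{ℚ.positive 0<B}} ac) ⟩
    A ℚ.* δ ℚ.+ δ ℚ.* B
      ≡⟨ cong (A ℚ.* δ ℚ.+_) (ℚ.*-comm δ B) ⟩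
    A ℚ.* δ ℚ.+ B ℚ.* δ
      ≡⟨ ℚ.*-distribʳ-+ δ A B ⟨
    (A ℚ.+ B) ℚ.* δ ∎
    where open ℚ.≤-Reasoning

  *-cauchy : ∀ {x y} → IsCauchy x → IsCauchy y → IsCauchy (λ n → x n ℚ.* y n)
  *-cauchy {x} {y} cx cy ε 0<ε = go (eventuallyBounded cx) (eventuallyBounded cy)
    where
    Bounded : (ℕ → ℚ) → Set
    Bounded z = ∃[ B ] 0ℚ ℚ.< B × ∃[ N ] (∀ n → N ℕ.≤ n → ℚ.∣ z n ∣ ℚ.≤ B)

    Close : (ℕ → ℚ) → ℚ → Set
    Close z δ = ∃[ N ] (∀ m n → N ℕ.≤ m → N ℕ.≤ n → ℚ.∣ z m ℚ.- z n ∣ ℚ.< δ)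

    combine : ∀ A B δ → 0ℚ ℚ.< A → 0ℚ ℚ.< B → (A ℚ.+ B) ℚ.* δ ≡ ε →
      ∀ K → (∀ n → K ℕ.≤ n → ℚ.∣ x n ∣ ℚ.≤ A) →
      ∀ L → (∀ n → L ℕ.≤ n → ℚ.∣ y n ∣ ℚ.≤ B) →
      Close x δ → Close y δ → Close (λ n → x n ℚ.* y n) ε
    combine A B δ 0<A 0<B total K boundX L boundY (M , hx) (N , hy) =
      (K ℕ.⊔ L) ℕ.⊔ (M ℕ.⊔ N) , λ m n m≥ n≥ →
      let K≤m = ℕ.m⊔n≤o⇒m≤o K L (ℕ.m⊔n≤o⇒m≤o (K ℕ.⊔ L) (M ℕ.⊔ N) m≥)
          L≤n = ℕ.m⊔n≤o⇒n≤o K L (ℕ.m⊔n≤o⇒m≤o (K ℕ.⊔ L) (M ℕ.⊔ N) n≥)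
          MN≤m = ℕ.m⊔n≤o⇒n≤o (K ℕ.⊔ L) (M ℕ.⊔ N) m≥
          MN≤n = ℕ.m⊔n≤o⇒n≤o (K ℕ.⊔ L) (M ℕ.⊔ N) n≥
      in subst (ℚ.∣ x m ℚ.* y m ℚ.- x n ℚ.* y n ∣ ℚ.<_) total
           (products-close (x m) (y m) (x n) (y n) A B δ 0<A 0<B
             (boundX m K≤m) (boundY n L≤n)
             (hx m n (ℕ.m⊔n≤o⇒m≤o M N MN≤m) (ℕ.m⊔n≤o⇒m≤o M N MN≤n))
             (hy m n (ℕ.m⊔n≤o⇒n≤o M N MN≤m) (ℕ.m⊔n≤o⇒n≤o M N MN≤n)))

    go : Bounded x → Bounded y → Close (λ n → x n ℚ.* y n) ε
    go (A , 0<A , K , boundX) (B , 0<B , L , boundY) =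
      let δ , 0<δ , total = divide (A ℚ.+ B) ε (ℚ.+-mono-< 0<A 0<B) 0<ε
      in combine A B δ 0<A 0<B total K boundX L boundY (cx δ 0<δ) (cy δ 0<δ)

infixl 6 _+_ _-_
infixl 7 _*_
infix  8 -_

fromℚ : ℚ → ℝ
fromℚ c = mkℝ (λ _ → c) (const-cauchy c)

0ℝ 1ℝ : ℝ
0ℝ = fromℚ 0ℚ
1ℝ = fromℚ 1ℚ

_+_ _*_ : ℝ → ℝ → ℝ
x + y = mkℝ (λ n → seq x n ℚ.+ seq y n) (+-cauchy {seq x} {seq y} (cauchy x) (cauchy y))
x * y = mkℝ (λ n → seq x n ℚ.* seq y n) (*-cauchy {seq x} {seq y} (cauchy x) (cauchy y))

-_ ∣_∣ : ℝ → ℝ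
- x   = mkℝ (λ n → ℚ.- seq x n) (neg-cauchy {seq x} (cauchy x))
∣ x ∣ = mkℝ (λ n → ℚ.∣ seq x n ∣) (∣∣-cauchy {seq x} (cauchy x))

_-_ : ℝ → ℝ → ℝ
x - y = x + (- y)

ℝ-rawRing : RawRing 0ℓ 0ℓ
ℝ-rawRing = record
  { Carrier = ℝ ; _≈_ = _≃_ ; _+_ = _+_ ; _*_ = _*_ ; -_ = -_ ; 0# = 0ℝ ; 1# = 1ℝ }

open import Algebra.Definitions.RawSemiring (RawRing.rawSemiring ℝ-rawRing) public
  using (sum; _^_)
  renaming (_×_ to _·_)

sumList : List ℝ → ℝ
sumList = List.foldr _+_ 0ℝ

Point : ℕ → Set
Point = Vector ℝ

infix 4 _≈_

_≈_ : ∀ {d} → Point d → Point d → Set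
_≈_ = Pointwise _≃_

combination : ∀ {m d} → Vector ℝ m → Vector (Point d) m → Point d
combination w φ k = sum (λ j → w j * φ j k)

-- The convex hull of an arbitrarily indexed family of points.
Conv : ∀ {I : Set} {d} → (I → Point d) → Pred (Point d) 0ℓ
Conv {I} φ x = ∃[ m ] Σ[ w ∈ Vector ℝ m ] Σ[ s ∈ Vector I m ]
  (∀ j → 0ℝ ≤ w j) × sum w ≃ 1ℝ × x ≈ combination w (φ ∘ s)

-- The relative interior of the convex hull of a finite family: the points
-- all of whose weights can be taken positive.
RelInt : ∀ {m d} → Vector (Point d) m → Pred (Point d) 0ℓ
RelInt {m} φ x = Σ[ w ∈ Vector ℝ m ]
  (∀ j → 0ℝ < w j) × sum w ≃ 1ℝ × x ≈ combination w φ

-- For a polytope, vertices are the same as extreme points.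
IsVertex : ∀ {d} → Pred (Point d) 0ℓ → Pred (Point d) 0ℓ
IsVertex P x = P x × (∀ {y z} t → P y → P z → 0ℝ < t → t < 1ℝ →
  x ≈ (λ k → t * y k + (1ℝ - t) * z k) → y ≈ x × z ≈ x)

-- For r ≥ 0 this says that x has Euclidean norm r.
OnSphere : ∀ {d} → ℝ → Pred (Point d) 0ℓ
OnSphere r x = sum (λ k → x k ^ 2) ≃ r ^ 2

-- Polynomials of degree at most 2, by coefficients, constant term first.

Poly₂ : Set
Poly₂ = Vector ℝ 3

eval : Poly₂ → ℝ → ℝ
eval p t = sum (λ k → p k * t ^ toℕ k)

1ₚ : Poly₂
1ₚ = 1ℝ ∷ 0ℝ ∷ 0ℝ ∷ []

LinearlyIndependent : ∀ {m d} → Vector (Vector ℝ d) m → Set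
LinearlyIndependent φ = ∀ c → combination c φ ≈ (λ _ → 0ℝ) → ∀ j → c j ≃ 0ℝ

curvePoint : Poly₂ → Poly₂ → ℝ → Point 2
curvePoint p q t = eval p t ∷ eval q t ∷ []

-- v i = (p (a + i b) , q (a + i b)); m · b is the m-fold sum of b.
equallySpaced : Poly₂ → Poly₂ → ℝ → ℝ → ∀ {N} → Vector (Point 2) N
equallySpaced p q a b i = curvePoint p q (a + toℕ i · b)

-- A triangle is given by the increasing list of the indices of its corners.
record Triangle (N : ℕ) : Set where
  constructor triangle
  field
    i j k : Fin N
    i<j   : i Fin.< j
    j<k   : j Fin.< k

corner : ∀ {N} → Triangle N → Vector (Fin N) 3
corner σ = i ∷ j ∷ k ∷ []
  where open Triangle σ

infix 4 _∈ᵗ_ _∈ᵗ?_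

_∈ᵗ_ : ∀ {N} → Fin N → Triangle N → Set
i ∈ᵗ σ = ∃[ m ] corner σ m ≡ i

_∈ᵗ?_ : ∀ {N} (i : Fin N) (σ : Triangle N) → Dec (i ∈ᵗ σ)
i ∈ᵗ? σ = Fin.any? (λ m → corner σ m Fin.≟ i)

-- (i , j) with i < j is one of the three sides of σ.
IsSide : ∀ {N} → Fin N × Fin N → Triangle N → Set
IsSide (i , j) σ = i Fin.< j × i ∈ᵗ σ × j ∈ᵗ σ

module _ {N : ℕ} (v : Vector (Point 2) N) where

  corners : Triangle N → Vector (Point 2) 3
  corners σ = v ∘ corner σ

  segment : Fin N × Fin N → Vector (Point 2) 2
  segment (i , j) = v i ∷ v j ∷ []

  -- Half the absolute value of the determinant of two edge vectors.
  vol : Triangle N → ℝ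
  vol σ = fromℚ ½ * ∣ (x j - x i) * (y k - y i) - (x k - x i) * (y j - y i) ∣
    where
    open Triangle σ
    x y : Fin N → ℝ
    x l = v l zero
    y l = v l (suc zero)

  -- T subdivides Q = conv (v 0 , … , v (N - 1)) into triangles whose sides
  -- (diagonals or edges of Q) do not cross, i.e. two different sides share no
  -- relatively interior point.
  record IsTriangulation (T : List (Triangle N)) : Set where
    field
      distinct : Unique T

      -- Membership in a union of closed triangles is stated up to double
      -- negation: for points on a common side one cannot, constructively,
      -- select one of the triangles.
      covers : ∀ (x : Point 2) → Conv v x → ¬ ¬ Any (λ σ → Conv (corners σ) x) T

      interiorsDisjoint : ∀ {σ τ} → σ ∈ T → τ ∈ T → ¬ (σ ≡ τ) →
        ∀ (x : Point 2) → ¬ (RelInt (corners σ) x × RelInt (corners τ) x)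

      nonCrossing : ∀ {σ τ} → σ ∈ T → τ ∈ T →
        ∀ {d e} → IsSide d σ → IsSide e τ → ¬ (d ≡ e) →
        ∀ (x : Point 2) → ¬ (RelInt (segment d) x × RelInt (segment e) x)

  record Triangulation : Set where
    field
      triangles       : List (Triangle N)
      isTriangulation : IsTriangulation triangles

-- Standard basis; the coordinate numbered k is the (k+1)-st one.
e : ∀ {d} → Fin d → Point d
e j k = if does (j Fin.≟ k) then 1ℝ else 0ℝ

-- f i = e₁ + ⋯ + eᵢ
f : ∀ {d} → Fin (ℕ.suc d) → Point d
f i k = sum (λ (j : Fin′ i) → e (inject! j) k)

module _ {d : ℕ} (v : Vector (Point 2) (ℕ.suc d)) where

  -- ∑ᵢ ∑_{σ ∈ T , i ∈ σ} vol σ · fᵢ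
  areaVector : Triangulation v → Point d
  areaVector T k = sum λ i →
    sumList (List.map (λ σ → vol v σ * f i k) (filter (i ∈ᵗ?_) triangles))
    where open Triangulation T

  SecondaryPolytope : Pred (Point d) 0ℓ
  SecondaryPolytope = Conv areaVector

{-# OPTIONS --safe #-}

-- With D = p₁ q₂ - p₂ q₁, the triangle on v i, v j, v k (i < j < k) has area
-- ½∣D b³∣ (j - i)(k - i)(k - j), so up to this factor everything is an integer
-- depending only on the combinatorics of T.
--
-- Cut a triangulation of the subpolygon on the vertices i, …, j along the two
-- sides of its triangle (i, k, j).  The coordinates numbered i ≤ l < k of its
-- area vector are those of the left part plus a constant, and those numbered
-- k ≤ l < j are those of the right part plus a constant; both constants depend
-- only on k - i and j - k.  By induction the sum of the coordinates and the
-- sum of their squares are polynomials in j - i, independent of T.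
--
-- The geometric definition of a triangulation yields this recursive structure:
-- sides do not cross, and below every chord i j there is a triangle (i, k, j),
-- namely the one covering the centroid of v i, v (i + 1), v j.  Finally, a
-- vertex of the convex hull of the area vectors is itself an area vector.
-- This last fact is needed only up to double negation, since equality of
-- reals is stable.

module Submission where

open import Defs
open import Algebra.Bundles using (CommutativeRing)
import Algebra.Properties.Semiring.Sum
open import Data.Bool.Base using (if_then_else_)
open import Data.Empty using (⊥-elim)
open import Data.Fin.Base as Fin using (Fin; inject!; zero; suc; toℕ; fromℕ<)
import Data.Fin.Properties as Fin
import Data.Integer.Base as ℤ
import Data.Integer.Properties as ℤ
open import Data.List.Base as List using (List; _++_; filter)
open import Data.List.Membership.Propositional using (_∈_; find)
open import Data.List.Membership.Propositional.Properties using (∈-++⁺ˡ; ∈-++⁺ʳ; ∈-++⁻)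
open import Data.List.Membership.Propositional.Properties.WithK using (unique∧set⇒bag)
open import Data.List.Relation.Binary.BagAndSetEquality using (∼bag⇒↭)
open import Data.List.Relation.Binary.Permutation.Propositional using (_↭_)
open import Data.List.Relation.Unary.All as All using (All)
import Data.List.Relation.Unary.All.Properties as All
open import Data.List.Relation.Unary.AllPairs as AllPairs using ()
open import Data.List.Relation.Unary.Any as Any using (here; there)
open import Data.List.Relation.Unary.Unique.Propositional using (Unique)
import Data.List.Relation.Unary.Unique.Propositional.Properties as Unique
open import Data.Nat.Base as ℕ using (ℕ; zero; suc)
import Data.Nat.Properties as ℕ
open import Data.Product.Base using (_×_; ∃-syntax; _,_; proj₁; proj₂)
open import Data.Rational.Base as ℚ using (ℚ; mkℚ; 0ℚ; 1ℚ; ½)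
import Data.Rational.Properties as ℚ
open import Data.Rational.Solver using (module +-*-Solver)
import Data.Rational.Unnormalised.Base as ℚᵘ
import Data.Rational.Unnormalised.Properties as ℚᵘ
open import Data.Sum.Base using (_⊎_; inj₁; inj₂)
open import Data.Vec.Functional using (Vector; []; _∷_)
open import Function.Base using (_∘_)
open import Function.Bundles using (mk⇔)
open import Relation.Binary.Definitions using (tri<; tri≈; tri>)
open import Relation.Binary.PropositionalEquality
open import Relation.Nullary using (¬_; Dec; yes; no; does; contradiction)
open import Relation.Nullary.Decidable using (_×-dec_)

open +-*-Solver using (solve; con; _:=_; _:+_; _:*_; _:-_; :-_)
open Algebra.Properties.Semiring.Sum (CommutativeRing.semiring ℚ.+-*-commutativeRing)
  using (sum-cong-≗; ∑-distrib-+; *-distribˡ-sum; sum-replicate-zero) renaming (sum to sumℚ)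

-- Rational and real arithmetic

-- A triangle contributes to coordinate `l` once for each corner numbered above `l`. Seen from the
-- left part of a cut, the whole right part lies above `l` and counts with three times its total
-- area; seen from the right part, the left one counts with zero. Hence the constants ignore how the
-- other part is triangulated. Squaring `x + c` creates the cross term `2 c x`, so the sum of the
-- coordinates has to be carried along with the sum of their squares. The other obstacle is
-- constructive: the sign of `D` and the order of two reals cannot be decided. Algebra is therefore
-- done termwise on rational representatives. The separating functionals are multiplied by `D`, so
-- that at the vertices they take the values `(D b)²` times rational numbers with known signs; then
-- `D b` only has to be nonzero. The radius is a real number, so the square root of a rational must
-- be built as well.

p≤∣p∣ : ∀ p → p ℚ.≤ ℚ.∣ p ∣
p≤∣p∣ p with ℚ.≤-total 0ℚ p
... | inj₁ 0≤p = ℚ.≤-reflexive (sym (ℚ.0≤p⇒∣p∣≡p 0≤p))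
... | inj₂ p≤0 = ℚ.≤-trans p≤0 (ℚ.0≤∣p∣ p)

∣p∣<q : ∀ {p q} → p ℚ.< q → ℚ.- p ℚ.< q → ℚ.∣ p ∣ ℚ.< q
∣p∣<q {p} p<q -p<q with ℚ.∣p∣≡p∨∣p∣≡-p p
... | inj₁ eq = subst (ℚ._< _) (sym eq) p<q
... | inj₂ eq = subst (ℚ._< _) (sym eq) -p<q

<⇒≱ : ∀ {p q} → p ℚ.< q → ¬ (q ℚ.≤ p)
<⇒≱ p<q q≤p = ℚ.<-irrefl refl (ℚ.<-≤-trans p<q q≤p)

p-0≡p : ∀ p → p ℚ.- 0ℚ ≡ p
p-0≡p = ℚ.+-identityʳ

0≤p*q : ∀ {p q} → 0ℚ ℚ.≤ p → 0ℚ ℚ.≤ q → 0ℚ ℚ.≤ p ℚ.* q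
0≤p*q {p} {q} 0≤p 0≤q = subst (ℚ._≤ p ℚ.* q) (ℚ.*-zeroʳ p)
  (ℚ.*-monoˡ-≤-nonNeg p {{ℚ.nonNegative 0≤p}} 0≤q)

0<p*q : ∀ {p q} → 0ℚ ℚ.< p → 0ℚ ℚ.< q → 0ℚ ℚ.< p ℚ.* q
0<p*q {p} {q} 0<p 0<q = subst (ℚ._< p ℚ.* q) (ℚ.*-zeroʳ p)
  (ℚ.*-monoʳ-<-pos p {{ℚ.positive 0<p}} 0<q)

0≤p² : ∀ p → 0ℚ ℚ.≤ p ℚ.* p
0≤p² p with ℚ.≤-total 0ℚ p
... | inj₁ 0≤p = 0≤p*q 0≤p 0≤p
... | inj₂ p≤0 = subst (0ℚ ℚ.≤_) (solve 1 (λ p → (:- p) :* (:- p) := p :* p) refl p)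
  (0≤p*q (ℚ.neg-antimono-≤ p≤0) (ℚ.neg-antimono-≤ p≤0))

p<q⇒0<q-p : ∀ {p q} → p ℚ.< q → 0ℚ ℚ.< q ℚ.- p
p<q⇒0<q-p {p} {q} p<q = subst (ℚ._< q ℚ.- p) (ℚ.+-inverseʳ p) (ℚ.+-monoˡ-< (ℚ.- p) p<q)

p≤q⇒0≤q-p : ∀ {p q} → p ℚ.≤ q → 0ℚ ℚ.≤ q ℚ.- p
p≤q⇒0≤q-p {p} {q} p≤q = subst (ℚ._≤ q ℚ.- p) (ℚ.+-inverseʳ p) (ℚ.+-monoˡ-≤ (ℚ.- p) p≤q)

-- The operations on `ℝ` act termwise on representatives, so a polynomial identity between reals
-- follows from the same identity in `ℚ` at every index. This hands real equations to the rational
-- ring solver.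
pointwise⇒≃ : ∀ {x y} → (∀ n → seq x n ≡ seq y n) → x ≃ y
pointwise⇒≃ {x} {y} eq ε 0<ε = 0 , λ n _ → subst (ℚ._< ε)
  (sym (cong ℚ.∣_∣ (trans (cong (ℚ._- seq y n) (eq n)) (ℚ.+-inverseʳ (seq y n))))) 0<ε

≃-refl : ∀ {x} → x ≃ x
≃-refl {x} = pointwise⇒≃ {x} {x} λ _ → refl

≃-sym : ∀ {x y} → x ≃ y → y ≃ x
≃-sym {x} {y} x≃y ε 0<ε with N , h ← x≃y ε 0<ε = N , λ n n≥ →
  subst (ℚ._< ε) (trans (sym (ℚ.∣-p∣≡∣p∣ (seq x n ℚ.- seq y n)))
    (cong ℚ.∣_∣ (solve 2 (λ p q → :- (p :- q) := q :- p) refl (seq x n) (seq y n)))) (h n n≥)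

≃-trans : ∀ {x y z} → x ≃ y → y ≃ z → x ≃ z
≃-trans {x} {y} {z} x≃y y≃z ε 0<ε
  with M , hx ← x≃y (ε ℚ.* ½) (half-pos 0<ε)
     | N , hz ← y≃z (ε ℚ.* ½) (half-pos 0<ε) = M ℕ.⊔ N , λ n n≥ → begin-strict
  ℚ.∣ seq x n ℚ.- seq z n ∣
    ≡⟨ cong ℚ.∣_∣ (solve 3 (λ p q r → p :- r := (p :- q) :+ (q :- r)) refl (seq x n) (seq y n) (seq z n)) ⟩
  ℚ.∣ (seq x n ℚ.- seq y n) ℚ.+ (seq y n ℚ.- seq z n) ∣
    ≤⟨ ℚ.∣p+q∣≤∣p∣+∣q∣ (seq x n ℚ.- seq y n) (seq y n ℚ.- seq z n) ⟩
  ℚ.∣ seq x n ℚ.- seq y n ∣ ℚ.+ ℚ.∣ seq y n ℚ.- seq z n ∣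
    <⟨ ℚ.+-mono-< (hx n (ℕ.m⊔n≤o⇒m≤o M N n≥)) (hz n (ℕ.m⊔n≤o⇒n≤o M N n≥)) ⟩
  ε ℚ.* ½ ℚ.+ ε ℚ.* ½
    ≡⟨ halves ε ⟩
  ε ∎
  where
  open ℚ.≤-Reasoning

+-cong : ∀ {x y u v} → x ≃ y → u ≃ v → x + u ≃ y + v
+-cong {x} {y} {u} {v} x≃y u≃v ε 0<ε
  with M , hx ← x≃y (ε ℚ.* ½) (half-pos 0<ε)
     | N , hu ← u≃v (ε ℚ.* ½) (half-pos 0<ε) = M ℕ.⊔ N , λ n n≥ → begin-strict
  ℚ.∣ (seq x n ℚ.+ seq u n) ℚ.- (seq y n ℚ.+ seq v n) ∣
    ≡⟨ cong ℚ.∣_∣ (solve 4 (λ p q r s → (p :+ r) :- (q :+ s) := (p :- q) :+ (r :- s)) refl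
         (seq x n) (seq y n) (seq u n) (seq v n)) ⟩
  ℚ.∣ (seq x n ℚ.- seq y n) ℚ.+ (seq u n ℚ.- seq v n) ∣
    ≤⟨ ℚ.∣p+q∣≤∣p∣+∣q∣ (seq x n ℚ.- seq y n) (seq u n ℚ.- seq v n) ⟩
  ℚ.∣ seq x n ℚ.- seq y n ∣ ℚ.+ ℚ.∣ seq u n ℚ.- seq v n ∣
    <⟨ ℚ.+-mono-< (hx n (ℕ.m⊔n≤o⇒m≤o M N n≥)) (hu n (ℕ.m⊔n≤o⇒n≤o M N n≥)) ⟩
  ε ℚ.* ½ ℚ.+ ε ℚ.* ½
    ≡⟨ halves ε ⟩
  ε ∎
  where
  open ℚ.≤-Reasoning

*-cong : ∀ {x y u v} → x ≃ y → u ≃ v → x * u ≃ y * v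
*-cong {x} {y} {u} {v} x≃y u≃v ε 0<ε
  with A , 0<A , K , boundX ← eventuallyBounded {seq x} (cauchy x)
     | B , 0<B , L , boundV ← eventuallyBounded {seq v} (cauchy v)
  with δ , 0<δ , total ← divide (A ℚ.+ B) ε (ℚ.+-mono-< 0<A 0<B) 0<ε
  with M , hx ← x≃y δ 0<δ | N , hu ← u≃v δ 0<δ =
  (K ℕ.⊔ L) ℕ.⊔ (M ℕ.⊔ N) , λ n n≥ →
  let KL = ℕ.m⊔n≤o⇒m≤o (K ℕ.⊔ L) (M ℕ.⊔ N) n≥
      MN = ℕ.m⊔n≤o⇒n≤o (K ℕ.⊔ L) (M ℕ.⊔ N) n≥
  in subst (ℚ.∣ seq x n ℚ.* seq u n ℚ.- seq y n ℚ.* seq v n ∣ ℚ.<_) total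
       (products-close (seq x n) (seq u n) (seq y n) (seq v n) A B δ 0<A 0<B
         (boundX n (ℕ.m⊔n≤o⇒m≤o K L KL)) (boundV n (ℕ.m⊔n≤o⇒n≤o K L KL))
         (hx n (ℕ.m⊔n≤o⇒m≤o M N MN)) (hu n (ℕ.m⊔n≤o⇒n≤o M N MN)))

sum-cong : ∀ {m} {x y : Vector ℝ m} → (∀ j → x j ≃ y j) → sum x ≃ sum y
sum-cong {zero}          _   = ≃-refl {0ℝ}
sum-cong {suc m} {x} {y} x≃y = +-cong {x zero} {y zero} {sum (λ j → x (suc j))} {sum (λ j → y (suc j))}
  (x≃y zero) (sum-cong λ j → x≃y (suc j))

^2-cong : ∀ {x y} → x ≃ y → x ^ 2 ≃ y ^ 2
^2-cong {x} {y} x≃y = *-cong {x} {y} {x * 1ℝ} {y * 1ℝ} x≃y (*-cong {x} {y} {1ℝ} {1ℝ} x≃y (≃-refl {1ℝ}))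

Eventually : (ℕ → Set) → Set
Eventually P = ∃[ N ] (∀ n → N ℕ.≤ n → P n)

-- Constructive substitute for deciding an order. Some tail stays within `ε / 4` of its first term,
-- and comparing that term with `3ε / 4`, midway between the two bounds, settles the matter.
eventually-<-or-≥ : ∀ x {ε} → 0ℚ ℚ.< ε →
  Eventually (λ n → seq x n ℚ.< ε) ⊎ Eventually (λ n → ε ℚ.* ½ ℚ.≤ seq x n)
eventually-<-or-≥ x {ε} 0<ε
  with N , h ← cauchy x (ε ℚ.* ½ ℚ.* ½) (half-pos (half-pos 0<ε))
  with seq x N ℚ.<? ε ℚ.* ½ ℚ.+ ε ℚ.* ½ ℚ.* ½
... | yes lt = inj₁ (N , λ n n≥ → begin-strict
  seq x n
    ≡⟨ solve 2 (λ p q → p := q :+ (p :- q)) refl (seq x n) (seq x N) ⟩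
  seq x N ℚ.+ (seq x n ℚ.- seq x N)
    <⟨ ℚ.+-mono-<-≤ lt (ℚ.≤-trans (p≤∣p∣ (seq x n ℚ.- seq x N)) (ℚ.<⇒≤ (h n N n≥ ℕ.≤-refl))) ⟩
  ε ℚ.* ½ ℚ.+ ε ℚ.* ½ ℚ.* ½ ℚ.+ ε ℚ.* ½ ℚ.* ½
    ≡⟨ trans (ℚ.+-assoc (ε ℚ.* ½) _ _)
         (trans (cong (ε ℚ.* ½ ℚ.+_) (halves (ε ℚ.* ½))) (halves ε)) ⟩
  ε ∎)
  where
  open ℚ.≤-Reasoning
... | no ≮ = inj₂ (N , λ n n≥ → begin
  ε ℚ.* ½
    ≡⟨ solve 2 (λ p q → p := (p :+ q) :- q) refl (ε ℚ.* ½) (ε ℚ.* ½ ℚ.* ½) ⟩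
  (ε ℚ.* ½ ℚ.+ ε ℚ.* ½ ℚ.* ½) ℚ.- ε ℚ.* ½ ℚ.* ½
    ≤⟨ ℚ.+-mono-≤ (ℚ.≮⇒≥ ≮) (ℚ.neg-antimono-≤
         (ℚ.≤-trans (p≤∣p∣ (seq x N ℚ.- seq x n)) (ℚ.<⇒≤ (h N n ℕ.≤-refl n≥)))) ⟩
  seq x N ℚ.- (seq x N ℚ.- seq x n)
    ≡⟨ solve 2 (λ p q → q :- (q :- p) := p) refl (seq x n) (seq x N) ⟩
  seq x n ∎)
  where
  open ℚ.≤-Reasoning

-- Apply the dichotomy to `∣ x - y ∣`: an eventual lower bound `ε / 2` refutes `x ≃ y`, so only the
-- small alternative survives.
≃-stable : ∀ x y → ¬ ¬ (x ≃ y) → x ≃ y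
≃-stable x y ¬¬x≃y ε 0<ε with eventually-<-or-≥ (∣ x - y ∣) 0<ε
... | inj₁ small     = small
... | inj₂ (N , big) = ⊥-elim (¬¬x≃y λ x≃y →
  let M , small = x≃y (ε ℚ.* ½) (half-pos 0<ε)
  in <⇒≱ (small (M ℕ.⊔ N) (ℕ.m≤m⊔n M N)) (big (M ℕ.⊔ N) (ℕ.m≤n⊔m M N)))

-- If `∣x∣` were eventually at least `ε / 2`, then `∣y∣` would be at most `∣x y∣ / (ε / 2)` and tend
-- to zero. No inverse of `y` is formed, which a bare negation would not provide.
x*y≃0⇒x≃0 : ∀ x y → x * y ≃ 0ℝ → ¬ (y ≃ 0ℝ) → x ≃ 0ℝ
x*y≃0⇒x≃0 x y xy≃0 y≄0 ε 0<ε with eventually-<-or-≥ (∣ x - 0ℝ ∣) 0<ε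
... | inj₁ small     = small
... | inj₂ (N , big) = ⊥-elim (y≄0 λ δ 0<δ →
  let M , small = xy≃0 (ε ℚ.* ½ ℚ.* δ) (0<p*q (half-pos 0<ε) 0<δ)
  in M ℕ.⊔ N , λ n n≥ → ℚ.≰⇒> λ δ≤ → <⇒≱ (small n (ℕ.m⊔n≤o⇒m≤o M N n≥)) (begin
    ε ℚ.* ½ ℚ.* δ
      ≤⟨ ℚ.*-monoˡ-≤-nonNeg (ε ℚ.* ½) {{ℚ.nonNegative (ℚ.<⇒≤ (half-pos 0<ε))}} δ≤ ⟩
    ε ℚ.* ½ ℚ.* ℚ.∣ seq y n ℚ.- 0ℚ ∣
      ≤⟨ ℚ.*-monoʳ-≤-nonNeg ℚ.∣ seq y n ℚ.- 0ℚ ∣ {{ℚ.nonNegative (ℚ.0≤∣p∣ (seq y n ℚ.- 0ℚ))}}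
           (big n (ℕ.m⊔n≤o⇒n≤o M N n≥)) ⟩
    ℚ.∣ seq x n ℚ.- 0ℚ ∣ ℚ.* ℚ.∣ seq y n ℚ.- 0ℚ ∣
      ≡⟨ ℚ.∣p*q∣≡∣p∣*∣q∣ (seq x n ℚ.- 0ℚ) (seq y n ℚ.- 0ℚ) ⟨
    ℚ.∣ (seq x n ℚ.- 0ℚ) ℚ.* (seq y n ℚ.- 0ℚ) ∣
      ≡⟨ cong ℚ.∣_∣ (trans (cong₂ ℚ._*_ (p-0≡p (seq x n)) (p-0≡p (seq y n))) (sym (p-0≡p _))) ⟩
    ℚ.∣ seq x n ℚ.* seq y n ℚ.- 0ℚ ∣ ∎))
  where open ℚ.≤-Reasoning

1≄0 : ¬ (1ℝ ≃ 0ℝ)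
1≄0 1≃0 with N , h ← 1≃0 1ℚ (ℚ.positive⁻¹ 1ℚ) = ℚ.<-irrefl refl (h N ℕ.≤-refl)

-- `0ℝ ≤ x` tolerates slightly negative terms; at such a term the two sides differ by twice its
-- absolute value, hence the bound `ε / 2`. Convex weights can thus be replaced by representatives
-- with nonnegative terms, which makes termwise sign estimates possible.
0≤x⇒x≃∣x∣ : ∀ x → 0ℝ ≤ x → x ≃ ∣ x ∣
0≤x⇒x≃∣x∣ x 0≤x ε 0<ε with N , h ← 0≤x (ε ℚ.* ½) (half-pos 0<ε) = N , λ n n≥ → close n (h n n≥)
  where
  open ℚ.≤-Reasoning
  close : ∀ n → 0ℚ ℚ.- seq x n ℚ.< ε ℚ.* ½ → ℚ.∣ seq x n ℚ.- ℚ.∣ seq x n ∣ ∣ ℚ.< ε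
  close n lt with ℚ.∣p∣≡p∨∣p∣≡-p (seq x n)
  ... | inj₁ eq = subst (ℚ._< ε) (sym (cong ℚ.∣_∣ (trans (cong (λ z → seq x n ℚ.- z) eq) (ℚ.+-inverseʳ (seq x n))))) 0<ε
  ... | inj₂ eq = begin-strict
    ℚ.∣ seq x n ℚ.- ℚ.∣ seq x n ∣ ∣
      ≤⟨ ℚ.∣p-q∣≤∣p∣+∣q∣ (seq x n) ℚ.∣ seq x n ∣ ⟩
    ℚ.∣ seq x n ∣ ℚ.+ ℚ.∣ ℚ.∣ seq x n ∣ ∣
      ≡⟨ cong₂ ℚ._+_ eq (trans (ℚ.∣∣p∣∣≡∣p∣ (seq x n)) eq) ⟩
    (ℚ.- seq x n) ℚ.+ (ℚ.- seq x n)
      ≡⟨ cong₂ ℚ._+_ (ℚ.+-identityˡ (ℚ.- seq x n)) (ℚ.+-identityˡ (ℚ.- seq x n)) ⟨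
    (0ℚ ℚ.- seq x n) ℚ.+ (0ℚ ℚ.- seq x n)
      <⟨ ℚ.+-mono-< lt lt ⟩
    ε ℚ.* ½ ℚ.+ ε ℚ.* ½
      ≡⟨ halves ε ⟩
    ε ∎

0≤x≮0⇒x≃0 : ∀ x → 0ℝ ≤ x → ¬ (0ℝ < x) → x ≃ 0ℝ
0≤x≮0⇒x≃0 x 0≤x 0≮x ε 0<ε with N , h ← 0≤x ε 0<ε with eventually-<-or-≥ x 0<ε
... | inj₁ (M , small) = M ℕ.⊔ N , λ n n≥ → subst (ℚ._< ε) (cong ℚ.∣_∣ (sym (p-0≡p (seq x n))))
  (∣p∣<q (small n (ℕ.m⊔n≤o⇒m≤o M N n≥))
         (subst (ℚ._< ε) (ℚ.+-identityˡ (ℚ.- seq x n)) (h n (ℕ.m⊔n≤o⇒n≤o M N n≥))))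
... | inj₂ (M , big) = contradiction
  (ε ℚ.* ½ , half-pos 0<ε , M , λ n n≥ → subst (ε ℚ.* ½ ℚ.≤_) (sym (p-0≡p (seq x n))) (big n n≥)) 0≮x

squeeze-0 : ∀ x y → (∀ n → 0ℚ ℚ.≤ seq x n) → (∀ n → seq y n ℚ.≤ 0ℚ) → x ≃ y → x ≃ 0ℝ
squeeze-0 x y 0≤x y≤0 x≃y ε 0<ε with N , h ← x≃y ε 0<ε = N , λ n n≥ → begin-strict
  ℚ.∣ seq x n ℚ.- 0ℚ ∣  ≡⟨ cong ℚ.∣_∣ (p-0≡p (seq x n)) ⟩
  ℚ.∣ seq x n ∣         ≡⟨ ℚ.0≤p⇒∣p∣≡p (0≤x n) ⟩
  seq x n               ≡⟨ p-0≡p (seq x n) ⟨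
  seq x n ℚ.- 0ℚ        ≤⟨ ℚ.+-monoʳ-≤ (seq x n) (ℚ.neg-antimono-≤ (y≤0 n)) ⟩
  seq x n ℚ.- seq y n   ≤⟨ p≤∣p∣ (seq x n ℚ.- seq y n) ⟩
  ℚ.∣ seq x n ℚ.- seq y n ∣ <⟨ h n n≥ ⟩
  ε ∎
  where open ℚ.≤-Reasoning

pointwise⇒0≤ : ∀ x → (∀ n → 0ℚ ℚ.≤ seq x n) → 0ℝ ≤ x
pointwise⇒0≤ x 0≤x ε 0<ε = 0 , λ n _ → ℚ.≤-<-trans
  (subst (ℚ._≤ 0ℚ) (sym (ℚ.+-identityˡ (ℚ.- seq x n))) (ℚ.neg-antimono-≤ (0≤x n))) 0<ε

0≤fromℚ : ∀ {c} → 0ℚ ℚ.≤ c → 0ℝ ≤ fromℚ c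
0≤fromℚ {c} 0≤c = pointwise⇒0≤ (fromℚ c) λ _ → 0≤c

0<fromℚ : ∀ {c} → 0ℚ ℚ.< c → 0ℝ < fromℚ c
0<fromℚ {c} 0<c = c , 0<c , 0 , λ _ _ → ℚ.≤-reflexive (sym (p-0≡p c))

-- Square roots of rationals

⟦_⟧ : ℕ → ℚ
⟦ zero ⟧  = 0ℚ
⟦ suc n ⟧ = 1ℚ ℚ.+ ⟦ n ⟧

⟦+⟧ : ∀ m n → ⟦ m ℕ.+ n ⟧ ≡ ⟦ m ⟧ ℚ.+ ⟦ n ⟧
⟦+⟧ zero    n = sym (ℚ.+-identityˡ ⟦ n ⟧)
⟦+⟧ (suc m) n = trans (cong (1ℚ ℚ.+_) (⟦+⟧ m n)) (sym (ℚ.+-assoc 1ℚ ⟦ m ⟧ ⟦ n ⟧))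

0≤⟦⟧ : ∀ n → 0ℚ ℚ.≤ ⟦ n ⟧
0≤⟦⟧ zero    = ℚ.≤-refl
0≤⟦⟧ (suc n) = ℚ.+-mono-≤ (ℚ.<⇒≤ (ℚ.positive⁻¹ 1ℚ)) (0≤⟦⟧ n)

⟦⟧-mono-≤ : ∀ {m n} → m ℕ.≤ n → ⟦ m ⟧ ℚ.≤ ⟦ n ⟧
⟦⟧-mono-≤ {n = n} ℕ.z≤n     = 0≤⟦⟧ n
⟦⟧-mono-≤         (ℕ.s≤s p) = ℚ.+-monoʳ-≤ 1ℚ (⟦⟧-mono-≤ p)

0<⟦suc⟧ : ∀ n → 0ℚ ℚ.< ⟦ suc n ⟧
0<⟦suc⟧ n = ℚ.+-mono-<-≤ (ℚ.positive⁻¹ 1ℚ) (0≤⟦⟧ n)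

⟦⟧-mono-< : ∀ {m n} → m ℕ.< n → ⟦ m ⟧ ℚ.< ⟦ n ⟧
⟦⟧-mono-< {n = suc n} (ℕ.s≤s ℕ.z≤n)     = 0<⟦suc⟧ n
⟦⟧-mono-<             (ℕ.s≤s (ℕ.s≤s p)) = ℚ.+-monoʳ-< 1ℚ (⟦⟧-mono-< (ℕ.s≤s p))

toℚᵘ-⟦⟧ : ∀ n → ℚ.toℚᵘ ⟦ n ⟧ ℚᵘ.≃ ℚᵘ.mkℚᵘ (ℤ.+ n) 0
toℚᵘ-⟦⟧ zero    = ℚᵘ.≃-refl
toℚᵘ-⟦⟧ (suc n) = ℚᵘ.≃-trans (ℚ.toℚᵘ-homo-+ 1ℚ ⟦ n ⟧)
  (ℚᵘ.≃-trans (ℚᵘ.+-congʳ (ℚ.toℚᵘ 1ℚ) (toℚᵘ-⟦⟧ n))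
    (ℚᵘ.*≡* (cong (ℤ._* (ℤ.+ 1)) (cong (ℤ._+_ (ℤ.+ 1)) (ℤ.*-identityʳ (ℤ.+ n))))))

archimedean : ∀ p → ∃[ N ] p ℚ.< ⟦ N ⟧
archimedean p@(mkℚ i d _) = suc ℤ.∣ i ∣ ,
  ℚ.toℚᵘ-cancel-< (ℚᵘ.<-respʳ-≃ (ℚᵘ.≃-sym (toℚᵘ-⟦⟧ (suc ℤ.∣ i ∣)))
    (ℚᵘ.*<* (ℤ.≤-<-trans (ℤ.≤-reflexive (ℤ.*-identityʳ i)) (ℤ.≤-<-trans (i≤+∣i∣ i) (ℤ.+<+ (ℕ.m≤m*n (suc ℤ.∣ i ∣) (suc d)))))))
  where
  i≤+∣i∣ : ∀ i → i ℤ.≤ ℤ.+ ℤ.∣ i ∣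
  i≤+∣i∣ (ℤ.+ n)    = ℤ.≤-refl
  i≤+∣i∣ ℤ.-[1+ n ] = ℤ.-≤+

²-cancel-≤ : ∀ {p q} → 0ℚ ℚ.≤ q → p ℚ.* p ℚ.≤ q ℚ.* q → p ℚ.≤ q
²-cancel-≤ {p} {q} 0≤q p²≤q² with p ℚ.≤? q
... | yes p≤q = p≤q
... | no  p≰q = contradiction p²≤q² (<⇒≱ (ℚ.≤-<-trans
  (ℚ.*-monoˡ-≤-nonNeg q {{ℚ.nonNegative 0≤q}} (ℚ.<⇒≤ q<p))
  (ℚ.*-monoˡ-<-pos p {{ℚ.positive (ℚ.≤-<-trans 0≤q q<p)}} q<p)))
  where q<p = ℚ.≰⇒> p≰q

abstract
  -- The error is at most `(s + δ)² - s²`, a difference of products with factors bounded by `B + 1`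
  -- and `B`. The strict bound `η` is separate from `δ` because `products-close` asks for strict
  -- inequalities.
  square-close : ∀ {M} s δ B η → 0ℚ ℚ.< B → 0ℚ ℚ.< δ → δ ℚ.< 1ℚ → δ ℚ.< η → ℚ.∣ s ∣ ℚ.≤ B →
    s ℚ.* s ℚ.≤ M → M ℚ.≤ (s ℚ.+ δ) ℚ.* (s ℚ.+ δ) →
    ℚ.∣ s ℚ.* s ℚ.- M ∣ ℚ.< ((B ℚ.+ 1ℚ) ℚ.+ B) ℚ.* η
  square-close {M} s δ B η 0<B 0<δ δ<1 δ<η s≤B s²≤M M≤ = begin-strict
    ℚ.∣ s ℚ.* s ℚ.- M ∣
      ≡⟨ ℚ.∣-p∣≡∣p∣ (s ℚ.* s ℚ.- M) ⟨
    ℚ.∣ ℚ.- (s ℚ.* s ℚ.- M) ∣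
      ≡⟨ cong ℚ.∣_∣ (solve 2 (λ a b → :- (a :- b) := b :- a) refl (s ℚ.* s) M) ⟩
    ℚ.∣ M ℚ.- s ℚ.* s ∣
      ≡⟨ ℚ.0≤p⇒∣p∣≡p (p≤q⇒0≤q-p s²≤M) ⟩
    M ℚ.- s ℚ.* s
      ≤⟨ ℚ.+-monoˡ-≤ (ℚ.- (s ℚ.* s)) M≤ ⟩
    (s ℚ.+ δ) ℚ.* (s ℚ.+ δ) ℚ.- s ℚ.* s
      ≤⟨ p≤∣p∣ _ ⟩
    ℚ.∣ (s ℚ.+ δ) ℚ.* (s ℚ.+ δ) ℚ.- s ℚ.* s ∣
      <⟨ products-close (s ℚ.+ δ) (s ℚ.+ δ) s s (B ℚ.+ 1ℚ) B η
           (ℚ.+-mono-< 0<B (ℚ.positive⁻¹ 1ℚ)) 0<B s+δ≤ s≤B s+δ-s< s+δ-s< ⟩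
    ((B ℚ.+ 1ℚ) ℚ.+ B) ℚ.* η ∎
    where
    open ℚ.≤-Reasoning
    ∣δ∣≡δ : ℚ.∣ δ ∣ ≡ δ
    ∣δ∣≡δ = ℚ.0≤p⇒∣p∣≡p (ℚ.<⇒≤ 0<δ)
    s+δ≤ : ℚ.∣ s ℚ.+ δ ∣ ℚ.≤ B ℚ.+ 1ℚ
    s+δ≤ = ℚ.≤-trans (ℚ.∣p+q∣≤∣p∣+∣q∣ s δ)
      (ℚ.+-mono-≤ s≤B (subst (ℚ._≤ 1ℚ) (sym ∣δ∣≡δ) (ℚ.<⇒≤ δ<1)))
    s+δ-s< : ℚ.∣ s ℚ.+ δ ℚ.- s ∣ ℚ.< η
    s+δ-s< = subst (ℚ._< η) (trans (sym ∣δ∣≡δ)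
      (cong ℚ.∣_∣ (solve 2 (λ s d → d := s :+ d :- s) refl s δ))) δ<η

module _ (M : ℚ) (0≤M : 0ℚ ℚ.≤ M) where

  RootWithin : ℚ → ℚ → Set
  RootWithin δ s = 0ℚ ℚ.≤ s × s ℚ.* s ℚ.≤ M × M ℚ.≤ (s ℚ.+ δ) ℚ.* (s ℚ.+ δ)

  -- Descends through the multiples of `δ` until the square first drops below `M`; the last two
  -- multiples enclose the root. At zero the hypothesis reads `M ≤ 0`, so `0ℚ` itself serves.
  searchRoot : ∀ δ → 0ℚ ℚ.< δ → ∀ K → M ℚ.≤ (⟦ K ⟧ ℚ.* δ) ℚ.* (⟦ K ⟧ ℚ.* δ) → ∃[ s ] RootWithin δ s
  searchRoot δ 0<δ zero M≤ = 0ℚ , ℚ.≤-refl , 0≤M ,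
    ℚ.≤-trans (subst (λ z → M ℚ.≤ z ℚ.* z) (ℚ.*-zeroˡ δ) M≤) (0≤p² (0ℚ ℚ.+ δ))
  searchRoot δ 0<δ (suc K) M≤ with M ℚ.≤? (⟦ K ⟧ ℚ.* δ) ℚ.* (⟦ K ⟧ ℚ.* δ)
  ... | yes M≤′ = searchRoot δ 0<δ K M≤′
  ... | no  M≰  = ⟦ K ⟧ ℚ.* δ , 0≤p*q (0≤⟦⟧ K) (ℚ.<⇒≤ 0<δ) , ℚ.<⇒≤ (ℚ.≰⇒> M≰) ,
    subst (λ z → M ℚ.≤ z ℚ.* z)
      (solve 2 (λ k d → (con 1ℚ :+ k) :* d := k :* d :+ d) refl ⟦ K ⟧ δ) M≤

  abstract
    reciprocal : ∀ n → ∃[ δ ] 0ℚ ℚ.< δ × ⟦ suc n ⟧ ℚ.* δ ≡ 1ℚ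
    reciprocal n = divide ⟦ suc n ⟧ 1ℚ (0<⟦suc⟧ n) (ℚ.positive⁻¹ 1ℚ)

  mesh : ℕ → ℚ
  mesh n = proj₁ (reciprocal n)

  0<mesh : ∀ n → 0ℚ ℚ.< mesh n
  0<mesh n = proj₁ (proj₂ (reciprocal n))

  mesh-small : ∀ ε → 0ℚ ℚ.< ε → Eventually (λ n → mesh n ℚ.< ε)
  mesh-small ε 0<ε with η , 0<η , εη≡1 ← divide ε 1ℚ 0<ε (ℚ.positive⁻¹ 1ℚ)
    with N , η<N ← archimedean η = N , λ n n≥ → begin-strict
    mesh n ≡⟨ ℚ.*-identityˡ (mesh n) ⟨
    1ℚ ℚ.* mesh n ≡⟨ cong (ℚ._* mesh n) εη≡1 ⟨
    ε ℚ.* η ℚ.* mesh n <⟨ ℚ.*-monoˡ-<-pos (mesh n) {{ℚ.positive (0<mesh n)}}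
      (ℚ.*-monoʳ-<-pos ε {{ℚ.positive 0<ε}} (ℚ.<-≤-trans η<N (⟦⟧-mono-≤ (ℕ.m≤n⇒m≤1+n n≥)))) ⟩
    ε ℚ.* ⟦ suc n ⟧ ℚ.* mesh n ≡⟨ ℚ.*-assoc ε ⟦ suc n ⟧ (mesh n) ⟩
    ε ℚ.* (⟦ suc n ⟧ ℚ.* mesh n) ≡⟨ cong (ε ℚ.*_) (proj₂ (proj₂ (reciprocal n))) ⟩
    ε ℚ.* 1ℚ ≡⟨ ℚ.*-identityʳ ε ⟩
    ε ∎
    where open ℚ.≤-Reasoning

  abstract
    rootSearch : ∀ n → ∃[ s ] RootWithin (mesh n) s
    -- `K > 1 + M` yields both `1 ≤ K` and `M ≤ K`, hence `M ≤ K²`; and `K (n + 1)` steps of length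
    -- `1 / (n + 1)` reach exactly `K`.
    rootSearch n with K , M<K ← archimedean (1ℚ ℚ.+ M) = searchRoot (mesh n) (0<mesh n) (K ℕ.* suc n) (begin
      M ≡⟨ ℚ.*-identityʳ M ⟨
      M ℚ.* 1ℚ ≤⟨ ℚ.*-monoˡ-≤-nonNeg M {{ℚ.nonNegative 0≤M}} (1≤ K M<K) ⟩
      M ℚ.* ⟦ K ⟧ ≤⟨ ℚ.*-monoʳ-≤-nonNeg ⟦ K ⟧ {{ℚ.nonNegative (0≤⟦⟧ K)}} (M≤ K M<K) ⟩
      ⟦ K ⟧ ℚ.* ⟦ K ⟧ ≡⟨ cong₂ ℚ._*_ (eq K) (eq K) ⟩
      (⟦ K ℕ.* suc n ⟧ ℚ.* mesh n) ℚ.* (⟦ K ℕ.* suc n ⟧ ℚ.* mesh n) ∎)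
      where
      open ℚ.≤-Reasoning
      1≤ : ∀ K → 1ℚ ℚ.+ M ℚ.< ⟦ K ⟧ → 1ℚ ℚ.≤ ⟦ K ⟧
      1≤ K lt = ℚ.<⇒≤ (ℚ.≤-<-trans (subst (ℚ._≤ 1ℚ ℚ.+ M) (ℚ.+-identityʳ 1ℚ) (ℚ.+-monoʳ-≤ 1ℚ 0≤M)) lt)
      M≤ : ∀ K → 1ℚ ℚ.+ M ℚ.< ⟦ K ⟧ → M ℚ.≤ ⟦ K ⟧
      M≤ K lt = ℚ.<⇒≤ (ℚ.≤-<-trans (subst (ℚ._≤ 1ℚ ℚ.+ M) (ℚ.+-identityˡ M)
        (ℚ.+-monoˡ-≤ M (ℚ.<⇒≤ (ℚ.positive⁻¹ 1ℚ)))) lt)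
      ⟦*⟧ : ∀ m → ⟦ m ℕ.* suc n ⟧ ≡ ⟦ m ⟧ ℚ.* ⟦ suc n ⟧
      ⟦*⟧ zero    = sym (ℚ.*-zeroˡ ⟦ suc n ⟧)
      ⟦*⟧ (suc m) = trans (⟦+⟧ (suc n) (m ℕ.* suc n)) (trans (cong (⟦ suc n ⟧ ℚ.+_) (⟦*⟧ m))
        (solve 2 (λ m n → n :+ m :* n := (con 1ℚ :+ m) :* n) refl ⟦ m ⟧ ⟦ suc n ⟧))
      eq : ∀ K → ⟦ K ⟧ ≡ ⟦ K ℕ.* suc n ⟧ ℚ.* mesh n
      eq K = sym (trans (cong (ℚ._* mesh n) (⟦*⟧ K)) (trans (ℚ.*-assoc ⟦ K ⟧ ⟦ suc n ⟧ (mesh n))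
        (trans (cong (⟦ K ⟧ ℚ.*_) (proj₂ (proj₂ (reciprocal n)))) (ℚ.*-identityʳ ⟦ K ⟧))))

  √-seq : ℕ → ℚ
  √-seq n = proj₁ (rootSearch n)

  0≤√-seq : ∀ n → 0ℚ ℚ.≤ √-seq n
  0≤√-seq n = proj₁ (proj₂ (rootSearch n))

  √-seq²≤M : ∀ n → √-seq n ℚ.* √-seq n ℚ.≤ M
  √-seq²≤M n = proj₁ (proj₂ (proj₂ (rootSearch n)))

  M≤[√-seq+mesh]² : ∀ n → M ℚ.≤ (√-seq n ℚ.+ mesh n) ℚ.* (√-seq n ℚ.+ mesh n)
  M≤[√-seq+mesh]² n = proj₂ (proj₂ (proj₂ (rootSearch n)))

  -- Compare through `M`: the square of term `m` is at most `M`, and `M` is at most the square of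
  -- term `n` plus its mesh. The bound involves only `n`, so using it in both orders gives the
  -- Cauchy property.
  √-seq-diff : ∀ m n → √-seq m ℚ.- √-seq n ℚ.≤ mesh n
  √-seq-diff m n = subst (√-seq m ℚ.- √-seq n ℚ.≤_)
    (solve 2 (λ s d → s :+ d :- s := d) refl (√-seq n) (mesh n))
    (ℚ.+-monoˡ-≤ (ℚ.- √-seq n) (²-cancel-≤ {√-seq m} {√-seq n ℚ.+ mesh n} (ℚ.+-mono-≤ (0≤√-seq n) (ℚ.<⇒≤ (0<mesh n)))
      (ℚ.≤-trans (√-seq²≤M m) (M≤[√-seq+mesh]² n))))

  √-seq-cauchy : IsCauchy √-seq
  √-seq-cauchy ε 0<ε with N , small ← mesh-small ε 0<ε = N , λ m n m≥ n≥ → ∣p∣<q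
    (ℚ.≤-<-trans (√-seq-diff m n) (small n n≥))
    (ℚ.≤-<-trans (subst (ℚ._≤ mesh m)
      (solve 2 (λ s t → s :- t := :- (t :- s)) refl (√-seq n) (√-seq m)) (√-seq-diff n m)) (small m m≥))

  √ : ℝ
  √ = mkℝ √-seq √-seq-cauchy

  √*√≃M : √ * √ ≃ fromℚ M
  √*√≃M ε 0<ε = go (eventuallyBounded {√-seq} √-seq-cauchy)
    where
    go : (∃[ B ] 0ℚ ℚ.< B × Eventually (λ n → ℚ.∣ √-seq n ∣ ℚ.≤ B)) →
      Eventually (λ n → ℚ.∣ √-seq n ℚ.* √-seq n ℚ.- M ∣ ℚ.< ε)
    go (B , 0<B , K , bound) =
      let η , 0<η , total = divide ((B ℚ.+ 1ℚ) ℚ.+ B) ε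
            (ℚ.+-mono-< (ℚ.+-mono-< 0<B (ℚ.positive⁻¹ 1ℚ)) 0<B) 0<ε
          L , δ<1 = mesh-small 1ℚ (ℚ.positive⁻¹ 1ℚ)
          N , δ<η = mesh-small η 0<η
      in K ℕ.⊔ (L ℕ.⊔ N) , λ n n≥ →
        let n≥LN = ℕ.m⊔n≤o⇒n≤o K (L ℕ.⊔ N) n≥
        in subst (ℚ.∣ √-seq n ℚ.* √-seq n ℚ.- M ∣ ℚ.<_) total
          (square-close (√-seq n) (mesh n) B η 0<B (0<mesh n)
            (δ<1 n (ℕ.m⊔n≤o⇒m≤o L N n≥LN)) (δ<η n (ℕ.m⊔n≤o⇒n≤o L N n≥LN))
            (bound n (ℕ.m⊔n≤o⇒m≤o K (L ℕ.⊔ N) n≥)) (√-seq²≤M n) (M≤[√-seq+mesh]² n))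

-- Vertices of convex hulls

0≤x*c : ∀ x {c} → 0ℝ ≤ x → 0ℚ ℚ.< c → 0ℝ ≤ x * fromℚ c
0≤x*c x {c} 0≤x 0<c ε 0<ε with δ , 0<δ , total ← divide c ε 0<c 0<ε
  with N , h ← 0≤x δ 0<δ = N , λ n n≥ → subst₂ ℚ._<_
    (solve 2 (λ x c → c :* (con 0ℚ :- x) := con 0ℚ :- x :* c) refl (seq x n) c) total
    (ℚ.*-monoʳ-<-pos c {{ℚ.positive 0<c}} (h n n≥))

seq-sum-unshifted : ∀ {m} (w x : Vector ℝ m) t u n →
  seq (sum λ i → ((w i - fromℚ t * 0ℝ) * fromℚ u) * x i) n ≡ seq (sum λ i → w i * x i) n ℚ.* u
seq-sum-unshifted {zero}  w x t u n = sym (ℚ.*-zeroˡ u)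
seq-sum-unshifted {suc m} w x t u n = trans
  (cong (((seq (w zero) n ℚ.- t ℚ.* 0ℚ) ℚ.* u) ℚ.* seq (x zero) n ℚ.+_)
    (seq-sum-unshifted (w ∘ suc) (x ∘ suc) t u n))
  (solve 5 (λ w x t u s → ((w :- t :* con 0ℚ) :* u) :* x :+ s :* u := (w :* x :+ s) :* u) refl
    (seq (w zero) n) (seq (x zero) n) t u (seq (sum λ i → w (suc i) * x (suc i)) n))

-- Effect on a weighted sum of taking weight `t` away from index `j` and rescaling by `u`. Beyond
-- `j` the indicator vanishes, which is the unshifted case. With `x` constantly one it gives the
-- total weight, with a coordinate of the generators it gives the new point.
seq-sum-shifted : ∀ {m} (w x : Vector ℝ m) j t u n →
  seq (sum λ i → ((w i - fromℚ t * e j i) * fromℚ u) * x i) n ≡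
  (seq (sum λ i → w i * x i) n ℚ.- t ℚ.* seq (x j) n) ℚ.* u
seq-sum-shifted w x zero t u n = trans
  (cong (((seq (w zero) n ℚ.- t ℚ.* 1ℚ) ℚ.* u) ℚ.* seq (x zero) n ℚ.+_)
    (seq-sum-unshifted (w ∘ suc) (x ∘ suc) t u n))
  (solve 5 (λ w x t u s → ((w :- t :* con 1ℚ) :* u) :* x :+ s :* u := (w :* x :+ s :- t :* x) :* u) refl
    (seq (w zero) n) (seq (x zero) n) t u (seq (sum λ i → w (suc i) * x (suc i)) n))
seq-sum-shifted w x (suc j) t u n = trans
  (cong (((seq (w zero) n ℚ.- t ℚ.* 0ℚ) ℚ.* u) ℚ.* seq (x zero) n ℚ.+_)
    (seq-sum-shifted (w ∘ suc) (x ∘ suc) j t u n))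
  (solve 6 (λ w x t u s y → ((w :- t :* con 0ℚ) :* u) :* x :+ (s :- t :* y) :* u := (w :* x :+ s :- t :* y) :* u) refl
    (seq (w zero) n) (seq (x zero) n) t u (seq (sum λ i → w (suc i) * x (suc i)) n) (seq (x (suc j)) n))

rationalWeight : ∀ {ε} → 0ℚ ℚ.< ε → ∃[ t ] 0ℚ ℚ.< t × t ℚ.< 1ℚ × t ℚ.≤ ε
rationalWeight {ε} 0<ε with ε ℚ.≤? ½
... | yes ε≤½ = ε , 0<ε , ℚ.≤-<-trans ε≤½ (ℚ.*<* (ℤ.+<+ (ℕ.s≤s (ℕ.s≤s ℕ.z≤n)))) , ℚ.≤-refl
... | no  ε≰½ = ½ , ℚ.positive⁻¹ ½ , ℚ.*<* (ℤ.+<+ (ℕ.s≤s (ℕ.s≤s ℕ.z≤n))) , ℚ.<⇒≤ (ℚ.≰⇒> ε≰½)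

sum-*1 : ∀ {m} (w : Vector ℝ m) → sum (λ i → w i * 1ℝ) ≃ sum w
sum-*1 w = sum-cong λ i → pointwise⇒≃ {w i * 1ℝ} {w i} λ n → ℚ.*-identityʳ (seq (w i) n)

module _ {I : Set} {d} (φ : I → Point d) where

  generator∈Conv : ∀ i → Conv φ (φ i)
  generator∈Conv i = 1 , (λ _ → 1ℝ) , (λ _ → i) , (λ _ → 0≤fromℚ (ℚ.<⇒≤ (ℚ.positive⁻¹ 1ℚ))) ,
    pointwise⇒≃ {sum {1} (λ _ → 1ℝ)} {1ℝ} (λ _ → refl) ,
    λ k → pointwise⇒≃ {φ i k} {combination {1} (λ _ → 1ℝ) (λ _ → φ i) k} λ n →
      sym (trans (ℚ.+-identityʳ _) (ℚ.*-identityˡ (seq (φ i k) n)))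

  -- x = t φᵢ + (1 - t) z with 0 < t ≤ wⱼ rational, so that only rational
  -- divisions are needed to write down the weights of z.
  positiveWeight⇒generator : ∀ {x} → IsVertex (Conv φ) x →
    ∀ {m} (w : Vector ℝ m) (s : Vector I m) → (∀ j → 0ℝ ≤ w j) → sum w ≃ 1ℝ →
    x ≈ combination w (φ ∘ s) → ∀ j → 0ℝ < w j → φ (s j) ≈ x
  positiveWeight⇒generator {x} (_ , extreme) {m} w s 0≤w Σw≃1 x≈ j (ε , 0<ε , N , ε≤wⱼ)
    with t , 0<t , t<1 , t≤ε ← rationalWeight 0<ε
    with u , 0<u , [1-t]u≡1 ← divide (1ℚ ℚ.- t) 1ℚ (p<q⇒0<q-p t<1) (ℚ.positive⁻¹ 1ℚ) =
    proj₁ (extreme {φ (s j)} {z} (fromℚ t) (generator∈Conv (s j))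
      (m , w′ , s , 0≤w′ , Σw′≃1 , λ k → ≃-refl {z k})
      (0<fromℚ 0<t) (1ℚ ℚ.- t , p<q⇒0<q-p t<1 , 0 , λ _ _ → ℚ.≤-refl) split)
    where
    w′ : Vector ℝ m
    w′ i = (w i - fromℚ t * e j i) * fromℚ u
    z : Point _
    z = combination w′ (φ ∘ s)
    0≤w-te : ∀ i → 0ℝ ≤ w i - fromℚ t * e j i
    0≤w-te i η 0<η with j Fin.≟ i
    ... | yes refl = N , λ n n≥ → ℚ.≤-<-trans (subst₂ ℚ._≤_
            (solve 2 (λ w t → t :- (w :- con 0ℚ) := con 0ℚ :- (w :- t :* con 1ℚ)) refl (seq (w j) n) t)
            (ℚ.+-inverseʳ ε)
            (ℚ.+-mono-≤ t≤ε (ℚ.neg-antimono-≤ (ε≤wⱼ n n≥)))) 0<η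
    ... | no  _ with L , h ← 0≤w i η 0<η = L , λ n n≥ → subst (ℚ._< η)
            (solve 2 (λ w t → con 0ℚ :- w := con 0ℚ :- (w :- t :* con 0ℚ)) refl (seq (w i) n) t) (h n n≥)
    0≤w′ : ∀ i → 0ℝ ≤ w′ i
    0≤w′ i = 0≤x*c (w i - fromℚ t * e j i) (0≤w-te i) 0<u
    Σw′≃1 : sum w′ ≃ 1ℝ
    Σw′≃1 = ≃-trans {sum w′} {(sum w - fromℚ t) * fromℚ u} {1ℝ}
      (≃-trans {sum w′} {sum (λ i → w′ i * 1ℝ)} {(sum w - fromℚ t) * fromℚ u}
        (≃-sym {sum (λ i → w′ i * 1ℝ)} {sum w′} (sum-*1 w′))
        (≃-trans {sum (λ i → w′ i * 1ℝ)} {(sum (λ i → w i * 1ℝ) - fromℚ t) * fromℚ u} {(sum w - fromℚ t) * fromℚ u}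
          (pointwise⇒≃ {sum (λ i → w′ i * 1ℝ)} {(sum (λ i → w i * 1ℝ) - fromℚ t) * fromℚ u} λ n →
            trans (seq-sum-shifted w (λ _ → 1ℝ) j t u n)
              (cong (λ q → (seq (sum (λ i → w i * 1ℝ)) n ℚ.- q) ℚ.* u) (ℚ.*-identityʳ t)))
          (*-cong {sum (λ i → w i * 1ℝ) - fromℚ t} {sum w - fromℚ t} {fromℚ u} {fromℚ u}
            (+-cong {sum (λ i → w i * 1ℝ)} {sum w} { - fromℚ t} { - fromℚ t} (sum-*1 w) (≃-refl { - fromℚ t}))
            (≃-refl {fromℚ u}))))
      (≃-trans {(sum w - fromℚ t) * fromℚ u} {(1ℝ - fromℚ t) * fromℚ u} {1ℝ}
        (*-cong {sum w - fromℚ t} {1ℝ - fromℚ t} {fromℚ u} {fromℚ u}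
          (+-cong {sum w} {1ℝ} { - fromℚ t} { - fromℚ t} Σw≃1 (≃-refl { - fromℚ t}))
          (≃-refl {fromℚ u}))
        (pointwise⇒≃ {(1ℝ - fromℚ t) * fromℚ u} {1ℝ} λ _ → [1-t]u≡1))
    split : x ≈ (λ k → fromℚ t * φ (s j) k + (1ℝ - fromℚ t) * z k)
    split k = ≃-trans {x k} {combination w (φ ∘ s) k} {fromℚ t * φ (s j) k + (1ℝ - fromℚ t) * z k}
      (x≈ k) (pointwise⇒≃ {combination w (φ ∘ s) k} {fromℚ t * φ (s j) k + (1ℝ - fromℚ t) * z k} λ n →
        let c = seq (combination w (φ ∘ s) k) n
            p = seq (φ (s j) k) n
        in sym (trans (cong (λ q → t ℚ.* p ℚ.+ (1ℚ ℚ.- t) ℚ.* q) (seq-sum-shifted w (λ i → φ (s i) k) j t u n))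
          (trans (solve 4 (λ t u c p → t :* p :+ (con 1ℚ :- t) :* ((c :- t :* p) :* u)
                      := t :* p :+ (con 1ℚ :- t) :* u :* (c :- t :* p)) refl t u c p)
            (trans (cong (λ q → t ℚ.* p ℚ.+ q ℚ.* (c ℚ.- t ℚ.* p)) [1-t]u≡1)
              (solve 3 (λ t c p → t :* p :+ con 1ℚ :* (c :- t :* p) := c) refl t c p)))))

  -- A positive weight would exhibit a generator equal to `x`. If there is none, every weight is
  -- nonnegative but not positive, hence zero, and the weights could not sum to one.
  vertex⇒generator : ∀ {x} → IsVertex (Conv φ) x → ¬ ¬ (∃[ i ] φ i ≈ x)
  vertex⇒generator {x} vertex@((m , w , s , 0≤w , Σw≃1 , x≈) , _) none =
    1≄0 (≃-trans {1ℝ} {sum w} {0ℝ} (≃-sym {sum w} {1ℝ} Σw≃1)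
      (≃-trans {sum w} {sum {m} (λ _ → 0ℝ)} {0ℝ}
        (sum-cong {x = w} {y = λ _ → 0ℝ} λ j → 0≤x≮0⇒x≃0 (w j) (0≤w j) λ 0<wⱼ →
          none (s j , positiveWeight⇒generator {x} vertex w s 0≤w Σw≃1 x≈ j 0<wⱼ))
        (pointwise⇒≃ {sum {m} (λ _ → 0ℝ)} {0ℝ} (sum-0 m))))
    where
    sum-0 : ∀ m n → seq (sum {m} (λ _ → 0ℝ)) n ≡ 0ℚ
    sum-0 zero    n = refl
    sum-0 (suc m) n = trans (ℚ.+-identityˡ _) (sum-0 m n)

-- Recursively built triangulations

-- The indicator of `k < m`, which is coordinate `k` of the simplex vertex `f m`.
below : ℕ → ℕ → ℚ
below k       zero    = 0ℚ
below zero    (suc m) = 1ℚ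
below (suc k) (suc m) = below k m

below-≥ : ∀ {k m} → m ℕ.≤ k → below k m ≡ 0ℚ
below-≥ ℕ.z≤n       = refl
below-≥ (ℕ.s≤s m≤k) = below-≥ m≤k

below-< : ∀ {k m} → k ℕ.< m → below k m ≡ 1ℚ
below-< {zero}  (ℕ.s≤s _)   = refl
below-< {suc k} (ℕ.s≤s k<m) = below-< k<m

prefix : (ℕ → ℚ) → ℕ → ℚ
prefix g zero    = 0ℚ
prefix g (suc n) = prefix g n ℚ.+ g n

-- The sum of `g` over `i ≤ k < j`. As a difference of prefix sums it splits at any intermediate
-- point by a ring identity.
Δ : (ℕ → ℚ) → ℕ → ℕ → ℚ
Δ g i j = prefix g j ℚ.- prefix g i

abstract
  Δ-split : ∀ g i k j → Δ g i j ≡ Δ g i k ℚ.+ Δ g k j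
  Δ-split g i k j = solve 3 (λ i k j → j :- i := (k :- i) :+ (j :- k)) refl
    (prefix g i) (prefix g k) (prefix g j)

  Δ-cong : ∀ {g h i j} → i ℕ.≤ j → (∀ {k} → i ℕ.≤ k → k ℕ.< j → g k ≡ h k) → Δ g i j ≡ Δ h i j
  Δ-cong {g} {h} {i} i≤j = go (ℕ.≤⇒≤′ i≤j)
    where
    go : ∀ {j} → i ℕ.≤′ j → (∀ {k} → i ℕ.≤ k → k ℕ.< j → g k ≡ h k) → Δ g i j ≡ Δ h i j
    go ℕ.≤′-refl eq = trans (ℚ.+-inverseʳ (prefix g i)) (sym (ℚ.+-inverseʳ (prefix h i)))
    go {suc j} (ℕ.≤′-step i≤j) eq = begin
      prefix g j ℚ.+ g j ℚ.- prefix g i ≡⟨ swap (prefix g j) (g j) (prefix g i) ⟩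
      Δ g i j ℚ.+ g j                   ≡⟨ cong₂ ℚ._+_ (go i≤j λ i≤k k<j → eq i≤k (ℕ.m≤n⇒m≤1+n k<j))
                                                       (eq (ℕ.≤′⇒≤ i≤j) ℕ.≤-refl) ⟩
      Δ h i j ℚ.+ h j                   ≡⟨ swap (prefix h j) (h j) (prefix h i) ⟨
      prefix h j ℚ.+ h j ℚ.- prefix h i ∎
      where
      open ≡-Reasoning
      swap : ∀ a b c → a ℚ.+ b ℚ.- c ≡ (a ℚ.- c) ℚ.+ b
      swap = solve 3 (λ a b c → a :+ b :- c := (a :- c) :+ b) refl

  Δ-0 : ∀ i j → Δ (λ _ → 0ℚ) i j ≡ 0ℚ
  Δ-0 i j = cong₂ ℚ._-_ (prefix-0 j) (prefix-0 i)
    where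
    prefix-0 : ∀ n → prefix (λ _ → 0ℚ) n ≡ 0ℚ
    prefix-0 zero    = refl
    prefix-0 (suc n) = trans (ℚ.+-identityʳ _) (prefix-0 n)

  prefix-shift : ∀ g c n → prefix (λ k → g k ℚ.+ c) n ≡ prefix g n ℚ.+ c ℚ.* ⟦ n ⟧
  prefix-shift g c zero    = sym (trans (ℚ.+-identityˡ _) (ℚ.*-zeroʳ c))
  prefix-shift g c (suc n) = trans (cong (ℚ._+ (g n ℚ.+ c)) (prefix-shift g c n))
    (solve 4 (λ p c m g → (p :+ c :* m) :+ (g :+ c) := (p :+ g) :+ c :* (con 1ℚ :+ m)) refl
      (prefix g n) c ⟦ n ⟧ (g n))

  prefix-shift² : ∀ g c n → prefix (λ k → (g k ℚ.+ c) ℚ.* (g k ℚ.+ c)) n ≡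
    prefix (λ k → g k ℚ.* g k) n ℚ.+ (c ℚ.+ c) ℚ.* prefix g n ℚ.+ c ℚ.* c ℚ.* ⟦ n ⟧
  prefix-shift² g c zero    = solve 1 (λ c → con 0ℚ := con 0ℚ :+ (c :+ c) :* con 0ℚ :+ c :* c :* con 0ℚ) refl c
  prefix-shift² g c (suc n) = trans (cong (ℚ._+ ((g n ℚ.+ c) ℚ.* (g n ℚ.+ c))) (prefix-shift² g c n))
    (solve 5 (λ q p c m g → (q :+ (c :+ c) :* p :+ c :* c :* m) :+ (g :+ c) :* (g :+ c) :=
        (q :+ g :* g) :+ (c :+ c) :* (p :+ g) :+ c :* c :* (con 1ℚ :+ m)) refl
      (prefix (λ k → g k ℚ.* g k) n) (prefix g n) c ⟦ n ⟧ (g n))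

  Δ-shift : ∀ g c i j → Δ (λ k → g k ℚ.+ c) i j ≡ Δ g i j ℚ.+ c ℚ.* (⟦ j ⟧ ℚ.- ⟦ i ⟧)
  Δ-shift g c i j = trans (cong₂ ℚ._-_ (prefix-shift g c j) (prefix-shift g c i))
    (solve 5 (λ p q c i j → (p :+ c :* j) :- (q :+ c :* i) := (p :- q) :+ c :* (j :- i)) refl
      (prefix g j) (prefix g i) c ⟦ i ⟧ ⟦ j ⟧)

  Δ-shift² : ∀ g c i j → Δ (λ k → (g k ℚ.+ c) ℚ.* (g k ℚ.+ c)) i j ≡
    Δ (λ k → g k ℚ.* g k) i j ℚ.+ (c ℚ.+ c) ℚ.* Δ g i j ℚ.+ c ℚ.* c ℚ.* (⟦ j ⟧ ℚ.- ⟦ i ⟧)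
  Δ-shift² g c i j = trans (cong₂ ℚ._-_ (prefix-shift² g c j) (prefix-shift² g c i))
    (solve 7 (λ p₂ p q₂ q c i j → (p₂ :+ (c :+ c) :* p :+ c :* c :* j) :- (q₂ :+ (c :+ c) :* q :+ c :* c :* i) :=
        (p₂ :- q₂) :+ (c :+ c) :* (p :- q) :+ c :* c :* (j :- i)) refl
      (prefix (λ k → g k ℚ.* g k) j) (prefix g j) (prefix (λ k → g k ℚ.* g k) i) (prefix g i) c ⟦ i ⟧ ⟦ j ⟧)

sumOver : ∀ {A : Set} → (A → ℚ) → List A → ℚ
sumOver g List.[]       = 0ℚ
sumOver g (x List.∷ xs) = g x ℚ.+ sumOver g xs

sumOver-++ : ∀ {A : Set} (g : A → ℚ) xs ys → sumOver g (xs ++ ys) ≡ sumOver g xs ℚ.+ sumOver g ys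
sumOver-++ g List.[]       ys = sym (ℚ.+-identityˡ _)
sumOver-++ g (x List.∷ xs) ys = trans (cong (g x ℚ.+_) (sumOver-++ g xs ys)) (sym (ℚ.+-assoc (g x) _ _))

-- Solver expressions for the three functions below. The coefficients are forced: the splitting
-- identities with `t = 1`, together with the value zero at one, determine each polynomial on the
-- positive integers.
area₃ₚ coordSumₚ normSqₚ : ∀ {n} → +-*-Solver.Polynomial n → +-*-Solver.Polynomial n
area₃ₚ s    = s :* s :* s :- s
coordSumₚ s = con ½ :* (s :* s :* s :* s :- s :* s)
normSqₚ s   = con (ℤ.+ 2 ℚ./ 7) :* s⁷ :- con (ℤ.+ 3 ℚ./ 5) :* s⁵ :+ con (ℤ.+ 1 ℚ./ 3) :* s³ :- con (ℤ.+ 2 ℚ./ 105) :* s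
  where
  s³ = s :* s :* s
  s⁵ = s³ :* s :* s
  s⁷ = s⁵ :* s :* s

-- As functions of s = j - i, for the subpolygon on the vertices i, …, j and with
-- areas in units of ½∣D b³∣: three times the area, and the sums of the
-- coordinates and of their squares over the range i ≤ k < j.
opaque
  area₃ coordSum normSq : ℚ → ℚ
  area₃ s    = s ℚ.* s ℚ.* s ℚ.- s
  coordSum s = ½ ℚ.* (s ℚ.* s ℚ.* s ℚ.* s ℚ.- s ℚ.* s)
  normSq s   = let s³ = s ℚ.* s ℚ.* s; s⁵ = s³ ℚ.* s ℚ.* s; s⁷ = s⁵ ℚ.* s ℚ.* s in
    (ℤ.+ 2 ℚ./ 7) ℚ.* s⁷ ℚ.- (ℤ.+ 3 ℚ./ 5) ℚ.* s⁵ ℚ.+ (ℤ.+ 1 ℚ./ 3) ℚ.* s³ ℚ.- (ℤ.+ 2 ℚ./ 105) ℚ.* s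

  -- Vandermonde determinant of three parameters with successive gaps s and t.
  V : ℚ → ℚ → ℚ
  V s t = s ℚ.* (s ℚ.+ t) ℚ.* t

  area₃-1 : area₃ 1ℚ ≡ 0ℚ
  area₃-1 = refl

  coordSum-1 : coordSum 1ℚ ≡ 0ℚ
  coordSum-1 = refl

  normSq-1 : normSq 1ℚ ≡ 0ℚ
  normSq-1 = refl

  area₃-split : ∀ s t → V s t ℚ.* (1ℚ ℚ.+ 1ℚ ℚ.+ 1ℚ) ℚ.+ (area₃ s ℚ.+ area₃ t) ≡ area₃ (s ℚ.+ t)
  area₃-split = solve 2 (λ s t → s :* (s :+ t) :* t :* (con 1ℚ :+ con 1ℚ :+ con 1ℚ) :+
    (area₃ₚ s :+ area₃ₚ t) := area₃ₚ (s :+ t)) refl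

  coordSum-split : ∀ s t → let v = V s t in
    (coordSum s ℚ.+ (v ℚ.+ v ℚ.+ area₃ t) ℚ.* s) ℚ.+ (coordSum t ℚ.+ v ℚ.* t) ≡ coordSum (s ℚ.+ t)
  coordSum-split = solve 2 (λ s t → let V = s :* (s :+ t) :* t in
    (coordSumₚ s :+ (V :+ V :+ area₃ₚ t) :* s) :+ (coordSumₚ t :+ V :* t) := coordSumₚ (s :+ t)) refl

  -- The left side is what remains after expanding the squares of coordinates shifted by `c` on the
  -- left part and by `v` on the right. That it depends on `s + t` alone is the reason why the
  -- position of the cut does not matter.
  normSq-split : ∀ s t → let v = V s t; c = v ℚ.+ v ℚ.+ area₃ t in
    (normSq s ℚ.+ (c ℚ.+ c) ℚ.* coordSum s ℚ.+ c ℚ.* c ℚ.* s) ℚ.+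
    (normSq t ℚ.+ (v ℚ.+ v) ℚ.* coordSum t ℚ.+ v ℚ.* v ℚ.* t) ≡ normSq (s ℚ.+ t)
  normSq-split = solve 2 (λ s t → let V = s :* (s :+ t) :* t; c = V :+ V :+ area₃ₚ t in
    (normSqₚ s :+ (c :+ c) :* coordSumₚ s :+ c :* c :* s) :+
    (normSqₚ t :+ (V :+ V) :* coordSumₚ t :+ V :* V :* t) := normSqₚ (s :+ t)) refl

-- Triangulations of the subpolygon on the vertices i, …, j.
data Tri {N} : Fin N → Fin N → Set where
  edge : ∀ {i j} → toℕ j ≡ suc (toℕ i) → Tri i j
  node : ∀ {i j} k → i Fin.< k → k Fin.< j → Tri i k → Tri k j → Tri i j

members : ∀ {N} {i j : Fin N} → Tri i j → List (Triangle N)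
members (edge _)                     = List.[]
members {i = i} {j} (node k i<k k<j t u) = triangle i k j i<k k<j List.∷ members t ++ members u

vandermonde₃ : ℚ → ℚ → ℚ → ℚ
vandermonde₃ x y z = (y ℚ.- x) ℚ.* (z ℚ.- x) ℚ.* (z ℚ.- y)

0<vandermonde₃ : ∀ {x y z} → x ℚ.< y → y ℚ.< z → 0ℚ ℚ.< vandermonde₃ x y z
0<vandermonde₃ x<y y<z = 0<p*q (0<p*q (p<q⇒0<q-p x<y) (p<q⇒0<q-p (ℚ.<-trans x<y y<z))) (p<q⇒0<q-p y<z)

vandermonde : ∀ {N} → Triangle N → ℚ
vandermonde (triangle i j k _ _) = vandermonde₃ ⟦ toℕ i ⟧ ⟦ toℕ j ⟧ ⟦ toℕ k ⟧

contribution : ∀ {N} → ℕ → Triangle N → ℚ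
contribution l σ@(triangle i j k _ _) =
  vandermonde σ ℚ.* (below l (toℕ i) ℚ.+ below l (toℕ j) ℚ.+ below l (toℕ k))

coordinate : ∀ {N} → List (Triangle N) → ℕ → ℚ
coordinate T l = sumOver (contribution l) T

opaque
  difference : ∀ {N} → Fin N → Fin N → ℚ
  difference i j = ⟦ toℕ j ⟧ ℚ.- ⟦ toℕ i ⟧

  Δ-+c : ∀ {N} g c (i j : Fin N) →
    Δ (λ l → g l ℚ.+ c) (toℕ i) (toℕ j) ≡ Δ g (toℕ i) (toℕ j) ℚ.+ c ℚ.* difference i j
  Δ-+c g c i j = Δ-shift g c (toℕ i) (toℕ j)

  Δ-+c² : ∀ {N} g c (i j : Fin N) → Δ (λ l → (g l ℚ.+ c) ℚ.* (g l ℚ.+ c)) (toℕ i) (toℕ j) ≡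
    Δ (λ l → g l ℚ.* g l) (toℕ i) (toℕ j) ℚ.+ (c ℚ.+ c) ℚ.* Δ g (toℕ i) (toℕ j) ℚ.+ c ℚ.* c ℚ.* difference i j
  Δ-+c² g c i j = Δ-shift² g c (toℕ i) (toℕ j)

  difference-split : ∀ {N} (i k j : Fin N) → difference i k ℚ.+ difference k j ≡ difference i j
  difference-split i k j = solve 3 (λ i k j → (k :- i) :+ (j :- k) := j :- i) refl ⟦ toℕ i ⟧ ⟦ toℕ k ⟧ ⟦ toℕ j ⟧

  difference-edge : ∀ {N} {i j : Fin N} → toℕ j ≡ suc (toℕ i) → difference i j ≡ 1ℚ
  difference-edge {i = i} eq = trans (cong (λ m → ⟦ m ⟧ ℚ.- ⟦ toℕ i ⟧) eq)
    (solve 1 (λ i → (con 1ℚ :+ i) :- i := con 1ℚ) refl ⟦ toℕ i ⟧)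

module _ {N} {i j : Fin N} (k : Fin N) (i<k : i Fin.< k) (k<j : k Fin.< j) (t : Tri i k) (u : Tri k j) where

  private
    s = difference i k
    r = difference k j

  opaque
    unfolding V difference

    -- Rewrites the root's Vandermonde factor through the gaps `s` and `r`, whose sum is the gap
    -- from `i` to `j`; absolute positions then enter only through `below`.
    coordinate-node : ∀ l → coordinate (members (node k i<k k<j t u)) l ≡
      V s r ℚ.* (below l (toℕ i) ℚ.+ below l (toℕ k) ℚ.+ below l (toℕ j)) ℚ.+
      (coordinate (members t) l ℚ.+ coordinate (members u) l)
    coordinate-node l = cong₂ ℚ._+_
      (cong (λ q → s ℚ.* q ℚ.* r ℚ.* (below l (toℕ i) ℚ.+ below l (toℕ k) ℚ.+ below l (toℕ j)))
        (sym (difference-split i k j)))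
      (sumOver-++ (contribution l) (members t) (members u))

coordinate-high : ∀ {N} {i j : Fin N} (t : Tri i j) {l} → toℕ j ℕ.≤ l → coordinate (members t) l ≡ 0ℚ
coordinate-high (edge _) _ = refl
coordinate-high {i = i} {j} (node k i<k k<j t u) {l} j≤l = begin
  coordinate (members (node k i<k k<j t u)) l
    ≡⟨ coordinate-node k i<k k<j t u l ⟩
  v ℚ.* (below l (toℕ i) ℚ.+ below l (toℕ k) ℚ.+ below l (toℕ j)) ℚ.+
  (coordinate (members t) l ℚ.+ coordinate (members u) l)
    ≡⟨ cong₂ (λ p q → v ℚ.* p ℚ.+ q)
         (cong₂ ℚ._+_ (cong₂ ℚ._+_ (below-≥ (ℕ.≤-trans (ℕ.<⇒≤ i<k) k≤l)) (below-≥ k≤l)) (below-≥ j≤l))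
         (cong₂ ℚ._+_ (coordinate-high t k≤l) (coordinate-high u j≤l)) ⟩
  v ℚ.* (0ℚ ℚ.+ 0ℚ ℚ.+ 0ℚ) ℚ.+ (0ℚ ℚ.+ 0ℚ)
    ≡⟨ solve 1 (λ v → v :* (con 0ℚ :+ con 0ℚ :+ con 0ℚ) :+ (con 0ℚ :+ con 0ℚ) := con 0ℚ) refl v ⟩
  0ℚ ∎
  where
  open ≡-Reasoning
  v = V (difference i k) (difference k j)
  k≤l : toℕ k ℕ.≤ l
  k≤l = ℕ.≤-trans (ℕ.<⇒≤ k<j) j≤l

-- All corners lie above `l`, so each triangle counts three times and only the total area remains.
coordinate-low : ∀ {N} {i j : Fin N} (t : Tri i j) {l} → l ℕ.< toℕ i →
  coordinate (members t) l ≡ area₃ (difference i j)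
coordinate-low {i = i} {j} (edge eq) _ = sym (trans (cong area₃ (difference-edge {i = i} {j} eq)) area₃-1)
coordinate-low {i = i} {j} (node k i<k k<j t u) {l} l<i = begin
  coordinate (members (node k i<k k<j t u)) l
    ≡⟨ coordinate-node k i<k k<j t u l ⟩
  V s r ℚ.* (below l (toℕ i) ℚ.+ below l (toℕ k) ℚ.+ below l (toℕ j)) ℚ.+
  (coordinate (members t) l ℚ.+ coordinate (members u) l)
    ≡⟨ cong₂ (λ p q → V s r ℚ.* p ℚ.+ q)
         (cong₂ ℚ._+_ (cong₂ ℚ._+_ (below-< l<i) (below-< l<k)) (below-< (ℕ.<-trans l<k k<j)))
         (cong₂ ℚ._+_ (coordinate-low t l<i) (coordinate-low u l<k)) ⟩
  V s r ℚ.* (1ℚ ℚ.+ 1ℚ ℚ.+ 1ℚ) ℚ.+ (area₃ s ℚ.+ area₃ r)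
    ≡⟨ area₃-split s r ⟩
  area₃ (s ℚ.+ r)
    ≡⟨ cong area₃ (difference-split i k j) ⟩
  area₃ (difference i j) ∎
  where
  open ≡-Reasoning
  s = difference i k
  r = difference k j
  l<k : l ℕ.< toℕ k
  l<k = ℕ.<-trans l<i i<k

-- Two corners of the root, `k` and `j`, lie above `l`, as do all corners of the right part.
coordinate-left : ∀ {N} {i j : Fin N} k (i<k : i Fin.< k) (k<j : k Fin.< j) (t : Tri i k) (u : Tri k j) →
  ∀ {l} → toℕ i ℕ.≤ l → l ℕ.< toℕ k → coordinate (members (node k i<k k<j t u)) l ≡
  let v = V (difference i k) (difference k j) in
  coordinate (members t) l ℚ.+ (v ℚ.+ v ℚ.+ area₃ (difference k j))
coordinate-left {i = i} {j} k i<k k<j t u {l} i≤l l<k = begin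
  coordinate (members (node k i<k k<j t u)) l
    ≡⟨ coordinate-node k i<k k<j t u l ⟩
  v ℚ.* (below l (toℕ i) ℚ.+ below l (toℕ k) ℚ.+ below l (toℕ j)) ℚ.+
  (coordinate (members t) l ℚ.+ coordinate (members u) l)
    ≡⟨ cong₂ (λ p q → v ℚ.* p ℚ.+ (coordinate (members t) l ℚ.+ q))
         (cong₂ ℚ._+_ (cong₂ ℚ._+_ (below-≥ i≤l) (below-< l<k)) (below-< (ℕ.<-trans l<k k<j)))
         (coordinate-low u l<k) ⟩
  v ℚ.* (0ℚ ℚ.+ 1ℚ ℚ.+ 1ℚ) ℚ.+ (coordinate (members t) l ℚ.+ area₃ (difference k j))
    ≡⟨ solve 3 (λ v x a → v :* (con 0ℚ :+ con 1ℚ :+ con 1ℚ) :+ (x :+ a) := x :+ (v :+ v :+ a)) refl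
         v (coordinate (members t) l) (area₃ (difference k j)) ⟩
  coordinate (members t) l ℚ.+ (v ℚ.+ v ℚ.+ area₃ (difference k j)) ∎
  where
  open ≡-Reasoning
  v = V (difference i k) (difference k j)

-- Of the root only the corner `j` lies above `l`, and the left part has no corner there.
coordinate-right : ∀ {N} {i j : Fin N} k (i<k : i Fin.< k) (k<j : k Fin.< j) (t : Tri i k) (u : Tri k j) →
  ∀ {l} → toℕ k ℕ.≤ l → l ℕ.< toℕ j → coordinate (members (node k i<k k<j t u)) l ≡
  coordinate (members u) l ℚ.+ V (difference i k) (difference k j)
coordinate-right {i = i} {j} k i<k k<j t u {l} k≤l l<j = begin
  coordinate (members (node k i<k k<j t u)) l
    ≡⟨ coordinate-node k i<k k<j t u l ⟩
  v ℚ.* (below l (toℕ i) ℚ.+ below l (toℕ k) ℚ.+ below l (toℕ j)) ℚ.+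
  (coordinate (members t) l ℚ.+ coordinate (members u) l)
    ≡⟨ cong₂ (λ p q → v ℚ.* p ℚ.+ (q ℚ.+ coordinate (members u) l))
         (cong₂ ℚ._+_ (cong₂ ℚ._+_ (below-≥ (ℕ.≤-trans (ℕ.<⇒≤ i<k) k≤l)) (below-≥ k≤l)) (below-< l<j))
         (coordinate-high t k≤l) ⟩
  v ℚ.* (0ℚ ℚ.+ 0ℚ ℚ.+ 1ℚ) ℚ.+ (0ℚ ℚ.+ coordinate (members u) l)
    ≡⟨ solve 2 (λ v x → v :* (con 0ℚ :+ con 0ℚ :+ con 1ℚ) :+ (con 0ℚ :+ x) := x :+ v) refl
         v (coordinate (members u) l) ⟩
  coordinate (members u) l ℚ.+ v ∎
  where
  open ≡-Reasoning
  v = V (difference i k) (difference k j)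

Δ-coordinate : ∀ {N} {i j : Fin N} (t : Tri i j) →
  Δ (coordinate (members t)) (toℕ i) (toℕ j) ≡ coordSum (difference i j)
Δ-coordinate {i = i} {j} (edge eq) = trans (Δ-0 (toℕ i) (toℕ j)) (sym (trans (cong coordSum (difference-edge {i = i} {j} eq)) coordSum-1))
Δ-coordinate {i = i} {j} n@(node k i<k k<j t u) = begin
  Δ X (toℕ i) (toℕ j)
    ≡⟨ Δ-split X (toℕ i) (toℕ k) (toℕ j) ⟩
  Δ X (toℕ i) (toℕ k) ℚ.+ Δ X (toℕ k) (toℕ j)
    ≡⟨ cong₂ ℚ._+_ (Δ-cong (ℕ.<⇒≤ i<k) (coordinate-left k i<k k<j t u))
                   (Δ-cong (ℕ.<⇒≤ k<j) (coordinate-right k i<k k<j t u)) ⟩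
  Δ (λ l → coordinate (members t) l ℚ.+ c) (toℕ i) (toℕ k) ℚ.+
  Δ (λ l → coordinate (members u) l ℚ.+ V s r) (toℕ k) (toℕ j)
    ≡⟨ cong₂ ℚ._+_ (Δ-+c (coordinate (members t)) c i k)
                   (Δ-+c (coordinate (members u)) (V s r) k j) ⟩
  (Δ (coordinate (members t)) (toℕ i) (toℕ k) ℚ.+ c ℚ.* s) ℚ.+
  (Δ (coordinate (members u)) (toℕ k) (toℕ j) ℚ.+ V s r ℚ.* r)
    ≡⟨ cong₂ (λ p q → (p ℚ.+ c ℚ.* s) ℚ.+ (q ℚ.+ V s r ℚ.* r)) (Δ-coordinate t) (Δ-coordinate u) ⟩
  (coordSum s ℚ.+ c ℚ.* s) ℚ.+ (coordSum r ℚ.+ V s r ℚ.* r)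
    ≡⟨ coordSum-split s r ⟩
  coordSum (s ℚ.+ r)
    ≡⟨ cong coordSum (difference-split i k j) ⟩
  coordSum (difference i j) ∎
  where
  open ≡-Reasoning
  X = coordinate (members n)
  s = difference i k
  r = difference k j
  c = V s r ℚ.+ V s r ℚ.+ area₃ r

Δ-coordinate² : ∀ {N} {i j : Fin N} (t : Tri i j) →
  Δ (λ l → coordinate (members t) l ℚ.* coordinate (members t) l) (toℕ i) (toℕ j) ≡ normSq (difference i j)
Δ-coordinate² {i = i} {j} (edge eq) = trans (Δ-0 (toℕ i) (toℕ j)) (sym (trans (cong normSq (difference-edge {i = i} {j} eq)) normSq-1))
Δ-coordinate² {i = i} {j} n@(node k i<k k<j t u) = begin
  Δ (sq X) (toℕ i) (toℕ j)
    ≡⟨ Δ-split (sq X) (toℕ i) (toℕ k) (toℕ j) ⟩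
  Δ (sq X) (toℕ i) (toℕ k) ℚ.+ Δ (sq X) (toℕ k) (toℕ j)
    ≡⟨ cong₂ ℚ._+_
         (Δ-cong (ℕ.<⇒≤ i<k) λ i≤l l<k → cong (λ q → q ℚ.* q) (coordinate-left k i<k k<j t u i≤l l<k))
         (Δ-cong (ℕ.<⇒≤ k<j) λ k≤l l<j → cong (λ q → q ℚ.* q) (coordinate-right k i<k k<j t u k≤l l<j)) ⟩
  Δ (sq λ l → coordinate (members t) l ℚ.+ c) (toℕ i) (toℕ k) ℚ.+
  Δ (sq λ l → coordinate (members u) l ℚ.+ V s r) (toℕ k) (toℕ j)
    ≡⟨ cong₂ ℚ._+_ (Δ-+c² (coordinate (members t)) c i k)
                   (Δ-+c² (coordinate (members u)) (V s r) k j) ⟩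
  (Δ (sq (coordinate (members t))) (toℕ i) (toℕ k) ℚ.+
    (c ℚ.+ c) ℚ.* Δ (coordinate (members t)) (toℕ i) (toℕ k) ℚ.+ c ℚ.* c ℚ.* s) ℚ.+
  (Δ (sq (coordinate (members u))) (toℕ k) (toℕ j) ℚ.+
    (V s r ℚ.+ V s r) ℚ.* Δ (coordinate (members u)) (toℕ k) (toℕ j) ℚ.+ V s r ℚ.* V s r ℚ.* r)
    ≡⟨ cong₂ ℚ._+_
         (cong₂ (λ p q → p ℚ.+ (c ℚ.+ c) ℚ.* q ℚ.+ c ℚ.* c ℚ.* s) (Δ-coordinate² t) (Δ-coordinate t))
         (cong₂ (λ p q → p ℚ.+ (V s r ℚ.+ V s r) ℚ.* q ℚ.+ V s r ℚ.* V s r ℚ.* r) (Δ-coordinate² u) (Δ-coordinate u)) ⟩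
  (normSq s ℚ.+ (c ℚ.+ c) ℚ.* coordSum s ℚ.+ c ℚ.* c ℚ.* s) ℚ.+
  (normSq r ℚ.+ (V s r ℚ.+ V s r) ℚ.* coordSum r ℚ.+ V s r ℚ.* V s r ℚ.* r)
    ≡⟨ normSq-split s r ⟩
  normSq (s ℚ.+ r)
    ≡⟨ cong normSq (difference-split i k j) ⟩
  normSq (difference i j) ∎
  where
  open ≡-Reasoning
  sq : (ℕ → ℚ) → ℕ → ℚ
  sq g l = g l ℚ.* g l
  X = coordinate (members n)
  s = difference i k
  r = difference k j
  c = V s r ℚ.+ V s r ℚ.+ area₃ r

Δ-nonneg : ∀ (g : ℕ → ℚ) → (∀ l → 0ℚ ℚ.≤ g l) → ∀ n → 0ℚ ℚ.≤ Δ g 0 n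
Δ-nonneg g 0≤g n = subst (0ℚ ℚ.≤_) (sym (ℚ.+-identityʳ (prefix g n))) (go n)
  where
  go : ∀ n → 0ℚ ℚ.≤ prefix g n
  go zero    = ℚ.≤-refl
  go (suc n) = ℚ.+-mono-≤ (go n) (0≤g n)

-- All triangles share the corner `j`: the cut is always at the successor of `i`, with an edge on
-- the left.
fan : ∀ m {N} {i j : Fin N} → toℕ j ≡ suc m ℕ.+ toℕ i → Tri i j
fan zero    j≡1+i = edge j≡1+i
fan (suc m) {N} {i} {j} j≡ = node k (ℕ.≤-reflexive (sym k≡1+i))
  (subst₂ ℕ._<_ (sym k≡1+i) (sym j≡) (ℕ.s≤s (ℕ.s≤s (ℕ.m≤n+m (toℕ i) m))))
  (edge k≡1+i)
  (fan m (trans j≡ (trans (cong suc (sym (ℕ.+-suc m (toℕ i)))) (cong (λ l → suc m ℕ.+ l) (sym k≡1+i)))))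
  where
  1+i<N : suc (toℕ i) ℕ.< N
  1+i<N = ℕ.≤-<-trans (ℕ.≤-trans (ℕ.s≤s (ℕ.m≤n+m (toℕ i) (suc m))) (ℕ.≤-reflexive (sym j≡))) (Fin.toℕ<n j)
  k : Fin N
  k = Fin.fromℕ< 1+i<N
  k≡1+i : toℕ k ≡ suc (toℕ i)
  k≡1+i = Fin.toℕ-fromℕ< 1+i<N

-- The coefficients of `normSq` have mixed signs; reading its value as the sum of squares belonging
-- to the fan makes nonnegativity evident. The square root in the radius relies on it.
normSq-nonneg : ∀ {N} (j : Fin (suc N)) → 0 ℕ.< toℕ j → 0ℚ ℚ.≤ normSq (difference {suc N} zero j)
normSq-nonneg {N} j 0<j = subst (0ℚ ℚ.≤_) (Δ-coordinate² t)
  (Δ-nonneg (λ l → coordinate (members t) l ℚ.* coordinate (members t) l) (λ l → 0≤p² (coordinate (members t) l)) (toℕ j))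
  where
  t : Tri zero j
  t = fan (ℕ.pred (toℕ j)) (sym (trans (cong suc (ℕ.+-identityʳ (ℕ.pred (toℕ j)))) (ℕ.suc-pred (toℕ j) {{ℕ.>-nonZero 0<j}})))

-- From non-crossing lists of triangles to recursive triangulations

module _ {N} (σ : Triangle N) where
  open Triangle σ

  side-ij : IsSide (i , j) σ
  side-ij = i<j , (zero , refl) , (suc zero , refl)

  side-jk : IsSide (j , k) σ
  side-jk = j<k , (suc zero , refl) , (suc (suc zero) , refl)

  side-ik : IsSide (i , k) σ
  side-ik = ℕ.<-trans i<j j<k , (zero , refl) , (suc (suc zero) , refl)

triangle-≡ : ∀ {N} (σ τ : Triangle N) → Triangle.i σ ≡ Triangle.i τ → Triangle.j σ ≡ Triangle.j τ →
  Triangle.k σ ≡ Triangle.k τ → σ ≡ τ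
triangle-≡ (triangle i j k p q) (triangle .i .j .k r s) refl refl refl =
  cong₂ (triangle i j k) (ℕ.<-irrelevant p r) (ℕ.<-irrelevant q s)

members-bounded : ∀ {N} {i j : Fin N} (t : Tri i j) {σ} → σ ∈ members t →
  i Fin.≤ Triangle.i σ × Triangle.k σ Fin.≤ j
members-bounded (node k i<k k<j t u) (here refl) = ℕ.≤-refl , ℕ.≤-refl
members-bounded (node k i<k k<j t u) (there σ∈) with ∈-++⁻ (members t) σ∈
... | inj₁ σ∈t = let i≤ , ≤k = members-bounded t σ∈t in i≤ , ℕ.≤-trans ≤k (ℕ.<⇒≤ k<j)
... | inj₂ σ∈u = let k≤ , ≤j = members-bounded u σ∈u in ℕ.≤-trans (ℕ.<⇒≤ i<k) k≤ , ≤j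

members-unique : ∀ {N} {i j : Fin N} (t : Tri i j) → Unique (members t)
members-unique (edge _) = AllPairs.[]
members-unique {i = i} {j} (node k i<k k<j t u) =
  All.tabulate (λ τ∈ root≡τ → root∉ (subst (_∈ members t ++ members u) (sym root≡τ) τ∈)) AllPairs.∷
  Unique.++⁺ (members-unique t) (members-unique u) disjoint
  where
  disjoint : ∀ {σ} → ¬ (σ ∈ members t × σ ∈ members u)
  disjoint {σ} (σ∈t , σ∈u) = ℕ.<⇒≱ (proj₁ (side-ik σ))
    (ℕ.≤-trans (proj₂ (members-bounded t σ∈t)) (proj₁ (members-bounded u σ∈u)))
  root∉ : ¬ (triangle i k j i<k k<j ∈ members t ++ members u)
  root∉ root∈ with ∈-++⁻ (members t) root∈
  ... | inj₁ ∈t = ℕ.<⇒≱ k<j (proj₂ (members-bounded t ∈t))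
  ... | inj₂ ∈u = ℕ.<⇒≱ i<k (proj₁ (members-bounded u ∈u))

Crossing : ∀ {N} → Fin N × Fin N → Fin N × Fin N → Set
Crossing (i , j) (k , l) = i Fin.< k × k Fin.< j × j Fin.< l

-- `Crossing` fixes which chord starts first, so both orders have to be excluded.
Uncrossed : ∀ {N} → List (Triangle N) → Fin N × Fin N → Set
Uncrossed T d = ∀ {σ} → σ ∈ T → ∀ {s} → IsSide s σ → ¬ Crossing d s × ¬ Crossing s d

module _ {N} {T : List (Triangle N)}
  (sidesUncrossed : ∀ {σ} → σ ∈ T → ∀ {d} → IsSide d σ → Uncrossed T d)
  (bounded : ∀ {i j} → suc (toℕ i) ℕ.< toℕ j → Uncrossed T (i , j) →
    ∃[ σ ] σ ∈ T × Triangle.i σ ≡ i × Triangle.k σ ≡ j)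
  where

  private
    -- Induction on a bound `m` for the gap. The triangle supplied below the chord `i j` belongs to
    -- `T`, so its other two sides are again uncrossed chords and the construction continues under
    -- them.
    grow : ∀ m {i j} → toℕ j ℕ.≤ m ℕ.+ toℕ i → i Fin.< j → Uncrossed T (i , j) →
      ∃[ t ] All (_∈ T) (members {i = i} {j} t)
    grow zero    j≤i i<j _ = contradiction j≤i (ℕ.<⇒≱ i<j)
    grow (suc m) {i} {j} j≤ i<j d with ℕ.m≤n⇒m<n∨m≡n i<j
    ... | inj₂ 1+i≡j = edge (sym 1+i≡j) , All.[]
    ... | inj₁ 1+i<j with bounded 1+i<j d
    ...   | σ@(triangle i k j i<k k<j) , σ∈T , refl , refl =
      let t , t⊆T = grow m (ℕ.≤-pred (ℕ.≤-trans k<j j≤)) i<k (sidesUncrossed σ∈T (side-ij σ))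
          u , u⊆T = grow m (ℕ.≤-trans j≤ (ℕ.≤-trans (ℕ.≤-reflexive (sym (ℕ.+-suc m (toℕ i)))) (ℕ.+-monoʳ-≤ m i<k)))
                         k<j (sidesUncrossed σ∈T (side-jk σ))
      in node k i<k k<j t u , σ∈T All.∷ All.++⁺ t⊆T u⊆T

    -- A triangle of `T` on one side of `k` is found recursively. One that straddles `k` must be the
    -- root: any corner differing from the root's would make one of its sides cross the chord `i k`
    -- or `k j`.
    complete : ∀ {i j} (t : Tri i j) → All (_∈ T) (members t) → ∀ {σ} → σ ∈ T →
      i Fin.≤ Triangle.i σ → Triangle.k σ Fin.≤ j → σ ∈ members t
    complete (edge eq) _ {σ} _ i≤a c≤j = contradiction
      (ℕ.≤-trans (ℕ.≤-<-trans (ℕ.≤-<-trans i≤a (Triangle.i<j σ)) (Triangle.j<k σ)) c≤j)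
      (ℕ.<⇒≱ (ℕ.≤-reflexive (cong suc eq)))
    complete {i} {j} (node k i<k k<j t u) (root∈T All.∷ tu⊆T) {σ@(triangle a b c a<b b<c)} σ∈T i≤a c≤j
      with toℕ c ℕ.≤? toℕ k | toℕ k ℕ.≤? toℕ a
    ... | yes c≤k | _       = there (∈-++⁺ˡ (complete t (All.++⁻ˡ (members t) tu⊆T) σ∈T i≤a c≤k))
    ... | no _    | yes k≤a = there (∈-++⁺ʳ (members t) (complete u (All.++⁻ʳ (members t) tu⊆T) σ∈T k≤a c≤j))
    ... | no c≰k  | no k≰a  = here (triangle-≡ σ root a≡i b≡k c≡j)
      where
      root = triangle i k j i<k k<j
      a<k = ℕ.≰⇒> k≰a
      k<c = ℕ.≰⇒> c≰k
      a≡i : a ≡ i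
      a≡i with ℕ.m≤n⇒m<n∨m≡n i≤a
      ... | inj₂ i≡a = Fin.toℕ-injective (sym i≡a)
      ... | inj₁ i<a = ⊥-elim (proj₁ (sidesUncrossed root∈T (side-ij root) σ∈T (side-ik σ)) (i<a , a<k , k<c))
      c≡j : c ≡ j
      c≡j with ℕ.m≤n⇒m<n∨m≡n c≤j
      ... | inj₂ c≡j = Fin.toℕ-injective c≡j
      ... | inj₁ c<j = ⊥-elim (proj₂ (sidesUncrossed root∈T (side-jk root) σ∈T (side-ik σ)) (a<k , k<c , c<j))
      b≡k : b ≡ k
      b≡k with ℕ.<-cmp (toℕ b) (toℕ k)
      ... | tri≈ _ b≡k _ = Fin.toℕ-injective b≡k
      ... | tri< b<k _ _ = ⊥-elim (proj₁ (sidesUncrossed root∈T (side-ij root) σ∈T (side-jk σ))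
                             (subst (Fin._< b) a≡i a<b , b<k , k<c))
      ... | tri> _ _ k<b = ⊥-elim (proj₂ (sidesUncrossed root∈T (side-jk root) σ∈T (side-ij σ))
                             (a<k , k<b , subst (b Fin.<_) c≡j b<c))

  -- The chord from first to last vertex cannot be crossed, so the tree grows from it. Two lists
  -- without repetitions and with the same elements are permutations of each other, which suffices
  -- for sums over triangles.
  ↭-members : Unique T → ∀ {i j : Fin N} → i Fin.< j → (∀ k → i Fin.≤ k) → (∀ k → k Fin.≤ j) →
    ∃[ t ] T ↭ members {i = i} {j} t
  ↭-members T! {i} {j} i<j i≤ ≤j =
    let t , t⊆T = grow (toℕ j) (ℕ.m≤m+n (toℕ j) (toℕ i)) i<j λ _ _ →
          (λ (_ , _ , j<l) → ℕ.<⇒≱ j<l (≤j _)) , (λ (k<i , _) → ℕ.<⇒≱ k<i (i≤ _))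
    in t , ∼bag⇒↭ (unique∧set⇒bag T! (members-unique t)
         (mk⇔ (λ σ∈T → complete t t⊆T σ∈T (i≤ _) (≤j _)) (All.lookup t⊆T)))

-- Area vectors of equally spaced points

sumOver-cong : ∀ {A : Set} {g h : A → ℚ} xs → (∀ x → g x ≡ h x) → sumOver g xs ≡ sumOver h xs
sumOver-cong List.[]       eq = refl
sumOver-cong (x List.∷ xs) eq = cong₂ ℚ._+_ (eq x) (sumOver-cong xs eq)

sumOver-* : ∀ {A : Set} c (g : A → ℚ) xs → sumOver (λ x → c ℚ.* g x) xs ≡ c ℚ.* sumOver g xs
sumOver-* c g List.[]       = sym (ℚ.*-zeroʳ c)
sumOver-* c g (x List.∷ xs) = trans (cong (c ℚ.* g x ℚ.+_) (sumOver-* c g xs)) (sym (ℚ.*-distribˡ-+ c (g x) (sumOver g xs)))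

sumOver-↭ : ∀ {A : Set} (g : A → ℚ) {xs ys} → xs ↭ ys → sumOver g xs ≡ sumOver g ys
sumOver-↭ g _↭_.refl         = refl
sumOver-↭ g (_↭_.prep x p)   = cong (g x ℚ.+_) (sumOver-↭ g p)
sumOver-↭ g (_↭_.swap x y p) = trans (cong (λ s → g x ℚ.+ (g y ℚ.+ s)) (sumOver-↭ g p))
  (solve 3 (λ x y s → x :+ (y :+ s) := y :+ (x :+ s)) refl (g x) (g y) _)
sumOver-↭ g (_↭_.trans p q)  = trans (sumOver-↭ g p) (sumOver-↭ g q)

sumℚ-sumOver : ∀ {A : Set} {m} (g : Fin m → A → ℚ) xs →
  sumℚ (λ i → sumOver (g i) xs) ≡ sumOver (λ x → sumℚ (λ i → g i x)) xs
sumℚ-sumOver {m = m} g List.[]       = sum-replicate-zero m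
sumℚ-sumOver         g (x List.∷ xs) = trans (∑-distrib-+ (λ i → g i x) (λ i → sumOver (g i) xs))
  (cong (sumℚ (λ i → g i x) ℚ.+_) (sumℚ-sumOver g xs))

seq-sum : ∀ {m} (x : Vector ℝ m) n → seq (sum x) n ≡ sumℚ (λ i → seq (x i) n)
seq-sum {zero}  x n = refl
seq-sum {suc m} x n = cong (seq (x zero) n ℚ.+_) (seq-sum (x ∘ suc) n)

seq-sumList-filter : ∀ {A : Set} {P : A → Set} (P? : ∀ x → Dec (P x)) (g : A → ℝ) xs n →
  seq (sumList (List.map g (filter P? xs))) n ≡ sumOver (λ x → if does (P? x) then seq (g x) n else 0ℚ) xs
seq-sumList-filter P? g List.[]       n = refl
seq-sumList-filter P? g (x List.∷ xs) n with P? x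
... | yes _ = cong (seq (g x) n ℚ.+_) (seq-sumList-filter P? g xs n)
... | no  _ = trans (seq-sumList-filter P? g xs n) (sym (ℚ.+-identityˡ _))

seq-f : ∀ {d} (i : Fin (suc d)) (k : Fin d) n → seq (f i k) n ≡ below (toℕ k) (toℕ i)
seq-f {d}     zero    k       n = refl
seq-f {suc d} (suc i) (suc k) n = trans (ℚ.+-identityˡ _) (seq-f i k n)
seq-f {suc d} (suc i) zero    n = cong (1ℚ ℚ.+_)
  (trans (seq-sum {toℕ i} (λ j → e (suc (inject! {i = i} j)) zero) n) (sum-replicate-zero (toℕ i)))

sumℚ-single : ∀ {m} (j : Fin m) (h : Fin m → ℚ) → sumℚ (λ i → if does (j Fin.≟ i) then h i else 0ℚ) ≡ h j
sumℚ-single {suc m} zero    h = trans (cong (h zero ℚ.+_) (sum-replicate-zero m)) (ℚ.+-identityʳ (h zero))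
sumℚ-single         (suc j) h = trans (ℚ.+-identityˡ _) (sumℚ-single j (h ∘ suc))

sumℚ-corners : ∀ {N} (σ : Triangle N) (h : Fin N → ℚ) → let open Triangle σ in
  sumℚ (λ l → if does (l ∈ᵗ? σ) then h l else 0ℚ) ≡ h i ℚ.+ h j ℚ.+ h k
sumℚ-corners σ@(triangle i j k i<j j<k) h = begin
  sumℚ (λ l → if does (l ∈ᵗ? σ) then h l else 0ℚ)
    ≡⟨ sum-cong-≗ split ⟩
  sumℚ (λ l → single i l ℚ.+ single j l ℚ.+ single k l)
    ≡⟨ ∑-distrib-+ (λ l → single i l ℚ.+ single j l) (single k) ⟩
  sumℚ (λ l → single i l ℚ.+ single j l) ℚ.+ sumℚ (single k)
    ≡⟨ cong (ℚ._+ sumℚ (single k)) (∑-distrib-+ (single i) (single j)) ⟩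
  sumℚ (single i) ℚ.+ sumℚ (single j) ℚ.+ sumℚ (single k)
    ≡⟨ cong₂ ℚ._+_ (cong₂ ℚ._+_ (sumℚ-single i h) (sumℚ-single j h)) (sumℚ-single k h) ⟩
  h i ℚ.+ h j ℚ.+ h k ∎
  where
  open ≡-Reasoning
  single : Fin _ → Fin _ → ℚ
  single m l = if does (m Fin.≟ l) then h l else 0ℚ

  i≢j : i ≢ j
  i≢j = Fin.<⇒≢ i<j
  j≢k : j ≢ k
  j≢k = Fin.<⇒≢ j<k
  i≢k : i ≢ k
  i≢k = Fin.<⇒≢ (ℕ.<-trans i<j j<k)

  split : ∀ l → (if does (l ∈ᵗ? σ) then h l else 0ℚ) ≡ single i l ℚ.+ single j l ℚ.+ single k l
  split l with i Fin.≟ l | j Fin.≟ l | k Fin.≟ l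
  ... | yes i≡l | yes j≡l | _       = contradiction (trans i≡l (sym j≡l)) i≢j
  ... | yes i≡l | _       | yes k≡l = contradiction (trans i≡l (sym k≡l)) i≢k
  ... | _       | yes j≡l | yes k≡l = contradiction (trans j≡l (sym k≡l)) j≢k
  ... | yes _   | no _    | no _    = sym (trans (ℚ.+-identityʳ _) (ℚ.+-identityʳ (h l)))
  ... | no _    | yes _   | no _    = sym (trans (ℚ.+-identityʳ _) (ℚ.+-identityˡ (h l)))
  ... | no _    | no _    | yes _   = sym (ℚ.+-identityˡ (h l))
  ... | no _    | no _    | no _    = refl

sumℚ-Δ : ∀ d (g : ℕ → ℚ) → sumℚ {d} (g ∘ toℕ) ≡ Δ g 0 d
sumℚ-Δ d g = trans (go d g) (sym (ℚ.+-identityʳ (prefix g d)))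
  where
  prefix-suc : ∀ n g → prefix g (suc n) ≡ g 0 ℚ.+ prefix (g ∘ suc) n
  prefix-suc zero    g = ℚ.+-comm 0ℚ (g 0)
  prefix-suc (suc n) g = trans (cong (ℚ._+ g (suc n)) (prefix-suc n g)) (ℚ.+-assoc (g 0) _ _)
  go : ∀ d g → sumℚ {d} (g ∘ toℕ) ≡ prefix g d
  go zero    g = refl
  go (suc d) g = trans (cong (g 0 ℚ.+_) (go d (g ∘ suc))) (sym (prefix-suc d g))

seq-· : ∀ m b n → seq (m · b) n ≡ ⟦ m ⟧ ℚ.* seq b n
seq-· zero    b n = sym (ℚ.*-zeroˡ (seq b n))
seq-· (suc m) b n = trans (cong (seq b n ℚ.+_) (seq-· m b n))
  (solve 2 (λ b m → b :+ m :* b := (con 1ℚ :+ m) :* b) refl (seq b n) ⟦ m ⟧)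

-- Keeps the units and the final zero so that it agrees with the unfolding of `eval` on
-- representatives.
quadratic : ℚ → ℚ → ℚ → ℚ → ℚ
quadratic p₀ p₁ p₂ t = p₀ ℚ.* 1ℚ ℚ.+ (p₁ ℚ.* (t ℚ.* 1ℚ) ℚ.+ (p₂ ℚ.* (t ℚ.* (t ℚ.* 1ℚ)) ℚ.+ 0ℚ))

quadraticₚ : ∀ {n} (p₀ p₁ p₂ t : +-*-Solver.Polynomial n) → +-*-Solver.Polynomial n
quadraticₚ p₀ p₁ p₂ t = p₀ :* con 1ℚ :+ (p₁ :* (t :* con 1ℚ) :+ (p₂ :* (t :* (t :* con 1ℚ)) :+ con 0ℚ))

quadratic-diff : ∀ p₀ p₁ p₂ a b i j →
  quadratic p₀ p₁ p₂ (a ℚ.+ j ℚ.* b) ℚ.- quadratic p₀ p₁ p₂ (a ℚ.+ i ℚ.* b) ≡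
  (j ℚ.- i) ℚ.* b ℚ.* (p₁ ℚ.+ p₂ ℚ.* ((a ℚ.+ i ℚ.* b) ℚ.+ (a ℚ.+ j ℚ.* b)))
quadratic-diff = solve 7 (λ p₀ p₁ p₂ a b i j →
  quadraticₚ p₀ p₁ p₂ (a :+ j :* b) :- quadraticₚ p₀ p₁ p₂ (a :+ i :* b) :=
  (j :- i) :* b :* (p₁ :+ p₂ :* ((a :+ i :* b) :+ (a :+ j :* b)))) refl

-- The curve is the image of the parabola `(t , t²)` under an affine map whose linear part has
-- determinant `p₁ q₂ - p₂ q₁`; on the parabola the determinant of two edge vectors is a Vandermonde
-- product, and each of its three factors yields one `b`.
det-identity : ∀ p₁ p₂ q₁ q₂ a b i j k →
  let t = λ l → a ℚ.+ l ℚ.* b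
      chord = λ r₁ r₂ l → (l ℚ.- i) ℚ.* b ℚ.* (r₁ ℚ.+ r₂ ℚ.* (t i ℚ.+ t l)) in
  chord p₁ p₂ j ℚ.* chord q₁ q₂ k ℚ.- chord p₁ p₂ k ℚ.* chord q₁ q₂ j ≡
  (p₁ ℚ.* q₂ ℚ.- p₂ ℚ.* q₁) ℚ.* (b ℚ.* (b ℚ.* b)) ℚ.* ((j ℚ.- i) ℚ.* (k ℚ.- i) ℚ.* (k ℚ.- j))
det-identity p₁ p₂ q₁ q₂ a b i j k = begin
  (j ℚ.- i) ℚ.* b ℚ.* (p₁ ℚ.+ p₂ ℚ.* (tᵢ ℚ.+ (a ℚ.+ j ℚ.* b))) ℚ.* ((k ℚ.- i) ℚ.* b ℚ.* (q₁ ℚ.+ q₂ ℚ.* (tᵢ ℚ.+ (a ℚ.+ k ℚ.* b)))) ℚ.-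
  (k ℚ.- i) ℚ.* b ℚ.* (p₁ ℚ.+ p₂ ℚ.* (tᵢ ℚ.+ (a ℚ.+ k ℚ.* b))) ℚ.* ((j ℚ.- i) ℚ.* b ℚ.* (q₁ ℚ.+ q₂ ℚ.* (tᵢ ℚ.+ (a ℚ.+ j ℚ.* b))))
    ≡⟨ factor p₁ p₂ q₁ q₂ (j ℚ.- i) (k ℚ.- i) b (tᵢ ℚ.+ (a ℚ.+ j ℚ.* b)) (tᵢ ℚ.+ (a ℚ.+ k ℚ.* b)) ⟩
  (p₁ ℚ.* q₂ ℚ.- p₂ ℚ.* q₁) ℚ.* ((j ℚ.- i) ℚ.* (k ℚ.- i) ℚ.* (b ℚ.* b)) ℚ.* ((tᵢ ℚ.+ (a ℚ.+ k ℚ.* b)) ℚ.- (tᵢ ℚ.+ (a ℚ.+ j ℚ.* b)))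
    ≡⟨ cancel (p₁ ℚ.* q₂ ℚ.- p₂ ℚ.* q₁) (j ℚ.- i) (k ℚ.- i) b tᵢ a j k ⟩
  (p₁ ℚ.* q₂ ℚ.- p₂ ℚ.* q₁) ℚ.* (b ℚ.* (b ℚ.* b)) ℚ.* ((j ℚ.- i) ℚ.* (k ℚ.- i) ℚ.* (k ℚ.- j)) ∎
  where
  open ≡-Reasoning
  tᵢ = a ℚ.+ i ℚ.* b
  factor : ∀ p₁ p₂ q₁ q₂ x y b u v →
    x ℚ.* b ℚ.* (p₁ ℚ.+ p₂ ℚ.* u) ℚ.* (y ℚ.* b ℚ.* (q₁ ℚ.+ q₂ ℚ.* v)) ℚ.-
    y ℚ.* b ℚ.* (p₁ ℚ.+ p₂ ℚ.* v) ℚ.* (x ℚ.* b ℚ.* (q₁ ℚ.+ q₂ ℚ.* u)) ≡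
    (p₁ ℚ.* q₂ ℚ.- p₂ ℚ.* q₁) ℚ.* (x ℚ.* y ℚ.* (b ℚ.* b)) ℚ.* (v ℚ.- u)
  factor = solve 9 (λ p₁ p₂ q₁ q₂ x y b u v →
    x :* b :* (p₁ :+ p₂ :* u) :* (y :* b :* (q₁ :+ q₂ :* v)) :-
    y :* b :* (p₁ :+ p₂ :* v) :* (x :* b :* (q₁ :+ q₂ :* u)) :=
    (p₁ :* q₂ :- p₂ :* q₁) :* (x :* y :* (b :* b)) :* (v :- u)) refl
  cancel : ∀ d x y b t a j k →
    d ℚ.* (x ℚ.* y ℚ.* (b ℚ.* b)) ℚ.* ((t ℚ.+ (a ℚ.+ k ℚ.* b)) ℚ.- (t ℚ.+ (a ℚ.+ j ℚ.* b))) ≡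
    d ℚ.* (b ℚ.* (b ℚ.* b)) ℚ.* (x ℚ.* y ℚ.* (k ℚ.- j))
  cancel = solve 8 (λ d x y b t a j k →
    d :* (x :* y :* (b :* b)) :* ((t :+ (a :+ k :* b)) :- (t :+ (a :+ j :* b))) :=
    d :* (b :* (b :* b)) :* (x :* y :* (k :- j))) refl

vandermonde-nonneg : ∀ {N} (σ : Triangle N) → 0ℚ ℚ.≤ vandermonde σ
vandermonde-nonneg (triangle _ _ _ i<j j<k) = ℚ.<⇒≤ (0<vandermonde₃ (⟦⟧-mono-< i<j) (⟦⟧-mono-< j<k))

module _ (p q : Poly₂) (a b : ℝ) where

  wronskian areaUnit : ℝ
  wronskian = p (suc zero) * q (suc (suc zero)) - p (suc (suc zero)) * q (suc zero)
  areaUnit  = fromℚ ½ * ∣ wronskian * (b * (b * b)) ∣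

  parameter : ℕ → ℕ → ℚ
  parameter n m = seq a n ℚ.+ ⟦ m ⟧ ℚ.* seq b n

  seq-eval : ∀ (r : Poly₂) m n → seq (eval r (a + m · b)) n ≡
    quadratic (seq (r zero) n) (seq (r (suc zero)) n) (seq (r (suc (suc zero))) n) (parameter n m)
  seq-eval r m n = cong (λ t → quadratic (seq (r zero) n) (seq (r (suc zero)) n) (seq (r (suc (suc zero))) n) (seq a n ℚ.+ t))
    (seq-· m b n)

  module _ {N : ℕ} where

    private
      v : Vector (Point 2) N
      v = equallySpaced p q a b

    seq-vol : ∀ σ n → seq (vol v σ) n ≡ seq areaUnit n ℚ.* vandermonde σ
    seq-vol σ@(triangle i j k _ _) n = begin
      ½ ℚ.* ℚ.∣ (X j ℚ.- X i) ℚ.* (Y k ℚ.- Y i) ℚ.- (X k ℚ.- X i) ℚ.* (Y j ℚ.- Y i) ∣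
        ≡⟨ cong (λ z → ½ ℚ.* ℚ.∣ z ∣) (cong₂ ℚ._-_
             (cong₂ ℚ._*_ (chord p i j) (chord q i k)) (cong₂ ℚ._*_ (chord p i k) (chord q i j))) ⟩
      _ ≡⟨ cong (λ z → ½ ℚ.* ℚ.∣ z ∣)
             (det-identity (p₁ p) (p₂ p) (p₁ q) (p₂ q) (seq a n) (seq b n) ⟦ toℕ i ⟧ ⟦ toℕ j ⟧ ⟦ toℕ k ⟧) ⟩
      ½ ℚ.* ℚ.∣ d ℚ.* vandermonde σ ∣
        ≡⟨ cong (½ ℚ.*_) (ℚ.∣p*q∣≡∣p∣*∣q∣ d (vandermonde σ)) ⟩
      ½ ℚ.* (ℚ.∣ d ∣ ℚ.* ℚ.∣ vandermonde σ ∣)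
        ≡⟨ cong (λ z → ½ ℚ.* (ℚ.∣ d ∣ ℚ.* z)) (ℚ.0≤p⇒∣p∣≡p (vandermonde-nonneg σ)) ⟩
      ½ ℚ.* (ℚ.∣ d ∣ ℚ.* vandermonde σ)
        ≡⟨ ℚ.*-assoc ½ ℚ.∣ d ∣ (vandermonde σ) ⟨
      ½ ℚ.* ℚ.∣ d ∣ ℚ.* vandermonde σ ∎
      where
      open ≡-Reasoning
      X Y : Fin N → ℚ
      X l = seq (v l zero) n
      Y l = seq (v l (suc zero)) n
      p₁ p₂ : Poly₂ → ℚ
      p₁ r = seq (r (suc zero)) n
      p₂ r = seq (r (suc (suc zero))) n
      d = seq (wronskian * (b * (b * b))) n
      chord : ∀ (r : Poly₂) (l m : Fin N) →
        seq (eval r (a + toℕ m · b)) n ℚ.- seq (eval r (a + toℕ l · b)) n ≡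
        (⟦ toℕ m ⟧ ℚ.- ⟦ toℕ l ⟧) ℚ.* seq b n ℚ.* (p₁ r ℚ.+ p₂ r ℚ.* (parameter n (toℕ l) ℚ.+ parameter n (toℕ m)))
      chord r l m = trans (cong₂ ℚ._-_ (seq-eval r (toℕ m) n) (seq-eval r (toℕ l) n))
        (quadratic-diff (seq (r zero) n) (p₁ r) (p₂ r) (seq a n) (seq b n) ⟦ toℕ l ⟧ ⟦ toℕ m ⟧)

  module _ {d : ℕ} where

    private
      v : Vector (Point 2) (suc d)
      v = equallySpaced p q a b

    -- Interchange the sums over vertices and over triangles: each triangle then gives its area
    -- times the number of its corners above `k`, and the common factor `areaUnit` comes out.
    seq-areaVector : ∀ (T : Triangulation v) k n → seq (areaVector v T k) n ≡
      seq areaUnit n ℚ.* coordinate (Triangulation.triangles T) (toℕ k)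
    seq-areaVector T k n = begin
      seq (areaVector v T k) n
        ≡⟨ seq-sum (λ i → sumList (List.map (λ σ → vol v σ * f i k) (filter (i ∈ᵗ?_) ts))) n ⟩
      sumℚ (λ i → seq (sumList (List.map (λ σ → vol v σ * f i k) (filter (i ∈ᵗ?_) ts))) n)
        ≡⟨ sum-cong-≗ (λ i → seq-sumList-filter (i ∈ᵗ?_) (λ σ → vol v σ * f i k) ts n) ⟩
      sumℚ (λ i → sumOver (λ σ → if does (i ∈ᵗ? σ) then seq (vol v σ) n ℚ.* seq (f i k) n else 0ℚ) ts)
        ≡⟨ sumℚ-sumOver (λ i σ → if does (i ∈ᵗ? σ) then seq (vol v σ) n ℚ.* seq (f i k) n else 0ℚ) ts ⟩
      sumOver (λ σ → sumℚ λ i → if does (i ∈ᵗ? σ) then seq (vol v σ) n ℚ.* seq (f i k) n else 0ℚ) ts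
        ≡⟨ sumOver-cong ts step ⟩
      sumOver (λ σ → seq areaUnit n ℚ.* contribution (toℕ k) σ) ts
        ≡⟨ sumOver-* (seq areaUnit n) (contribution (toℕ k)) ts ⟩
      seq areaUnit n ℚ.* coordinate ts (toℕ k) ∎
      where
      open ≡-Reasoning
      ts = Triangulation.triangles T
      step : ∀ σ → sumℚ (λ i → if does (i ∈ᵗ? σ) then seq (vol v σ) n ℚ.* seq (f i k) n else 0ℚ) ≡
        seq areaUnit n ℚ.* contribution (toℕ k) σ
      step σ@(triangle i j l _ _) = begin
        sumℚ (λ i → if does (i ∈ᵗ? σ) then seq (vol v σ) n ℚ.* seq (f i k) n else 0ℚ)
          ≡⟨ sumℚ-corners σ (λ i → seq (vol v σ) n ℚ.* seq (f i k) n) ⟩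
        seq (vol v σ) n ℚ.* seq (f i k) n ℚ.+ seq (vol v σ) n ℚ.* seq (f j k) n ℚ.+ seq (vol v σ) n ℚ.* seq (f l k) n
          ≡⟨ cong₂ ℚ._+_ (cong₂ ℚ._+_ (cong₂ ℚ._*_ (seq-vol σ n) (seq-f i k n))
               (cong₂ ℚ._*_ (seq-vol σ n) (seq-f j k n))) (cong₂ ℚ._*_ (seq-vol σ n) (seq-f l k n)) ⟩
        c ℚ.* V′ ℚ.* B i ℚ.+ c ℚ.* V′ ℚ.* B j ℚ.+ c ℚ.* V′ ℚ.* B l
          ≡⟨ solve 5 (λ c v x y z → c :* v :* x :+ c :* v :* y :+ c :* v :* z := c :* (v :* (x :+ y :+ z))) refl
               c V′ (B i) (B j) (B l) ⟩
        c ℚ.* (V′ ℚ.* (B i ℚ.+ B j ℚ.+ B l)) ∎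
        where
        c = seq areaUnit n
        V′ = vandermonde σ
        B : Fin (suc d) → ℚ
        B m = below (toℕ k) (toℕ m)

    seq-normSq : ∀ (T : Triangulation v) (t : Tri zero (Fin.fromℕ d)) →
      Triangulation.triangles T ↭ members t → ∀ n →
      seq (sum (λ k → areaVector v T k ^ 2)) n ≡
      seq areaUnit n ℚ.* seq areaUnit n ℚ.* normSq (difference {suc d} zero (Fin.fromℕ d))
    seq-normSq T t T↭t n = begin
      seq (sum (λ k → areaVector v T k ^ 2)) n
        ≡⟨ seq-sum (λ k → areaVector v T k ^ 2) n ⟩
      sumℚ (λ k → seq (areaVector v T k) n ℚ.* (seq (areaVector v T k) n ℚ.* 1ℚ))
        ≡⟨ sum-cong-≗ (λ k → trans
             (cong (λ x → x ℚ.* (x ℚ.* 1ℚ)) (trans (seq-areaVector T k n) (cong (c ℚ.*_) (sumOver-↭ (contribution (toℕ k)) T↭t))))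
             (solve 2 (λ c x → (c :* x) :* ((c :* x) :* con 1ℚ) := (c :* c) :* (x :* x)) refl c (coordinate (members t) (toℕ k)))) ⟩
      sumℚ {d} (λ k → c ℚ.* c ℚ.* (coordinate (members t) (toℕ k) ℚ.* coordinate (members t) (toℕ k)))
        ≡⟨ *-distribˡ-sum (c ℚ.* c) (λ (k : Fin d) → coordinate (members t) (toℕ k) ℚ.* coordinate (members t) (toℕ k)) ⟨
      c ℚ.* c ℚ.* sumℚ {d} (λ k → coordinate (members t) (toℕ k) ℚ.* coordinate (members t) (toℕ k))
        ≡⟨ cong (c ℚ.* c ℚ.*_) (sumℚ-Δ d (λ k → coordinate (members t) k ℚ.* coordinate (members t) k)) ⟩
      c ℚ.* c ℚ.* Δ (λ k → coordinate (members t) k ℚ.* coordinate (members t) k) 0 d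
        ≡⟨ cong (λ m → c ℚ.* c ℚ.* Δ (λ k → coordinate (members t) k ℚ.* coordinate (members t) k) 0 m) (sym (Fin.toℕ-fromℕ d)) ⟩
      c ℚ.* c ℚ.* Δ (λ k → coordinate (members t) k ℚ.* coordinate (members t) k) 0 (toℕ (Fin.fromℕ d))
        ≡⟨ cong (c ℚ.* c ℚ.*_) (Δ-coordinate² t) ⟩
      c ℚ.* c ℚ.* normSq (difference {suc d} zero (Fin.fromℕ d)) ∎
      where
      open ≡-Reasoning
      c = seq areaUnit n

-- Affine functionals on the plane

affine : ℝ → ℝ → ℝ → Point 2 → ℝ
affine A B C P = A * P zero + B * P (suc zero) + C

module _ (A B C : ℝ) where

  seq-sum-affine : ∀ {m} (w : Vector ℝ m) (φ : Vector (Point 2) m) n →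
    seq (A * combination w φ zero + B * combination w φ (suc zero) + C * sum w) n ≡
    seq (sum (λ j → w j * affine A B C (φ j))) n
  seq-sum-affine {zero}  w φ n = solve 3 (λ a b c → a :* con 0ℚ :+ b :* con 0ℚ :+ c :* con 0ℚ := con 0ℚ) refl
    (seq A n) (seq B n) (seq C n)
  seq-sum-affine {suc m} w φ n = trans
    (solve 9 (λ a b c w x y X Y W →
       a :* (w :* x :+ X) :+ b :* (w :* y :+ Y) :+ c :* (w :+ W) :=
       w :* (a :* x :+ b :* y :+ c) :+ (a :* X :+ b :* Y :+ c :* W)) refl
      (seq A n) (seq B n) (seq C n) (seq (w zero) n) (seq (φ zero zero) n) (seq (φ zero (suc zero)) n)
      (seq (combination (w ∘ suc) (φ ∘ suc) zero) n) (seq (combination (w ∘ suc) (φ ∘ suc) (suc zero)) n)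
      (seq (sum (w ∘ suc)) n))
    (cong (seq (w zero) n ℚ.* seq (affine A B C (φ zero)) n ℚ.+_) (seq-sum-affine (w ∘ suc) (φ ∘ suc) n))

  affine-combination : ∀ {m} (w : Vector ℝ m) (φ : Vector (Point 2) m) x →
    sum w ≃ 1ℝ → x ≈ combination w φ → affine A B C x ≃ sum (λ j → w j * affine A B C (φ j))
  affine-combination w φ x Σw≃1 x≈ =
    ≃-trans {affine A B C x} {A * X + B * Y + C * sum w} {sum (λ j → w j * affine A B C (φ j))}
      (+-cong {A * x zero + B * x (suc zero)} {A * X + B * Y} {C} {C * sum w}
        (+-cong {A * x zero} {A * X} {B * x (suc zero)} {B * Y}
          (*-cong {A} {A} {x zero} {X} (≃-refl {A}) (x≈ zero))
          (*-cong {B} {B} {x (suc zero)} {Y} (≃-refl {B}) (x≈ (suc zero))))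
        (≃-trans {C} {C * 1ℝ} {C * sum w}
          (pointwise⇒≃ {C} {C * 1ℝ} λ n → sym (ℚ.*-identityʳ (seq C n)))
          (*-cong {C} {C} {1ℝ} {sum w} (≃-refl {C}) (≃-sym {sum w} {1ℝ} Σw≃1))))
      (pointwise⇒≃ {A * X + B * Y + C * sum w} {sum (λ j → w j * affine A B C (φ j))} (seq-sum-affine w φ))
    where
    X = combination w φ zero
    Y = combination w φ (suc zero)

  -- Replacing each weight by its absolute value makes every summand nonpositive term by term. The
  -- conclusion keeps this explicit representative because `squeeze-0` consumes it.
  affine-Conv≤0 : ∀ {I : Set} (φ : I → Point 2) x → Conv φ x → (∀ i n → seq (affine A B C (φ i)) n ℚ.≤ 0ℚ) →
    ∃[ y ] (∀ n → seq y n ℚ.≤ 0ℚ) × affine A B C x ≃ y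
  affine-Conv≤0 φ x (m , w , s , 0≤w , Σw≃1 , x≈) φ≤0 =
    y , y≤0 , ≃-trans {affine A B C x} {sum (λ j → w j * affine A B C (φ (s j)))} {y}
      (affine-combination w (φ ∘ s) x Σw≃1 x≈)
      (sum-cong {x = λ j → w j * affine A B C (φ (s j))} {y = λ j → ∣ w j ∣ * affine A B C (φ (s j))} λ j →
        *-cong {w j} {∣ w j ∣} {affine A B C (φ (s j))} {affine A B C (φ (s j))}
          (0≤x⇒x≃∣x∣ (w j) (0≤w j)) (≃-refl {affine A B C (φ (s j))}))
    where
    y = sum (λ j → ∣ w j ∣ * affine A B C (φ (s j)))
    sum≤0 : ∀ {k} (z : Vector ℝ k) n → (∀ j → seq (z j) n ℚ.≤ 0ℚ) → seq (sum z) n ℚ.≤ 0ℚ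
    sum≤0 {zero}  z n z≤0 = ℚ.≤-refl
    sum≤0 {suc k} z n z≤0 = ℚ.+-mono-≤ (z≤0 zero) (sum≤0 (z ∘ suc) n (z≤0 ∘ suc))
    y≤0 : ∀ n → seq y n ℚ.≤ 0ℚ
    y≤0 n = sum≤0 (λ j → ∣ w j ∣ * affine A B C (φ (s j))) n λ j →
      subst (ℚ.∣ seq (w j) n ∣ ℚ.* seq (affine A B C (φ (s j))) n ℚ.≤_) (ℚ.*-zeroʳ ℚ.∣ seq (w j) n ∣)
        (ℚ.*-monoˡ-≤-nonNeg ℚ.∣ seq (w j) n ∣ {{ℚ.nonNegative (ℚ.0≤∣p∣ (seq (w j) n))}} (φ≤0 (s j) n))

⅓ : ℚ
⅓ = ℤ.+ 1 ℚ./ 3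

-- On the curve d x and d x² are affine functions of the point (X , Y), hence
-- so is d (x - s)(x - t), which vanishes on the chord between s and t.
opaque
  chord-functional : ∀ p₀ p₁ p₂ q₀ q₁ q₂ s t x →
    let X = quadratic p₀ p₁ p₂ x; Y = quadratic q₀ q₁ q₂ x; d = p₁ ℚ.* q₂ ℚ.- p₂ ℚ.* q₁ in
    (ℚ.- q₁ ℚ.- (s ℚ.+ t) ℚ.* q₂) ℚ.* X ℚ.+ (p₁ ℚ.+ (s ℚ.+ t) ℚ.* p₂) ℚ.* Y ℚ.+
    (q₁ ℚ.* p₀ ℚ.- p₁ ℚ.* q₀ ℚ.+ (s ℚ.+ t) ℚ.* (q₂ ℚ.* p₀ ℚ.- p₂ ℚ.* q₀) ℚ.+ s ℚ.* t ℚ.* d) ≡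
    d ℚ.* ((x ℚ.- s) ℚ.* (x ℚ.- t))
  chord-functional = solve 9 (λ p₀ p₁ p₂ q₀ q₁ q₂ s t x →
    let X = quadraticₚ p₀ p₁ p₂ x; Y = quadraticₚ q₀ q₁ q₂ x; d = p₁ :* q₂ :- p₂ :* q₁ in
    (:- q₁ :- (s :+ t) :* q₂) :* X :+ (p₁ :+ (s :+ t) :* p₂) :* Y :+
    (q₁ :* p₀ :- p₁ :* q₀ :+ (s :+ t) :* (q₂ :* p₀ :- p₂ :* q₀) :+ s :* t :* d) :=
    d :* ((x :- s) :* (x :- t))) refl

-- Linear independence and the Wronskian

module _ (p q : Poly₂) (independent : LinearlyIndependent (p ∷ q ∷ 1ₚ ∷ []))
         (a b : ℝ) (b≄0 : ¬ (b ≃ 0ℝ)) where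

  private
    p₀ = p zero
    p₁ = p (suc zero)
    p₂ = p (suc (suc zero))
    q₀ = q zero
    q₁ = q (suc zero)
    q₂ = q (suc (suc zero))
    D = wronskian p q a b

  -- If `D` vanished, `p₂ q - q₂ p` would be constant, as its linear coefficient is `- D`;
  -- independence then gives `p₂ ≃ 0`. The same with `p₁ q - q₁ p` and its quadratic coefficient `D`
  -- gives `p₁ ≃ 0`. So `p` is constant, contradicting independence.
  wronskian≄0 : ¬ (D ≃ 0ℝ)
  wronskian≄0 D≃0 = 1≄0 (independent (1ℝ ∷ 0ℝ ∷ (- p₀) ∷ []) constant zero)
    where
    p₂≃0 : p₂ ≃ 0ℝ
    p₂≃0 = independent (c ∷ p₂ ∷ (q₂ * p₀ - p₂ * q₀) ∷ []) vanish (suc zero)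
      where
      c = - q₂
      vanish : combination (c ∷ p₂ ∷ (q₂ * p₀ - p₂ * q₀) ∷ []) (p ∷ q ∷ 1ₚ ∷ []) ≈ (λ _ → 0ℝ)
      vanish zero = pointwise⇒≃ {c * p₀ + (p₂ * q₀ + ((q₂ * p₀ - p₂ * q₀) * 1ℝ + 0ℝ))} {0ℝ} λ n →
        solve 4 (λ p₀ p₂ q₀ q₂ → :- q₂ :* p₀ :+ (p₂ :* q₀ :+ ((q₂ :* p₀ :- p₂ :* q₀) :* con 1ℚ :+ con 0ℚ)) := con 0ℚ)
          refl (seq p₀ n) (seq p₂ n) (seq q₀ n) (seq q₂ n)
      vanish (suc zero) = ≃-trans {combination (c ∷ p₂ ∷ (q₂ * p₀ - p₂ * q₀) ∷ []) (p ∷ q ∷ 1ₚ ∷ []) (suc zero)}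
        {D * fromℚ (ℚ.- 1ℚ)} {0ℝ}
        (pointwise⇒≃ {combination (c ∷ p₂ ∷ (q₂ * p₀ - p₂ * q₀) ∷ []) (p ∷ q ∷ 1ₚ ∷ []) (suc zero)}
          {D * fromℚ (ℚ.- 1ℚ)} λ n →
          solve 6 (λ p₀ p₁ p₂ q₀ q₁ q₂ → :- q₂ :* p₁ :+ (p₂ :* q₁ :+ ((q₂ :* p₀ :- p₂ :* q₀) :* con 0ℚ :+ con 0ℚ)) :=
            (p₁ :* q₂ :- p₂ :* q₁) :* con (ℚ.- 1ℚ))
          refl (seq p₀ n) (seq p₁ n) (seq p₂ n) (seq q₀ n) (seq q₁ n) (seq q₂ n))
        (≃-trans {D * fromℚ (ℚ.- 1ℚ)} {0ℝ * fromℚ (ℚ.- 1ℚ)} {0ℝ}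
          (*-cong {D} {0ℝ} {fromℚ (ℚ.- 1ℚ)} {fromℚ (ℚ.- 1ℚ)} D≃0 (≃-refl {fromℚ (ℚ.- 1ℚ)}))
          (pointwise⇒≃ {0ℝ * fromℚ (ℚ.- 1ℚ)} {0ℝ} λ _ → refl))
      vanish (suc (suc zero)) = pointwise⇒≃ {c * p₂ + (p₂ * q₂ + ((q₂ * p₀ - p₂ * q₀) * 0ℝ + 0ℝ))} {0ℝ} λ n →
        solve 4 (λ p₀ p₂ q₀ q₂ → :- q₂ :* p₂ :+ (p₂ :* q₂ :+ ((q₂ :* p₀ :- p₂ :* q₀) :* con 0ℚ :+ con 0ℚ)) := con 0ℚ)
          refl (seq p₀ n) (seq p₂ n) (seq q₀ n) (seq q₂ n)
    p₁≃0 : p₁ ≃ 0ℝ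
    p₁≃0 = independent (c ∷ p₁ ∷ (q₁ * p₀ - p₁ * q₀) ∷ []) vanish (suc zero)
      where
      c = - q₁
      vanish : combination (c ∷ p₁ ∷ (q₁ * p₀ - p₁ * q₀) ∷ []) (p ∷ q ∷ 1ₚ ∷ []) ≈ (λ _ → 0ℝ)
      vanish zero = pointwise⇒≃ {c * p₀ + (p₁ * q₀ + ((q₁ * p₀ - p₁ * q₀) * 1ℝ + 0ℝ))} {0ℝ} λ n →
        solve 4 (λ p₀ p₁ q₀ q₁ → :- q₁ :* p₀ :+ (p₁ :* q₀ :+ ((q₁ :* p₀ :- p₁ :* q₀) :* con 1ℚ :+ con 0ℚ)) := con 0ℚ)
          refl (seq p₀ n) (seq p₁ n) (seq q₀ n) (seq q₁ n)
      vanish (suc zero) = pointwise⇒≃ {c * p₁ + (p₁ * q₁ + ((q₁ * p₀ - p₁ * q₀) * 0ℝ + 0ℝ))} {0ℝ} λ n →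
        solve 4 (λ p₀ p₁ q₀ q₁ → :- q₁ :* p₁ :+ (p₁ :* q₁ :+ ((q₁ :* p₀ :- p₁ :* q₀) :* con 0ℚ :+ con 0ℚ)) := con 0ℚ)
          refl (seq p₀ n) (seq p₁ n) (seq q₀ n) (seq q₁ n)
      vanish (suc (suc zero)) = ≃-trans {combination (c ∷ p₁ ∷ (q₁ * p₀ - p₁ * q₀) ∷ []) (p ∷ q ∷ 1ₚ ∷ []) (suc (suc zero))}
        {D} {0ℝ}
        (pointwise⇒≃ {combination (c ∷ p₁ ∷ (q₁ * p₀ - p₁ * q₀) ∷ []) (p ∷ q ∷ 1ₚ ∷ []) (suc (suc zero))} {D} λ n →
          solve 6 (λ p₀ p₁ p₂ q₀ q₁ q₂ → :- q₁ :* p₂ :+ (p₁ :* q₂ :+ ((q₁ :* p₀ :- p₁ :* q₀) :* con 0ℚ :+ con 0ℚ)) :=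
            p₁ :* q₂ :- p₂ :* q₁)
          refl (seq p₀ n) (seq p₁ n) (seq p₂ n) (seq q₀ n) (seq q₁ n) (seq q₂ n))
        D≃0
    constant : combination (1ℝ ∷ 0ℝ ∷ (- p₀) ∷ []) (p ∷ q ∷ 1ₚ ∷ []) ≈ (λ _ → 0ℝ)
    constant zero = pointwise⇒≃ {1ℝ * p₀ + (0ℝ * q₀ + (- p₀ * 1ℝ + 0ℝ))} {0ℝ} λ n →
      solve 2 (λ p₀ q₀ → con 1ℚ :* p₀ :+ (con 0ℚ :* q₀ :+ (:- p₀ :* con 1ℚ :+ con 0ℚ)) := con 0ℚ) refl (seq p₀ n) (seq q₀ n)
    constant (suc zero) = ≃-trans {1ℝ * p₁ + (0ℝ * q₁ + (- p₀ * 0ℝ + 0ℝ))} {p₁} {0ℝ}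
      (pointwise⇒≃ {1ℝ * p₁ + (0ℝ * q₁ + (- p₀ * 0ℝ + 0ℝ))} {p₁} λ n →
        solve 3 (λ p₀ p₁ q₁ → con 1ℚ :* p₁ :+ (con 0ℚ :* q₁ :+ (:- p₀ :* con 0ℚ :+ con 0ℚ)) := p₁) refl
          (seq p₀ n) (seq p₁ n) (seq q₁ n)) p₁≃0
    constant (suc (suc zero)) = ≃-trans {1ℝ * p₂ + (0ℝ * q₂ + (- p₀ * 0ℝ + 0ℝ))} {p₂} {0ℝ}
      (pointwise⇒≃ {1ℝ * p₂ + (0ℝ * q₂ + (- p₀ * 0ℝ + 0ℝ))} {p₂} λ n →
        solve 3 (λ p₀ p₂ q₂ → con 1ℚ :* p₂ :+ (con 0ℚ :* q₂ :+ (:- p₀ :* con 0ℚ :+ con 0ℚ)) := p₂) refl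
          (seq p₀ n) (seq p₂ n) (seq q₂ n)) p₂≃0

  -- A square, so that its terms are nonnegative without knowing the sign of `D` or `b`.
  κ : ℝ
  κ = D * b * (D * b)

  κ≄0 : ¬ (κ ≃ 0ℝ)
  κ≄0 κ≃0 = Db≄0 (x*y≃0⇒x≃0 (D * b) (D * b) κ≃0 Db≄0)
    where
    Db≄0 : ¬ (D * b ≃ 0ℝ)
    Db≄0 Db≃0 = wronskian≄0 (x*y≃0⇒x≃0 D b Db≃0 b≄0)

-- Interleaving chords meet

vandermonde₃ₚ : ∀ {n} (x y z : +-*-Solver.Polynomial n) → +-*-Solver.Polynomial n
vandermonde₃ₚ x y z = (y :- x) :* (z :- x) :* (z :- y)

-- Expanding a 4 × 4 determinant of values of polynomials of degree at most 2
-- along its last column.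
module _ (x y z w : ℚ) where

  private
    α = vandermonde₃ y z w
    β = vandermonde₃ x z w
    γ = vandermonde₃ x y w
    δ = vandermonde₃ x y z

  dependency₀ : α ℚ.+ γ ≡ β ℚ.+ δ
  dependency₀ = solve 4 (λ x y z w → vandermonde₃ₚ y z w :+ vandermonde₃ₚ x y w :=
    vandermonde₃ₚ x z w :+ vandermonde₃ₚ x y z) refl x y z w

  dependency₁ : α ℚ.* x ℚ.+ γ ℚ.* z ≡ β ℚ.* y ℚ.+ δ ℚ.* w
  dependency₁ = solve 4 (λ x y z w → vandermonde₃ₚ y z w :* x :+ vandermonde₃ₚ x y w :* z :=
    vandermonde₃ₚ x z w :* y :+ vandermonde₃ₚ x y z :* w) refl x y z w

  dependency₂ : α ℚ.* (x ℚ.* x) ℚ.+ γ ℚ.* (z ℚ.* z) ≡ β ℚ.* (y ℚ.* y) ℚ.+ δ ℚ.* (w ℚ.* w)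
  dependency₂ = solve 4 (λ x y z w → vandermonde₃ₚ y z w :* (x :* x) :+ vandermonde₃ₚ x y w :* (z :* z) :=
    vandermonde₃ₚ x z w :* (y :* y) :+ vandermonde₃ₚ x y z :* (w :* w)) refl x y z w

  dependency : ∀ u r₀ r₁ r₂ a b → let P = λ t → quadratic r₀ r₁ r₂ (a ℚ.+ t ℚ.* b) in
    α ℚ.* u ℚ.* P x ℚ.+ (γ ℚ.* u ℚ.* P z ℚ.+ 0ℚ) ≡ β ℚ.* u ℚ.* P y ℚ.+ (δ ℚ.* u ℚ.* P w ℚ.+ 0ℚ)
  dependency u r₀ r₁ r₂ a b = begin
    α ℚ.* u ℚ.* P x ℚ.+ (γ ℚ.* u ℚ.* P z ℚ.+ 0ℚ)
      ≡⟨ collect α γ x z u r₀ r₁ r₂ a b ⟩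
    u ℚ.* (quadratic r₀ r₁ r₂ a ℚ.* (α ℚ.+ γ) ℚ.+ b ℚ.* (r₁ ℚ.+ r₂ ℚ.* (a ℚ.+ a)) ℚ.* (α ℚ.* x ℚ.+ γ ℚ.* z)
      ℚ.+ r₂ ℚ.* (b ℚ.* b) ℚ.* (α ℚ.* (x ℚ.* x) ℚ.+ γ ℚ.* (z ℚ.* z)))
      ≡⟨ cong (u ℚ.*_) (cong₂ ℚ._+_ (cong₂ ℚ._+_
           (cong (quadratic r₀ r₁ r₂ a ℚ.*_) dependency₀)
           (cong (b ℚ.* (r₁ ℚ.+ r₂ ℚ.* (a ℚ.+ a)) ℚ.*_) dependency₁))
           (cong (r₂ ℚ.* (b ℚ.* b) ℚ.*_) dependency₂)) ⟩
    u ℚ.* (quadratic r₀ r₁ r₂ a ℚ.* (β ℚ.+ δ) ℚ.+ b ℚ.* (r₁ ℚ.+ r₂ ℚ.* (a ℚ.+ a)) ℚ.* (β ℚ.* y ℚ.+ δ ℚ.* w)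
      ℚ.+ r₂ ℚ.* (b ℚ.* b) ℚ.* (β ℚ.* (y ℚ.* y) ℚ.+ δ ℚ.* (w ℚ.* w)))
      ≡⟨ collect β δ y w u r₀ r₁ r₂ a b ⟨
    β ℚ.* u ℚ.* P y ℚ.+ (δ ℚ.* u ℚ.* P w ℚ.+ 0ℚ) ∎
    where
    open ≡-Reasoning
    P : ℚ → ℚ
    P t = quadratic r₀ r₁ r₂ (a ℚ.+ t ℚ.* b)
    collect : ∀ α γ x z u r₀ r₁ r₂ a b →
      α ℚ.* u ℚ.* quadratic r₀ r₁ r₂ (a ℚ.+ x ℚ.* b) ℚ.+ (γ ℚ.* u ℚ.* quadratic r₀ r₁ r₂ (a ℚ.+ z ℚ.* b) ℚ.+ 0ℚ) ≡
      u ℚ.* (quadratic r₀ r₁ r₂ a ℚ.* (α ℚ.+ γ) ℚ.+ b ℚ.* (r₁ ℚ.+ r₂ ℚ.* (a ℚ.+ a)) ℚ.* (α ℚ.* x ℚ.+ γ ℚ.* z)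
      ℚ.+ r₂ ℚ.* (b ℚ.* b) ℚ.* (α ℚ.* (x ℚ.* x) ℚ.+ γ ℚ.* (z ℚ.* z)))
    collect = solve 10 (λ α γ x z u r₀ r₁ r₂ a b →
      α :* u :* quadraticₚ r₀ r₁ r₂ (a :+ x :* b) :+ (γ :* u :* quadraticₚ r₀ r₁ r₂ (a :+ z :* b) :+ con 0ℚ) :=
      u :* (quadraticₚ r₀ r₁ r₂ a :* (α :+ γ) :+ b :* (r₁ :+ r₂ :* (a :+ a)) :* (α :* x :+ γ :* z)
        :+ r₂ :* (b :* b) :* (α :* (x :* x) :+ γ :* (z :* z)))) refl

module _ (p q : Poly₂) (a b : ℝ) {N : ℕ} where

  private
    v : Vector (Point 2) N
    v = equallySpaced p q a b

  -- For `i < k < j < l` all four Vandermonde coefficients are positive, and the dependency puts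
  -- `i`, `j` on one side and `k`, `l` on the other. Dividing by `α + γ`, which equals `β + δ`,
  -- writes one point as a convex combination on both chords.
  crossing-meets : ∀ {i j k l} → Crossing (i , j) (k , l) →
    ∃[ x ] RelInt (segment v (i , j)) x × RelInt (segment v (k , l)) x
  crossing-meets {i} {j} {k} {l} (i<k , k<j , j<l) = meet (divide (α ℚ.+ γ) 1ℚ (ℚ.+-mono-< 0<α 0<γ) (ℚ.positive⁻¹ 1ℚ))
    where
    α = vandermonde₃ ⟦ toℕ k ⟧ ⟦ toℕ j ⟧ ⟦ toℕ l ⟧
    β = vandermonde₃ ⟦ toℕ i ⟧ ⟦ toℕ j ⟧ ⟦ toℕ l ⟧
    γ = vandermonde₃ ⟦ toℕ i ⟧ ⟦ toℕ k ⟧ ⟦ toℕ l ⟧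
    δ = vandermonde₃ ⟦ toℕ i ⟧ ⟦ toℕ k ⟧ ⟦ toℕ j ⟧
    0<α = 0<vandermonde₃ (⟦⟧-mono-< k<j) (⟦⟧-mono-< j<l)
    0<β = 0<vandermonde₃ (⟦⟧-mono-< (ℕ.<-trans i<k k<j)) (⟦⟧-mono-< j<l)
    0<γ = 0<vandermonde₃ (⟦⟧-mono-< i<k) (⟦⟧-mono-< (ℕ.<-trans k<j j<l))
    0<δ = 0<vandermonde₃ (⟦⟧-mono-< i<k) (⟦⟧-mono-< k<j)
    meet : (∃[ u ] 0ℚ ℚ.< u × (α ℚ.+ γ) ℚ.* u ≡ 1ℚ) →
      ∃[ x ] RelInt (segment v (i , j)) x × RelInt (segment v (k , l)) x
    meet (u , 0<u , total) = x ,
      (wᵢⱼ , 0<wᵢⱼ , pointwise⇒≃ {sum wᵢⱼ} {1ℝ} (λ _ → trans (weights α γ u) total) , λ c → ≃-refl {x c}) ,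
      (wₖₗ , 0<wₖₗ , pointwise⇒≃ {sum wₖₗ} {1ℝ} (λ _ → trans (weights β δ u)
         (trans (cong (ℚ._* u) (sym (dependency₀ ⟦ toℕ i ⟧ ⟦ toℕ k ⟧ ⟦ toℕ j ⟧ ⟦ toℕ l ⟧))) total)) , agree)
      where
      wᵢⱼ wₖₗ : Vector ℝ 2
      wᵢⱼ = fromℚ (α ℚ.* u) ∷ fromℚ (γ ℚ.* u) ∷ []
      wₖₗ = fromℚ (β ℚ.* u) ∷ fromℚ (δ ℚ.* u) ∷ []
      x : Point 2
      x = combination wᵢⱼ (segment v (i , j))
      0<wᵢⱼ : ∀ c → 0ℝ < wᵢⱼ c
      0<wᵢⱼ zero       = 0<fromℚ (0<p*q 0<α 0<u)
      0<wᵢⱼ (suc zero) = 0<fromℚ (0<p*q 0<γ 0<u)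
      0<wₖₗ : ∀ c → 0ℝ < wₖₗ c
      0<wₖₗ zero       = 0<fromℚ (0<p*q 0<β 0<u)
      0<wₖₗ (suc zero) = 0<fromℚ (0<p*q 0<δ 0<u)
      weights : ∀ α γ u → α ℚ.* u ℚ.+ (γ ℚ.* u ℚ.+ 0ℚ) ≡ (α ℚ.+ γ) ℚ.* u
      weights = solve 3 (λ α γ u → α :* u :+ (γ :* u :+ con 0ℚ) := (α :+ γ) :* u) refl
      coordinates-agree : ∀ (r : Poly₂) n → let P = λ (m : Fin N) → seq (eval r (a + toℕ m · b)) n in
        α ℚ.* u ℚ.* P i ℚ.+ (γ ℚ.* u ℚ.* P j ℚ.+ 0ℚ) ≡ β ℚ.* u ℚ.* P k ℚ.+ (δ ℚ.* u ℚ.* P l ℚ.+ 0ℚ)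
      coordinates-agree r n = trans
        (cong₂ (λ y z → α ℚ.* u ℚ.* y ℚ.+ (γ ℚ.* u ℚ.* z ℚ.+ 0ℚ))
          (seq-eval p q a b r (toℕ i) n) (seq-eval p q a b r (toℕ j) n))
        (trans (dependency ⟦ toℕ i ⟧ ⟦ toℕ k ⟧ ⟦ toℕ j ⟧ ⟦ toℕ l ⟧ u
                 (seq (r zero) n) (seq (r (suc zero)) n) (seq (r (suc (suc zero))) n) (seq a n) (seq b n))
          (sym (cong₂ (λ y z → β ℚ.* u ℚ.* y ℚ.+ (δ ℚ.* u ℚ.* z ℚ.+ 0ℚ))
            (seq-eval p q a b r (toℕ k) n) (seq-eval p q a b r (toℕ l) n))))
      agree : x ≈ combination wₖₗ (segment v (k , l))
      agree zero       = pointwise⇒≃ {x zero} {combination wₖₗ (segment v (k , l)) zero} (coordinates-agree p)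
      agree (suc zero) = pointwise⇒≃ {x (suc zero)} {combination wₖₗ (segment v (k , l)) (suc zero)} (coordinates-agree q)

  triangulation-sidesUncrossed : ∀ {T} → IsTriangulation v T →
    ∀ {σ} → σ ∈ T → ∀ {d} → IsSide d σ → Uncrossed T d
  triangulation-sidesUncrossed isT {σ} σ∈T {d} dσ {τ} τ∈T {s} sτ =
    (λ crossing → let x , xd , xs = crossing-meets crossing in
      IsTriangulation.nonCrossing isT σ∈T τ∈T dσ sτ (crossing⇒≢ crossing) x (xd , xs)) ,
    (λ crossing → let x , xs , xd = crossing-meets crossing in
      IsTriangulation.nonCrossing isT σ∈T τ∈T dσ sτ (crossing⇒≢ crossing ∘ sym) x (xd , xs))
    where
    crossing⇒≢ : ∀ {d s : Fin N × Fin N} → Crossing d s → ¬ (d ≡ s)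
    crossing⇒≢ (i<i , _) refl = ℕ.<-irrefl refl i<i

-- Separating centroids from triangles by chords

module _ (p q : Poly₂) (independent : LinearlyIndependent (p ∷ q ∷ 1ₚ ∷ []))
         (a b : ℝ) (b≄0 : ¬ (b ≃ 0ℝ)) {N : ℕ} where

  private
    v : Vector (Point 2) N
    v = equallySpaced p q a b

    K : ℝ
    K = κ p q independent a b b≄0

  centroid : Triangle N → Point 2
  centroid σ = combination (λ _ → fromℚ ⅓) (corners v σ)

  centroid∈Conv : ∀ σ → Conv v (centroid σ)
  centroid∈Conv σ = 3 , (λ _ → fromℚ ⅓) , corner σ , (λ _ → 0≤fromℚ (ℚ.<⇒≤ (ℚ.positive⁻¹ ⅓))) ,
    pointwise⇒≃ {sum {3} (λ _ → fromℚ ⅓)} {1ℝ} (λ _ → refl) , λ k → ≃-refl {centroid σ k}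

  -- An affine functional with values K · g at the vertices, for rational g, is
  -- a certificate that the centroid of τ lies outside σ.
  centroid∉ : ∀ A B C (g : Fin N → ℚ) → (∀ m n → seq (affine A B C (v m)) n ≡ seq K n ℚ.* g m) →
    ∀ σ τ → (∀ c → g (corner σ c) ℚ.≤ 0ℚ) →
    0ℚ ℚ.< g (Triangle.i τ) ℚ.+ g (Triangle.j τ) ℚ.+ g (Triangle.k τ) → ¬ Conv (corners v σ) (centroid τ)
  centroid∉ A B C g values σ τ@(triangle i j k _ _) σ≤0 0<τ x∈σ =
    κ≄0 p q independent a b b≄0 (x*y≃0⇒x≃0 K (fromℚ ρ) Kρ≃0 ρ≄0)
    where
    x = centroid τ
    s = g i ℚ.+ g j ℚ.+ g k
    ρ = ⅓ ℚ.* s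
    0<ρ : 0ℚ ℚ.< ρ
    0<ρ = 0<p*q (ℚ.positive⁻¹ ⅓) 0<τ
    0≤K : ∀ n → 0ℚ ℚ.≤ seq K n
    0≤K n = 0≤p² (seq (wronskian p q a b * b) n)
    ρ≄0 : ¬ (fromℚ ρ ≃ 0ℝ)
    ρ≄0 ρ≃0 with M , h ← ρ≃0 ρ 0<ρ =
      ℚ.<-irrefl refl (subst (ℚ._< ρ) (trans (cong ℚ.∣_∣ (p-0≡p ρ)) (ℚ.0≤p⇒∣p∣≡p (ℚ.<⇒≤ 0<ρ))) (h M ℕ.≤-refl))
    σ-values≤0 : ∀ c n → seq (affine A B C (corners v σ c)) n ℚ.≤ 0ℚ
    σ-values≤0 c n = subst₂ ℚ._≤_ (sym (values (corner σ c) n)) (ℚ.*-zeroʳ (seq K n))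
      (ℚ.*-monoˡ-≤-nonNeg (seq K n) {{ℚ.nonNegative (0≤K n)}} (σ≤0 c))
    at-centroid : ∀ n → seq (affine A B C x) n ≡ seq K n ℚ.* ρ
    at-centroid n = begin
      seq (affine A B C x) n
        ≡⟨ average (seq A n) (seq B n) (seq C n) (X i) (X j) (X k) (Y i) (Y j) (Y k) ⟩
      ⅓ ℚ.* (seq (affine A B C (v i)) n ℚ.+ seq (affine A B C (v j)) n ℚ.+ seq (affine A B C (v k)) n)
        ≡⟨ cong (⅓ ℚ.*_) (cong₂ ℚ._+_ (cong₂ ℚ._+_ (values i n) (values j n)) (values k n)) ⟩
      ⅓ ℚ.* (seq K n ℚ.* g i ℚ.+ seq K n ℚ.* g j ℚ.+ seq K n ℚ.* g k)
        ≡⟨ solve 4 (λ c x y z → con ⅓ :* (c :* x :+ c :* y :+ c :* z) := c :* (con ⅓ :* (x :+ y :+ z))) refl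
             (seq K n) (g i) (g j) (g k) ⟩
      seq K n ℚ.* ρ ∎
      where
      open ≡-Reasoning
      X Y : Fin N → ℚ
      X m = seq (v m zero) n
      Y m = seq (v m (suc zero)) n
      average : ∀ A B C x y z x′ y′ z′ →
        A ℚ.* (⅓ ℚ.* x ℚ.+ (⅓ ℚ.* y ℚ.+ (⅓ ℚ.* z ℚ.+ 0ℚ))) ℚ.+ B ℚ.* (⅓ ℚ.* x′ ℚ.+ (⅓ ℚ.* y′ ℚ.+ (⅓ ℚ.* z′ ℚ.+ 0ℚ))) ℚ.+ C ≡
        ⅓ ℚ.* ((A ℚ.* x ℚ.+ B ℚ.* x′ ℚ.+ C) ℚ.+ (A ℚ.* y ℚ.+ B ℚ.* y′ ℚ.+ C) ℚ.+ (A ℚ.* z ℚ.+ B ℚ.* z′ ℚ.+ C))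
      average = solve 9 (λ A B C x y z x′ y′ z′ →
        A :* (con ⅓ :* x :+ (con ⅓ :* y :+ (con ⅓ :* z :+ con 0ℚ))) :+ B :* (con ⅓ :* x′ :+ (con ⅓ :* y′ :+ (con ⅓ :* z′ :+ con 0ℚ))) :+ C :=
        con ⅓ :* ((A :* x :+ B :* x′ :+ C) :+ (A :* y :+ B :* y′ :+ C) :+ (A :* z :+ B :* z′ :+ C))) refl
    Kρ≃0 : K * fromℚ ρ ≃ 0ℝ
    Kρ≃0 = let y , y≤0 , x≃y = affine-Conv≤0 A B C (corners v σ) x x∈σ σ-values≤0 in
      squeeze-0 (K * fromℚ ρ) y (λ n → 0≤p*q (0≤K n) (ℚ.<⇒≤ 0<ρ)) y≤0
        (≃-trans {K * fromℚ ρ} {affine A B C x} {y}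
          (pointwise⇒≃ {K * fromℚ ρ} {affine A B C x} λ n → sym (at-centroid n)) x≃y)

  -- Negative strictly between the indices `l` and `m`, zero at them and positive outside: the side
  -- of the chord on which vertex `c` lies, up to the factor `κ`.
  chord : ℕ → ℕ → Fin N → ℚ
  chord l m c = (⟦ toℕ c ⟧ ℚ.- ⟦ l ⟧) ℚ.* (⟦ toℕ c ⟧ ℚ.- ⟦ m ⟧)

  module _ (l m : ℕ) where

    private
      D tˡ tᵐ A B C : ℝ
      D = wronskian p q a b
      tˡ = a + l · b
      tᵐ = a + m · b
      -- `chord-functional` leaves one factor `D` of unknown sign; the extra `D` here completes it
      -- to a square.
      A = D * (- q (suc zero) - (tˡ + tᵐ) * q (suc (suc zero)))
      B = D * (p (suc zero) + (tˡ + tᵐ) * p (suc (suc zero)))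
      C = D * (q (suc zero) * p zero - p (suc zero) * q zero +
        (tˡ + tᵐ) * (q (suc (suc zero)) * p zero - p (suc (suc zero)) * q zero) + tˡ * tᵐ * D)

      values : ∀ c n → seq (affine A B C (v c)) n ≡ seq K n ℚ.* chord l m c
      values c n = begin
        d ℚ.* A′ ℚ.* X ℚ.+ d ℚ.* B′ ℚ.* Y ℚ.+ d ℚ.* C′
          ≡⟨ solve 6 (λ d a x b y c → d :* a :* x :+ d :* b :* y :+ d :* c := d :* (a :* x :+ b :* y :+ c)) refl d A′ X B′ Y C′ ⟩
        d ℚ.* (A′ ℚ.* X ℚ.+ B′ ℚ.* Y ℚ.+ C′)
          ≡⟨ cong (d ℚ.*_) (chord-functional p₀ p₁ p₂ q₀ q₁ q₂ (seq tˡ n) (seq tᵐ n) t) ⟩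
        d ℚ.* (d ℚ.* ((t ℚ.- seq tˡ n) ℚ.* (t ℚ.- seq tᵐ n)))
          ≡⟨ cong₂ (λ x y → d ℚ.* (d ℚ.* (x ℚ.* y))) (gap l) (gap m) ⟩
        d ℚ.* (d ℚ.* ((⟦ toℕ c ⟧ ℚ.- ⟦ l ⟧) ℚ.* seq b n ℚ.* ((⟦ toℕ c ⟧ ℚ.- ⟦ m ⟧) ℚ.* seq b n)))
          ≡⟨ solve 4 (λ d b x y → d :* (d :* (x :* b :* (y :* b))) := d :* b :* (d :* b) :* (x :* y)) refl
               d (seq b n) (⟦ toℕ c ⟧ ℚ.- ⟦ l ⟧) (⟦ toℕ c ⟧ ℚ.- ⟦ m ⟧) ⟩
        seq K n ℚ.* chord l m c ∎
        where
        open ≡-Reasoning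
        p₀ = seq (p zero) n
        p₁ = seq (p (suc zero)) n
        p₂ = seq (p (suc (suc zero))) n
        q₀ = seq (q zero) n
        q₁ = seq (q (suc zero)) n
        q₂ = seq (q (suc (suc zero))) n
        d = p₁ ℚ.* q₂ ℚ.- p₂ ℚ.* q₁
        t = seq (a + toℕ c · b) n
        X = seq (v c zero) n
        Y = seq (v c (suc zero)) n
        A′ = ℚ.- q₁ ℚ.- (seq tˡ n ℚ.+ seq tᵐ n) ℚ.* q₂
        B′ = p₁ ℚ.+ (seq tˡ n ℚ.+ seq tᵐ n) ℚ.* p₂
        C′ = q₁ ℚ.* p₀ ℚ.- p₁ ℚ.* q₀ ℚ.+ (seq tˡ n ℚ.+ seq tᵐ n) ℚ.* (q₂ ℚ.* p₀ ℚ.- p₂ ℚ.* q₀) ℚ.+ seq tˡ n ℚ.* seq tᵐ n ℚ.* d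
        gap : ∀ k → t ℚ.- seq (a + k · b) n ≡ (⟦ toℕ c ⟧ ℚ.- ⟦ k ⟧) ℚ.* seq b n
        gap k = trans (cong₂ (λ x y → (seq a n ℚ.+ x) ℚ.- (seq a n ℚ.+ y)) (seq-· (toℕ c) b n) (seq-· k b n))
          (solve 4 (λ a b x y → (a :+ x :* b) :- (a :+ y :* b) := (x :- y) :* b) refl (seq a n) (seq b n) ⟦ toℕ c ⟧ ⟦ k ⟧)

      values⁻ : ∀ c n → seq (affine (- A) (- B) (- C) (v c)) n ≡ seq K n ℚ.* (ℚ.- chord l m c)
      values⁻ c n = trans
        (solve 5 (λ A B C x y → :- A :* x :+ :- B :* y :+ :- C := :- (A :* x :+ B :* y :+ C)) refl
          (seq A n) (seq B n) (seq C n) (seq (v c zero) n) (seq (v c (suc zero)) n))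
        (trans (cong ℚ.-_ (values c n)) (ℚ.neg-distribʳ-* (seq K n) (chord l m c)))

    beyond : ∀ σ τ → (∀ c → chord l m (corner σ c) ℚ.≤ 0ℚ) →
      0ℚ ℚ.< chord l m (Triangle.i τ) ℚ.+ chord l m (Triangle.j τ) ℚ.+ chord l m (Triangle.k τ) →
      ¬ Conv (corners v σ) (centroid τ)
    beyond = centroid∉ A B C (chord l m) values

    within : ∀ σ τ → (∀ c → ℚ.- chord l m (corner σ c) ℚ.≤ 0ℚ) →
      0ℚ ℚ.< (ℚ.- chord l m (Triangle.i τ)) ℚ.+ (ℚ.- chord l m (Triangle.j τ)) ℚ.+ (ℚ.- chord l m (Triangle.k τ)) →
      ¬ Conv (corners v σ) (centroid τ)
    within = centroid∉ (- A) (- B) (- C) (λ c → ℚ.- chord l m c) values⁻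

module _ (p q : Poly₂) (independent : LinearlyIndependent (p ∷ q ∷ 1ₚ ∷ []))
         (a b : ℝ) (b≄0 : ¬ (b ≃ 0ℝ)) {N : ℕ} where

  private
    v : Vector (Point 2) N
    v = equallySpaced p q a b

    g : ℕ → ℕ → Fin N → ℚ
    g = chord p q independent a b b≄0

  chord-inside : ∀ {l m c} → l ℕ.≤ toℕ c → toℕ c ℕ.≤ m → g l m c ℚ.≤ 0ℚ
  chord-inside {l} {m} {c} l≤c c≤m = subst (ℚ._≤ 0ℚ)
    (solve 3 (λ l m c → :- ((c :- l) :* (m :- c)) := (c :- l) :* (c :- m)) refl ⟦ l ⟧ ⟦ m ⟧ ⟦ toℕ c ⟧)
    (ℚ.neg-antimono-≤ (0≤p*q (p≤q⇒0≤q-p (⟦⟧-mono-≤ l≤c)) (p≤q⇒0≤q-p (⟦⟧-mono-≤ c≤m))))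

  chord-outside : ∀ {l m c} → l ℕ.≤ m → toℕ c ℕ.≤ l ⊎ m ℕ.≤ toℕ c → ℚ.- g l m c ℚ.≤ 0ℚ
  chord-outside {l} {m} {c} l≤m (inj₁ c≤l) = subst (λ z → ℚ.- z ℚ.≤ 0ℚ)
    (solve 3 (λ l m c → (l :- c) :* (m :- c) := (c :- l) :* (c :- m)) refl ⟦ l ⟧ ⟦ m ⟧ ⟦ toℕ c ⟧)
    (ℚ.neg-antimono-≤ (0≤p*q (p≤q⇒0≤q-p (⟦⟧-mono-≤ c≤l)) (p≤q⇒0≤q-p (⟦⟧-mono-≤ (ℕ.≤-trans c≤l l≤m)))))
  chord-outside {l} {m} {c} l≤m (inj₂ m≤c) =
    ℚ.neg-antimono-≤ (0≤p*q (p≤q⇒0≤q-p (⟦⟧-mono-≤ (ℕ.≤-trans l≤m m≤c))) (p≤q⇒0≤q-p (⟦⟧-mono-≤ m≤c)))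

  -- The centroid of v i, v (i + 1), v j lies on the inner side of the chord
  -- i j and beyond the chords (i + 1) j and i (j - 1), so a triangle covering
  -- it that does not cross i j has both i and j as corners.
  module _ {T : List (Triangle N)} (isT : IsTriangulation v T)
           {i j : Fin N} (1+i<j : suc (toℕ i) ℕ.< toℕ j) (uncrossed : Uncrossed T (i , j)) where

    private
      i⁺<N : suc (toℕ i) ℕ.< N
      i⁺<N = ℕ.<-trans 1+i<j (Fin.toℕ<n j)

      i⁺ : Fin N
      i⁺ = fromℕ< i⁺<N

      toℕ-i⁺ : toℕ i⁺ ≡ suc (toℕ i)
      toℕ-i⁺ = Fin.toℕ-fromℕ< i⁺<N

      τ : Triangle N
      τ = triangle i i⁺ j (ℕ.≤-reflexive (sym toℕ-i⁺)) (subst (ℕ._< toℕ j) (sym toℕ-i⁺) 1+i<j)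

      x y : ℚ
      x = ⟦ toℕ i ⟧
      y = ⟦ toℕ j ⟧

      i⁺-cast : ⟦ toℕ i⁺ ⟧ ≡ 1ℚ ℚ.+ x
      i⁺-cast = cong ⟦_⟧ toℕ-i⁺

      at-i⁺ : (h : ℚ → ℚ) → h ⟦ toℕ i⁺ ⟧ ≡ h (1ℚ ℚ.+ x)
      at-i⁺ h = cong h i⁺-cast

      -- With the chord from `i + 1` to `j`, the corners `i + 1` and `j` of `τ` have value zero and
      -- `i` has value `j - i`.
      avoids-i : ∀ σ → suc (toℕ i) ℕ.≤ toℕ (Triangle.i σ) → toℕ (Triangle.k σ) ℕ.≤ toℕ j →
        ¬ Conv (corners v σ) (centroid p q independent a b b≄0 τ)
      avoids-i σ@(triangle α β γ α<β β<γ) i<α γ≤j =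
        beyond p q independent a b b≄0 (suc (toℕ i)) (toℕ j) σ τ (λ where
          zero             → chord-inside {c = α} i<α (ℕ.≤-trans (ℕ.<⇒≤ (ℕ.<-trans α<β β<γ)) γ≤j)
          (suc zero)       → chord-inside {c = β} (ℕ.≤-trans i<α (ℕ.<⇒≤ α<β)) (ℕ.≤-trans (ℕ.<⇒≤ β<γ) γ≤j)
          (suc (suc zero)) → chord-inside {c = γ} (ℕ.≤-trans i<α (ℕ.<⇒≤ (ℕ.<-trans α<β β<γ))) γ≤j)
          (subst (0ℚ ℚ.<_) (sym (trans
            (at-i⁺ (λ z → (x ℚ.- (1ℚ ℚ.+ x)) ℚ.* (x ℚ.- y) ℚ.+ (z ℚ.- (1ℚ ℚ.+ x)) ℚ.* (z ℚ.- y) ℚ.+ (y ℚ.- (1ℚ ℚ.+ x)) ℚ.* (y ℚ.- y)))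
            (solve 2 (λ x y → (x :- (con 1ℚ :+ x)) :* (x :- y) :+ ((con 1ℚ :+ x) :- (con 1ℚ :+ x)) :* ((con 1ℚ :+ x) :- y)
                :+ (y :- (con 1ℚ :+ x)) :* (y :- y) := y :- x) refl x y)))
            (p<q⇒0<q-p (⟦⟧-mono-< (ℕ.<-trans (ℕ.n<1+n (toℕ i)) 1+i<j))))

      -- With the chord from `i` to `m = j - 1`, the corner `i` of `τ` has value zero, `i + 1` has
      -- `i + 1 - m` and `j` has `m + 1 - i`, which add up to two.
      avoids-j : ∀ σ {m} → toℕ j ≡ suc m → toℕ i ℕ.≤ toℕ (Triangle.i σ) → toℕ (Triangle.k σ) ℕ.≤ m →
        ¬ Conv (corners v σ) (centroid p q independent a b b≄0 τ)
      avoids-j σ@(triangle α β γ α<β β<γ) {m} j≡1+m i≤α γ≤m =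
        beyond p q independent a b b≄0 (toℕ i) m σ τ (λ where
          zero             → chord-inside {c = α} i≤α (ℕ.≤-trans (ℕ.<⇒≤ (ℕ.<-trans α<β β<γ)) γ≤m)
          (suc zero)       → chord-inside {c = β} (ℕ.≤-trans i≤α (ℕ.<⇒≤ α<β)) (ℕ.≤-trans (ℕ.<⇒≤ β<γ) γ≤m)
          (suc (suc zero)) → chord-inside {c = γ} (ℕ.≤-trans i≤α (ℕ.<⇒≤ (ℕ.<-trans α<β β<γ))) γ≤m)
          (subst (0ℚ ℚ.<_) (sym (trans
            (cong₂ (λ z w → (x ℚ.- x) ℚ.* (x ℚ.- ⟦ m ⟧) ℚ.+ (z ℚ.- x) ℚ.* (z ℚ.- ⟦ m ⟧) ℚ.+ (w ℚ.- x) ℚ.* (w ℚ.- ⟦ m ⟧))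
              i⁺-cast (cong ⟦_⟧ j≡1+m))
            (solve 2 (λ x m → (x :- x) :* (x :- m) :+ ((con 1ℚ :+ x) :- x) :* ((con 1ℚ :+ x) :- m)
                :+ ((con 1ℚ :+ m) :- x) :* ((con 1ℚ :+ m) :- m) := con 1ℚ :+ con 1ℚ) refl x ⟦ m ⟧)))
            (ℚ.positive⁻¹ (1ℚ ℚ.+ 1ℚ)))

      -- With the chord from `i` to `j` and reversed sign, only the corner `i + 1` of `τ` counts,
      -- with value `j - (i + 1)`.
      avoids-interior : ∀ σ → (∀ c → toℕ (corner σ c) ℕ.≤ toℕ i ⊎ toℕ j ℕ.≤ toℕ (corner σ c)) →
        ¬ Conv (corners v σ) (centroid p q independent a b b≄0 τ)
      avoids-interior σ outside =
        within p q independent a b b≄0 (toℕ i) (toℕ j) σ τ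
          (λ c → chord-outside {c = corner σ c} (ℕ.<⇒≤ (ℕ.<-trans (ℕ.n<1+n (toℕ i)) 1+i<j)) (outside c))
          (subst (0ℚ ℚ.<_) (sym (trans
            (at-i⁺ (λ z → ℚ.- ((x ℚ.- x) ℚ.* (x ℚ.- y)) ℚ.+ ℚ.- ((z ℚ.- x) ℚ.* (z ℚ.- y)) ℚ.+ ℚ.- ((y ℚ.- x) ℚ.* (y ℚ.- y))))
            (solve 2 (λ x y → :- ((x :- x) :* (x :- y)) :+ :- (((con 1ℚ :+ x) :- x) :* ((con 1ℚ :+ x) :- y))
                :+ :- ((y :- x) :* (y :- y)) := y :- (con 1ℚ :+ x)) refl x y)))
            (p<q⇒0<q-p (⟦⟧-mono-< 1+i<j)))

      -- A corner strictly between i and j would be joined across i j.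
      outside-left : ∀ {σ} → σ ∈ T → Triangle.i σ Fin.< i →
        ∀ c → toℕ (corner σ c) ℕ.≤ toℕ i ⊎ toℕ j ℕ.≤ toℕ (corner σ c)
      outside-left {σ} σ∈T α<i = λ where
          zero             → inj₁ (ℕ.<⇒≤ α<i)
          (suc zero)       → away (side-ij σ)
          (suc (suc zero)) → away (side-ik σ)
        where
        away : ∀ {c} → IsSide (Triangle.i σ , c) σ → toℕ c ℕ.≤ toℕ i ⊎ toℕ j ℕ.≤ toℕ c
        away {c} side with toℕ c ℕ.≤? toℕ i | toℕ j ℕ.≤? toℕ c
        ... | yes c≤i | _       = inj₁ c≤i
        ... | no _    | yes j≤c = inj₂ j≤c
        ... | no c≰i  | no j≰c  = ⊥-elim (proj₂ (uncrossed σ∈T side) (α<i , ℕ.≰⇒> c≰i , ℕ.≰⇒> j≰c))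

      outside-right : ∀ {σ} → σ ∈ T → j Fin.< Triangle.k σ →
        ∀ c → toℕ (corner σ c) ℕ.≤ toℕ i ⊎ toℕ j ℕ.≤ toℕ (corner σ c)
      outside-right {σ} σ∈T j<γ = λ where
          zero             → away (side-ik σ)
          (suc zero)       → away (side-jk σ)
          (suc (suc zero)) → inj₂ (ℕ.<⇒≤ j<γ)
        where
        away : ∀ {c} → IsSide (c , Triangle.k σ) σ → toℕ c ℕ.≤ toℕ i ⊎ toℕ j ℕ.≤ toℕ c
        away {c} side with toℕ c ℕ.≤? toℕ i | toℕ j ℕ.≤? toℕ c
        ... | yes c≤i | _       = inj₁ c≤i
        ... | no _    | yes j≤c = inj₂ j≤c
        ... | no c≰i  | no j≰c  = ⊥-elim (proj₁ (uncrossed σ∈T side) (ℕ.≰⇒> c≰i , ℕ.≰⇒> j≰c , j<γ))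

      -- A triangle reaching left of `i` or right of `j` has no corner strictly between them, so it
      -- lies outside the chord `i j`. Any other has its corners between `i` and `j`, and missing
      -- one of the two would confine it behind a shorter chord.
      covering-bounds : ∀ {σ} → σ ∈ T → Conv (corners v σ) (centroid p q independent a b b≄0 τ) →
        Triangle.i σ ≡ i × Triangle.k σ ≡ j
      covering-bounds {σ} σ∈T x∈σ with ℕ.<-cmp (toℕ (Triangle.i σ)) (toℕ i) | ℕ.<-cmp (toℕ (Triangle.k σ)) (toℕ j)
      ... | tri< α<i _ _ | _            = ⊥-elim (avoids-interior σ (outside-left σ∈T α<i) x∈σ)
      ... | _            | tri> _ _ j<γ = ⊥-elim (avoids-interior σ (outside-right σ∈T j<γ) x∈σ)
      ... | tri> _ _ i<α | tri< γ<j _ _ = ⊥-elim (avoids-i σ i<α (ℕ.<⇒≤ γ<j) x∈σ)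
      ... | tri> _ _ i<α | tri≈ _ γ≡j _ = ⊥-elim (avoids-i σ i<α (ℕ.≤-reflexive γ≡j) x∈σ)
      ... | tri≈ _ α≡i _ | tri≈ _ γ≡j _ = Fin.toℕ-injective α≡i , Fin.toℕ-injective γ≡j
      ... | tri≈ _ α≡i _ | tri< γ<j _ _ = ⊥-elim (avoids-j σ (sym (ℕ.suc-pred (toℕ j) {{ℕ.>-nonZero (ℕ.≤-<-trans ℕ.z≤n 1+i<j)}}))
              (ℕ.≤-reflexive (sym α≡i)) (ℕ.<⇒≤pred γ<j) x∈σ)

    -- Covering is known only up to double negation, but having prescribed outer corners is
    -- decidable on the finite list `T`. Deciding it first leaves only a refutation to give.
    triangulation-bounded : ∃[ σ ] σ ∈ T × Triangle.i σ ≡ i × Triangle.k σ ≡ j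
    triangulation-bounded with Any.any? (λ σ → (Triangle.i σ Fin.≟ i) ×-dec (Triangle.k σ Fin.≟ j)) T
    ... | yes any = find any
    ... | no none = ⊥-elim (IsTriangulation.covers isT (centroid p q independent a b b≄0 τ)
            (centroid∈Conv p q independent a b b≄0 τ)
            λ covered → let σ , σ∈T , x∈σ = find covered in
              none (Any.map (λ { {σ′} refl → covering-bounds σ∈T x∈σ }) σ∈T))

-- The common sphere

theorem3p1 : (n : ℕ) (p q : Poly₂) → LinearlyIndependent (p ∷ q ∷ 1ₚ ∷ []) →
    (a b : ℝ) → ¬ (b ≃ 0ℝ) →
    let v : Vector (Point 2) (3 ℕ.+ n)
        v = equallySpaced p q a b
    in ∃[ r ] (0ℝ ≤ r × (∀ x → IsVertex (SecondaryPolytope v) x → OnSphere r x))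
theorem3p1 n p q independent a b b≄0 = r , 0≤r , onSphere
  where
  d : ℕ
  d = 2 ℕ.+ n
  v : Vector (Point 2) (suc d)
  v = equallySpaced p q a b
  c : ℝ
  c = areaUnit p q a b
  M : ℚ
  M = normSq (difference {suc d} zero (Fin.fromℕ d))
  0≤M : 0ℚ ℚ.≤ M
  0≤M = normSq-nonneg (Fin.fromℕ d) (ℕ.s≤s ℕ.z≤n)
  -- Every area vector has squared norm `c² M`, with `c` the unit of area and `M` rational; hence
  -- this radius.
  r : ℝ
  r = c * √ M 0≤M
  0≤r : 0ℝ ≤ r
  0≤r = pointwise⇒0≤ r λ m → 0≤p*q
    (0≤p*q (ℚ.<⇒≤ (ℚ.positive⁻¹ ½)) (ℚ.0≤∣p∣ (seq (wronskian p q a b * (b * (b * b))) m)))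
    (0≤√-seq M 0≤M m)
  r²≃ : c * c * fromℚ M ≃ r ^ 2
  r²≃ = ≃-trans {c * c * fromℚ M} {c * c * (√ M 0≤M * √ M 0≤M)} {r ^ 2}
    (*-cong {c * c} {c * c} {fromℚ M} {√ M 0≤M * √ M 0≤M} (≃-refl {c * c})
      (≃-sym {√ M 0≤M * √ M 0≤M} {fromℚ M} (√*√≃M M 0≤M)))
    (pointwise⇒≃ {c * c * (√ M 0≤M * √ M 0≤M)} {r ^ 2} λ m →
      solve 2 (λ c s → c :* c :* (s :* s) := (c :* s) :* ((c :* s) :* con 1ℚ)) refl (seq c m) (√-seq M 0≤M m))
  generator-onSphere : ∀ T → OnSphere r (areaVector v T)
  generator-onSphere T =
    let t , T↭t = ↭-members
          (triangulation-sidesUncrossed p q a b (Triangulation.isTriangulation T))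
          (triangulation-bounded p q independent a b b≄0 (Triangulation.isTriangulation T))
          (IsTriangulation.distinct (Triangulation.isTriangulation T))
          {zero} {Fin.fromℕ d} (ℕ.s≤s ℕ.z≤n) (λ _ → ℕ.z≤n) Fin.≤fromℕ
    in ≃-trans {sum (λ k → areaVector v T k ^ 2)} {c * c * fromℚ M} {r ^ 2}
         (pointwise⇒≃ {sum (λ k → areaVector v T k ^ 2)} {c * c * fromℚ M} (seq-normSq p q a b T t T↭t)) r²≃
  onSphere : ∀ x → IsVertex (SecondaryPolytope v) x → OnSphere r x
  -- Lying on the sphere is an equality of reals and therefore stable, so an area vector equal to
  -- `x` is needed only up to double negation.
  onSphere x vertex = ≃-stable (sum (λ k → x k ^ 2)) (r ^ 2) λ ¬onSphere →
    vertex⇒generator (areaVector v) {x} vertex λ (T , T≈x) → ¬onSphere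
      (≃-trans {sum (λ k → x k ^ 2)} {sum (λ k → areaVector v T k ^ 2)} {r ^ 2}
        (sum-cong {x = λ k → x k ^ 2} {y = λ k → areaVector v T k ^ 2} λ k →
          ^2-cong {x k} {areaVector v T k} (≃-sym {areaVector v T k} {x k} (T≈x k)))
        (generator-onSphere T))
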